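{- For every diagonal $\lambda_+/\lambda_-$ of $R$ and every $w\in S_n$, the filling $T_w$ of $R$ defined below is a standard Young tableau of shape $R$ (its entries are $1,2,\dots,mn$, each once, strictly increasing along rows and down columns). Moreover, $T_w$ does not depend on the choice of the diagonal $\lambda_+/\lambda_-$.
   Context: Fix integers $m\ge n\ge 1$. Young diagrams are drawn in English convention (row $1$ on top); "above" means in a row of smaller index, "to the right" means in a column of larger index. Let $R$ be a rectangular Young diagram with either $n$ rows and $m$ columns, or $m$ rows and $n$ columns. A diagonal of $R$ is a skew shape $\lambda_+/\lambda_-$ ($\lambda_-\subseteq\lambda_+\subseteq R$ Young diagrams) consisting of exactly $n$ boxes $b_1,\dots,b_n$ with $b_{i+1}$ strictly above and strictly to the right of $b_i$ ($1\le i\le n-1$). $T[x]$ is the entry of a filling $T$ in box $x$. Jeu de taquin: for a filling $T$ with entries strictly increasing along rows and columns and an empty box $x$, sliding $x$ through $T$ means: while the empty box has a filled neighbour immediately to its right or immediately below, move the smaller of these entries into the empty box. Reverse-sliding $x$ through $T$ means: while the empty box has a filled neighbour immediately to its left or immediately above, move the larger of these entries into the empty box. The box where the empty box ends is the final position of the sliding path. Construction of $T^{\lambda_+}_w$ ($w\in S_n$): start with $T[b_i]=w(i)$, boxes of $\lambda_-$ unfilled. While the filled boxes are not all of $\lambda_+$: let $\mu\subseteq\lambda_+$ be the Young diagram of unfilled boxes; choose a corner box $x$ of $\mu$ (removing it leaves a Young diagram); slide $x$ through $T$ to get $T'$; if the final position of the path is $b_i$, set $T'[b_i]:=T[b_i]+n$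 ($T[b_i]$ the entry before the slide); replace $T$ by $T'$. Output $T^{\lambda_+}_w$. Construction of $T^{R/\lambda_- }_w$: start with $T[b_i]=w(i)+(m-1)n$, boxes of $R/\lambda_+$ unfilled. While the filled boxes are not all of $R/\lambda_-$: the unfilled boxes of $R/\lambda_-$ form a set $R/\nu$ with $\nu$ a Young diagram; choose a box $x\in R/\nu$ such that $\nu\cup\{x\}$ is a Young diagram; reverse-slide $x$ through $T$ to get $T'$; if the final position of the path is $b_i$, set $T'[b_i]:=T[b_i]-n$; replace $T$ by $T'$. Output $T^{R/\lambda_- }_w$. Both outputs are independent of the choices made. Define $T_w$ on $R$ by $T_w[x]=T^{\lambda_+}_w[x]$ if $x\in\lambda_+$ and $T_w[x]=T^{R/\lambda_- }_w[x]$ otherwise. -}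

module Defs where

open import Data.Nat using (ℕ; zero; suc; _+_; _*_; _∸_; _≤_; _<_)
open import Data.Fin using (Fin; toℕ)
open import Data.Fin.Properties using () renaming (_≟_ to _≟F_)
open import Data.Fin.Permutation using (Permutation; _⟨$⟩ʳ_)
open import Data.Maybe using (Maybe; just; nothing)
import Data.Maybe as Maybe
open import Data.Product using (Σ; ∃; ∃-syntax; _×_; _,_; proj₁; proj₂)
open import Data.Product.Properties using (≡-dec)
open import Data.Sum using (_⊎_)
open import Data.Bool using (if_then_else_)
open import Relation.Nullary using (¬_; does)
open import Relation.Binary.PropositionalEquality using (_≡_; _≢_)

-- Boxes of the r × c rectangle R (0-indexed; row 0 is the top row,
-- column 0 the leftmost column; English convention).

Box : ℕ → ℕ → Set
Box r c = Fin r × Fin c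

module _ {r c : ℕ} where

  row : Box r c → Fin r
  row = proj₁

  col : Box r c → Fin c
  col = proj₂

  _≟B_ : (x y : Box r c) → Relation.Nullary.Dec (x ≡ y)
  _≟B_ = ≡-dec _≟F_ _≟F_

record Shape (r c : ℕ) : Set where
  field
    len     : Fin r → ℕ
    len≤c   : ∀ i → len i ≤ c
    antitone : ∀ i i′ → toℕ i ≤ toℕ i′ → len i′ ≤ len i
open Shape public

_∈ₛ_ : ∀ {r c} → Box r c → Shape r c → Set
x ∈ₛ s = toℕ (col x) < len s (row x)

IsYoung : ∀ {r c} → (Box r c → Set) → Set
IsYoung {r} {c} P = ∀ (i i′ : Fin r) (j j′ : Fin c) →
  toℕ i′ ≤ toℕ i → toℕ j′ ≤ toℕ j → P (i , j) → P (i′ , j′)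

record Diagonal (r c n : ℕ) : Set where
  field
    lower upper : Shape r c
    lower⊆upper : ∀ i → len lower i ≤ len upper i
    b           : Fin n → Box r c
    b-in-skew   : ∀ k → (b k ∈ₛ upper) × ¬ (b k ∈ₛ lower)
    skew-in-b   : ∀ x → x ∈ₛ upper → ¬ (x ∈ₛ lower) → ∃[ k ] b k ≡ x
    staircase   : ∀ k k′ → toℕ k′ ≡ suc (toℕ k) →
                  (toℕ (row (b k′)) < toℕ (row (b k))) ×
                  (toℕ (col (b k)) < toℕ (col (b k′)))
open Diagonal public

Filling : ℕ → ℕ → Set
Filling r c = Box r c → Maybe ℕ

module _ {r c : ℕ} where

  Filled : Filling r c → Box r c → Set
  Filled T y = ∃[ v ] T y ≡ just v

  upd : Filling r c → Box r c → Maybe ℕ → Filling r c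
  upd T x v y = if does (y ≟B x) then v else T y

  RightOf Below Fwd : Box r c → Box r c → Set
  RightOf x y = (row y ≡ row x) × (toℕ (col y) ≡ suc (toℕ (col x)))
  Below   x y = (toℕ (row y) ≡ suc (toℕ (row x))) × (col y ≡ col x)
  Fwd x y = RightOf x y ⊎ Below x y

  -- Jeu de taquin slide of the empty box x through T;
  -- Slide T x T′ f : the result is T′ and the final position is f.
  data Slide : Filling r c → Box r c → Filling r c → Box r c → Set where
    stop : ∀ {T x} → (∀ y → Fwd x y → ¬ Filled T y) → Slide T x T x
    step : ∀ {T x T′ f} y v → Fwd x y → T y ≡ just v →
           (∀ z u → Fwd x z → T z ≡ just u → v ≤ u) →
           Slide (upd (upd T x (just v)) y nothing) y T′ f →
           Slide T x T′ f

  data RSlide : Filling r c → Box r c → Filling r c → Box r c → Set where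
    stop : ∀ {T x} → (∀ y → Fwd y x → ¬ Filled T y) → RSlide T x T x
    step : ∀ {T x T′ f} y v → Fwd y x → T y ≡ just v →
           (∀ z u → Fwd z x → T z ≡ just u → u ≤ v) →
           RSlide (upd (upd T x (just v)) y nothing) y T′ f →
           RSlide T x T′ f

  Init : ∀ {n} → (Fin n → Box r c) → (Fin n → ℕ) → Filling r c → Set
  Init b val T = (∀ k → T (b k) ≡ just (val k)) ×
                 (∀ x → (∀ k → b k ≢ x) → T x ≡ nothing)

  FilledExactly : Filling r c → (Box r c → Set) → Set
  FilledExactly T P = ∀ y → (Filled T y → P y) × (P y → Filled T y)

module Plus {r c n : ℕ} (d : Diagonal r c n) where

  μ : Filling r c → Box r c → Set
  μ T y = (y ∈ₛ upper d) × (T y ≡ nothing)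

  Corner : Filling r c → Box r c → Set
  Corner T x = μ T x × IsYoung (λ y → μ T y × y ≢ x)

  data Step (T : Filling r c) : Filling r c → Set where
    diag  : ∀ x k T′ → Corner T x → Slide T x T′ (b d k) →
            Step T (upd T′ (b d k) (Maybe.map (_+ n) (T (b d k))))
    other : ∀ x f T′ → Corner T x → Slide T x T′ f → (∀ k → b d k ≢ f) →
            Step T T′

  data Run : Filling r c → Filling r c → Set where
    done : ∀ {T} → FilledExactly T (_∈ₛ upper d) → Run T T
    more : ∀ {T T′ T″} → ¬ FilledExactly T (_∈ₛ upper d) →
           Step T T′ → Run T′ T″ → Run T T″

  Output : Permutation n n → Filling r c → Set
  Output w T = ∃[ T₀ ] Init (b d) (λ k → suc (toℕ (w ⟨$⟩ʳ k))) T₀ × Run T₀ T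

module Minus {r c n : ℕ} (m : ℕ) (d : Diagonal r c n) where

  -- ν : λ₋ together with the filled boxes (unfilled boxes of R/λ₋ = R/ν)
  ν : Filling r c → Box r c → Set
  ν T y = (y ∈ₛ lower d) ⊎ Filled T y

  Addable : Filling r c → Box r c → Set
  Addable T x = ¬ ν T x × IsYoung (λ y → ν T y ⊎ y ≡ x)

  data Step (T : Filling r c) : Filling r c → Set where
    diag  : ∀ x k T′ → Addable T x → RSlide T x T′ (b d k) →
            Step T (upd T′ (b d k) (Maybe.map (_∸ n) (T (b d k))))
    other : ∀ x f T′ → Addable T x → RSlide T x T′ f → (∀ k → b d k ≢ f) →
            Step T T′

  NotLower : Box r c → Set
  NotLower y = ¬ (y ∈ₛ lower d)

  data Run : Filling r c → Filling r c → Set where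
    done : ∀ {T} → FilledExactly T NotLower → Run T T
    more : ∀ {T T′ T″} → ¬ FilledExactly T NotLower →
           Step T T′ → Run T′ T″ → Run T T″

  Output : Permutation n n → Filling r c → Set
  Output w T = ∃[ T₀ ] Init (b d) (λ k → suc (toℕ (w ⟨$⟩ʳ k)) + (m ∸ 1) * n) T₀
                       × Run T₀ T

-- T_w : T is a possible result of the combined construction.

TW : ∀ {r c n} (m : ℕ) → Diagonal r c n → Permutation n n → Filling r c → Set
TW {r} {c} m d w T =
  ∃[ T⁺ ] ∃[ T⁻ ] Plus.Output d w T⁺ × Minus.Output m d w T⁻ ×
    (∀ (x : Box r c) → (x ∈ₛ upper d → T x ≡ T⁺ x) × (¬ (x ∈ₛ upper d) → T x ≡ T⁻ x))

SYT : ∀ {r c} → Filling r c → Set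
SYT {r} {c} T =
  (∀ x → ∃[ v ] (T x ≡ just v × 1 ≤ v × v ≤ r * c)) ×
  (∀ v → 1 ≤ v → v ≤ r * c →
     ∃[ x ] (T x ≡ just v × (∀ y → T y ≡ just v → y ≡ x))) ×
  (∀ i j j′ v v′ → toℕ j < toℕ j′ → T (i , j) ≡ just v → T (i , j′) ≡ just v′ → v < v′) ×
  (∀ i i′ j v v′ → toℕ i < toℕ i′ → T (i , j) ≡ just v → T (i′ , j) ≡ just v′ → v < v′)

{-# OPTIONS --safe #-}
module Submission where

-- Number the entries from 0, so that u and u + n enter through the same
-- diagonal box, and encode a tableau by the word R of the rows and the word C
-- of the columns of the entries 0, 1, 2, ...; an entry that has not entered
-- yet carries the coordinates of its diagonal box.  A vertical move of a slide
-- lowers one letter of R under a ballot condition, hence it cannot increase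
-- the maximal total length of k weakly decreasing chains in a window of R;
-- likewise for horizontal moves and C.  For the staircase diagonal the
-- resulting bounds for rows and columns add up to an equality, which forces
-- the entry of the diagonal box in row i to be w i + q i * n with
-- q i + asc i = i + asc (n - 1 - i), where asc i counts the ascents of w
-- before i.  Neighbouring diagonal entries then differ by less than n, so
-- deleting the smallest entry and sliding preserves the chain lengths; doing
-- this a multiple of n times yields a tableau whose row and column words
-- attain the maximal chain lengths of the periodic word of classes.  By
-- induction on u the rows of every completed T⁺ agree with it, so T⁺ is the
-- restriction of one infinite tableau that does not depend on the diagonal.
-- Rotation by 180 degrees gives the same for T⁻, and by the formula for q the
-- two infinite tableaux agree on the band of all boxes that lie on diagonals.

open import Defs hiding (row; col)
import Defs
open import Data.Nat
open import Data.Nat.Properties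
open import Data.Nat.DivMod
open import Data.Nat.Divisibility using (n∣m*n)
open import Data.Nat.Induction using (<-rec)
open import Data.Nat.Solver using (module +-*-Solver)
open import Data.Fin using (Fin; zero; suc; toℕ; fromℕ<)
import Data.Fin.Properties as Fin
open import Data.Fin.Permutation using (Permutation; _⟨$⟩ʳ_; _⟨$⟩ˡ_; inverseˡ; inverseʳ)
open import Data.Bool using (Bool; true; false; if_then_else_; _∧_; _∨_; not)
open import Data.Bool.Properties using (∧-identityʳ)
open import Data.Maybe using (just; nothing)
open import Data.Maybe.Properties using (just-injective)
import Data.Maybe as Maybe
open import Data.Product
open import Data.Sum using (_⊎_; inj₁; inj₂)
open import Data.Empty using (⊥; ⊥-elim)
open import Function using (_∘_; id; case_of_; flip)
open import Relation.Nullary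
open import Relation.Nullary.Decidable using (dec-true; dec-false)
open import Relation.Binary.PropositionalEquality
open import Relation.Binary.Definitions using (tri<; tri≈; tri>)
open import Algebra.Properties.CommutativeSemigroup +-commutativeSemigroup using (x∙yz≈y∙xz; interchange)

-- Families of chains in a word

-- The words are infinite on purpose. The entry that refills a diagonal box already carries the
-- coordinates of that box, so adding `n` there changes neither word, and only the moves of the
-- empty box have to be compared. For one move this is Greene's theorem split into two halves. The
-- ballot condition before the moved entry always holds and shows that chains do not get longer.
-- That they do not get shorter needs the mirrored condition after the moved entry, which involves
-- entries that have not entered yet: the next entry of row `r + 1` has to come after the last
-- entered entry of row `r`. This is the bound by `n`, and it can be read off only once the diagonal
-- entries are known. For the staircase they are known because the one-sided bounds for rows and
-- columns leave no slack. An arbitrary diagonal is then treated with the one-sided bounds alone,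
-- since the tableau built from the staircase already attains the maxima.

b2n : Bool → ℕ
b2n true = 1
b2n false = 0

cnt : (ℕ → Bool) → ℕ → ℕ
cnt p zero = 0
cnt p (suc V) = b2n (p V) + cnt p V

is : ℕ → ℕ → Bool
is a b = does (a ≟ b)

is-t : ∀ {a b} → a ≡ b → is a b ≡ true
is-t {a} {b} eq = dec-true (a ≟ b) eq

is-f : ∀ {a b} → a ≢ b → is a b ≡ false
is-f {a} {b} ne = dec-false (a ≟ b) ne

is-T : ∀ {a b} → is a b ≡ true → a ≡ b
is-T {a} {b} eq with a ≟ b
... | yes p = p
... | no np with trans (sym eq) (is-f np)
... | ()

lt : ℕ → ℕ → Bool
lt a b = does (a <? b)

lt-t : ∀ {a b} → a < b → lt a b ≡ true
lt-t {a} {b} p = dec-true (a <? b) p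

lt-f : ∀ {a b} → b ≤ a → lt a b ≡ false
lt-f {a} {b} p = dec-false (a <? b) (≤⇒≯ p)

lt-T : ∀ {a b} → lt a b ≡ true → a < b
lt-T {a} {b} eq with a <? b
... | yes p = p
... | no np with trans (sym eq) (lt-f (≮⇒≥ np))
... | ()

cnt-cong : ∀ {p q} V → (∀ u → u < V → p u ≡ q u) → cnt p V ≡ cnt q V
cnt-cong zero h = refl
cnt-cong (suc V) h = cong₂ _+_ (cong b2n (h V ≤-refl)) (cnt-cong V λ u l → h u (m≤n⇒m≤1+n l))

cnt-mono-V : ∀ p {V W} → V ≤ W → cnt p V ≤ cnt p W
cnt-mono-V p {V} {zero} z≤n = ≤-refl
cnt-mono-V p {V} {suc W} l with m≤n⇒m<n∨m≡n l
... | inj₂ refl = ≤-refl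
... | inj₁ (s≤s l′) = ≤-trans (cnt-mono-V p l′) (m≤n+m _ (b2n (p W)))

cnt-mono-p : ∀ {p q} V → (∀ u → u < V → p u ≡ true → q u ≡ true) → cnt p V ≤ cnt q V
cnt-mono-p zero h = z≤n
cnt-mono-p {p} {q} (suc V) h = +-mono-≤ (g (p V) (q V) (h V ≤-refl)) (cnt-mono-p V λ u l → h u (m≤n⇒m≤1+n l))
  where
  g : ∀ a b → (a ≡ true → b ≡ true) → b2n a ≤ b2n b
  g false b f = z≤n
  g true b f rewrite f refl = ≤-refl

cnt-take : ∀ p V → p V ≡ true → cnt p (suc V) ≡ suc (cnt p V)
cnt-take p V eq rewrite eq = refl

cnt-skip : ∀ p V → p V ≡ false → cnt p (suc V) ≡ cnt p V
cnt-skip p V eq rewrite eq = refl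

cnt-+ : ∀ p s d → cnt p (s + d) ≡ cnt p s + cnt (λ x → p (s + x)) d
cnt-+ p s zero rewrite +-identityʳ s = sym (+-identityʳ _)
cnt-+ p s (suc d) rewrite +-suc s d | cnt-+ p s d = begin
  b2n (p (s + d)) + (cnt p s + c) ≡⟨ sym (+-assoc (b2n (p (s + d))) (cnt p s) c) ⟩
  b2n (p (s + d)) + cnt p s + c ≡⟨ cong (_+ c) (+-comm (b2n (p (s + d))) (cnt p s)) ⟩
  cnt p s + b2n (p (s + d)) + c ≡⟨ +-assoc (cnt p s) _ c ⟩
  cnt p s + (b2n (p (s + d)) + c) ∎
  where
  open ≡-Reasoning
  c = cnt (λ x → p (s + x)) d

-- An order-preserving matching cannot send two positions to one. The topmost hit is matched first
-- and its partner `u₁` becomes the new bound, so strict monotonicity of the relation is all that is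
-- required.
cnt-inj : ∀ {P Q : ℕ → Bool} (Φ : ℕ → ℕ → Set) →
  (∀ {u u₁ v v₁} → Φ u u₁ → Φ v v₁ → u < v → u₁ < v₁) →
  ∀ τ B → (∀ u → u < τ → P u ≡ true → ∃ λ u₁ → Φ u u₁ × u₁ < B × Q u₁ ≡ true) →
  cnt P τ ≤ cnt Q B
cnt-inj Φ mono zero B h = z≤n
cnt-inj {P} {Q} Φ mono (suc τ) B h with P τ in eq
... | false = cnt-inj Φ mono τ B λ u l → h u (m≤n⇒m≤1+n l)
... | true with h τ ≤-refl eq
... | u₁ , φ , l₁ , q = ≤-trans (s≤s (cnt-inj Φ mono τ u₁ rec))
                          (≤-trans (≤-reflexive (sym (cnt-take Q u₁ q))) (cnt-mono-V Q l₁))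
  where
  rec : ∀ u → u < τ → P u ≡ true → ∃ λ u₂ → Φ u u₂ × u₂ < u₁ × Q u₂ ≡ true
  rec u l pu with h u (m≤n⇒m≤1+n l) pu
  ... | u₂ , φ₂ , _ , q₂ = u₂ , φ₂ , mono φ₂ φ l , q₂

module _ {k : ℕ} where

  _[_≔_] : (Fin k → ℕ) → Fin k → ℕ → Fin k → ℕ
  (g [ i ≔ x ]) j = if does (j Fin.≟ i) then x else g j

  upd-ind : ∀ (P : Fin k → ℕ → Set) g i x → P i x → (∀ j → j ≢ i → P j (g j)) →
            ∀ j → P j ((g [ i ≔ x ]) j)
  upd-ind P g i x p q j with j Fin.≟ i
  ... | yes refl = p
  ... | no ne = q j ne

  upd-≡ : ∀ g i x → (g [ i ≔ x ]) i ≡ x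
  upd-≡ g i x with i Fin.≟ i
  ... | yes _ = refl
  ... | no ne = ⊥-elim (ne refl)

  upd-≢ : ∀ g i x {j} → j ≢ i → (g [ i ≔ x ]) j ≡ g j
  upd-≢ g i x {j} ne with j Fin.≟ i
  ... | yes eq = ⊥-elim (ne eq)
  ... | no _ = refl

  _⊑_ : (Fin k → ℕ) → (Fin k → ℕ) → Set
  g ⊑ h = ∀ j → g j ≤ h j

  ⊑-upd : ∀ {g h} i x → (∀ j → j ≢ i → g j ≤ h j) → g i ≤ x → g ⊑ (h [ i ≔ x ])
  ⊑-upd {g} {h} i x p q = upd-ind (λ j y → g j ≤ y) h i x q p

  upd-⊑ : ∀ {g h} i x → (∀ j → j ≢ i → g j ≤ h j) → x ≤ h i → (g [ i ≔ x ]) ⊑ h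
  upd-⊑ {g} {h} i x p q = upd-ind (λ j y → y ≤ h j) g i x q p

  upd-mono : ∀ {g h} i {x z} → (∀ j → j ≢ i → g j ≤ h j) → x ≤ z → (g [ i ≔ x ]) ⊑ (h [ i ≔ z ])
  upd-mono {g} {h} i {x} {z} p q j with j Fin.≟ i
  ... | yes _ = q
  ... | no ne = p j ne

-- k disjoint chains, weakly decreasing in the letters, among the first V
-- letters of y; m is their total length and g bounds the letters of each
-- chain from below.
data Fam {k : ℕ} (y : ℕ → ℕ) : ℕ → ℕ → (Fin k → ℕ) → Set where
  nil  : ∀ {g} → Fam y 0 0 g
  skip : ∀ {V m g} → Fam y V m g → Fam y (suc V) m g
  take : ∀ {V m g} i → g i ≤ y V → Fam y V m (g [ i ≔ y V ]) → Fam y (suc V) (suc m) g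

Has : ℕ → (ℕ → ℕ) → ℕ → ℕ → Set
Has k y V m = ∃ λ m₁ → m ≤ m₁ × Fam {k} y V m₁ (λ _ → 0)

Fam-mono : ∀ {k y V m} {g h : Fin k → ℕ} → h ⊑ g → Fam y V m g → Fam y V m h
Fam-mono l nil = nil
Fam-mono l (skip F) = skip (Fam-mono l F)
Fam-mono l (take i p F) = take i (≤-trans (l i) p) (Fam-mono (upd-mono i (λ j _ → l j) ≤-refl) F)

Fam-map : ∀ {k y z V m} {g h : Fin k → ℕ} → (∀ u v → u < V → v < V → y u ≤ y v → z u ≤ z v) →
          (∀ i u → u < V → g i ≤ y u → h i ≤ z u) → Fam y V m g → Fam z V m h
Fam-map c b nil = nil
Fam-map c b (skip F) = skip (Fam-map (λ u v l l′ → c u v (m≤n⇒m≤1+n l) (m≤n⇒m≤1+n l′)) (λ i u l → b i u (m≤n⇒m≤1+n l)) F)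
Fam-map {y = y} {z} {suc V} {g = g} {h} c b (take i p F) = take i (b i V ≤-refl p)
  (Fam-map (λ u v l l′ → c u v (m≤n⇒m≤1+n l) (m≤n⇒m≤1+n l′)) b′ F)
  where
  b′ : ∀ j u → u < V → (g [ i ≔ y V ]) j ≤ y u → (h [ i ≔ z V ]) j ≤ z u
  b′ j u l with j Fin.≟ i
  ... | yes _ = c V u ≤-refl (m≤n⇒m≤1+n l)
  ... | no _ = b j u (m≤n⇒m≤1+n l)

Fam-cong : ∀ {k y z V m} {g : Fin k → ℕ} → (∀ u → u < V → y u ≡ z u) → Fam y V m g → Fam z V m g
Fam-cong e = Fam-map (λ u v l l′ → subst₂ _≤_ (e u l) (e v l′)) (λ i u l → subst (_ ≤_) (e u l))

module _ {k : ℕ} (a b : Fin k) where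

  tp : Fin k → Fin k
  tp j = if does (j Fin.≟ a) then b else if does (j Fin.≟ b) then a else j

  tp-invol : ∀ j → tp (tp j) ≡ j
  tp-invol j with j Fin.≟ a
  tp-invol j | yes refl with b Fin.≟ a
  ... | yes refl = refl
  ... | no _ with b Fin.≟ b
  ... | yes _ = refl
  ... | no ne = ⊥-elim (ne refl)
  tp-invol j | no ja with j Fin.≟ b
  tp-invol j | no ja | yes refl with a Fin.≟ a
  ... | yes _ = refl
  ... | no ne = ⊥-elim (ne refl)
  tp-invol j | no ja | no jb with j Fin.≟ a
  ... | yes p = ⊥-elim (ja p)
  ... | no _ with j Fin.≟ b
  ... | yes p = ⊥-elim (jb p)
  ... | no _ = refl

  -- Serves the case of `exchange` in which two chains trade their earlier parts.
  Fam-swap : ∀ {y V m} {g : Fin k → ℕ} → Fam y V m g → Fam y V m (g ∘ tp)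
  Fam-swap nil = nil
  Fam-swap (skip F) = skip (Fam-swap F)
  Fam-swap {y} {suc V} {g = g} (take i p F) = take (tp i) (subst (λ x → g x ≤ _) (sym (tp-invol i)) p)
    (Fam-mono h (Fam-swap F))
    where
    h : ((g ∘ tp) [ tp i ≔ y V ]) ⊑ ((g [ i ≔ y V ]) ∘ tp)
    h j with j Fin.≟ tp i
    ... | yes refl = ≤-reflexive (sym (trans (cong (g [ i ≔ y V ]) (tp-invol i)) (upd-≡ g i (y V))))
    ... | no ne = ≤-reflexive (sym (upd-≢ g i (y V) λ eq → ne (trans (sym (tp-invol j)) (cong tp eq))))

-- α τ and β τ count the letters r and r + 1 at the positions from τ on.
record Surplus (y : ℕ → ℕ) (r V : ℕ) (α β : ℕ → ℕ) : Set where
  field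
    at-r  : ∀ {τ} → τ < V → y τ ≡ r → α τ ≡ suc (α (suc τ)) × β τ ≡ β (suc τ)
    at-r₁ : ∀ {τ} → τ < V → y τ ≡ suc r → α τ ≡ α (suc τ) × β τ ≡ suc (β (suc τ))
    at-o  : ∀ {τ} → τ < V → y τ ≢ r → y τ ≢ suc r → α τ ≡ α (suc τ) × β τ ≡ β (suc τ)
    α≤β   : ∀ {τ} → τ ≤ V → α τ ≤ β τ

Surplus-pred : ∀ {y r V α β} → Surplus y r (suc V) α β → Surplus y r V α β
Surplus-pred B = record { at-r = at-r ∘ m≤n⇒m≤1+n ; at-r₁ = at-r₁ ∘ m≤n⇒m≤1+n
                    ; at-o = at-o ∘ m≤n⇒m≤1+n ; α≤β = α≤β ∘ m≤n⇒m≤1+n }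
  where open Surplus B

-- The exchange lemma: a chain bounded by r can be kept above r at the cost
-- of the surplus β − α, unless another chain is bounded by r + 1.
exchange : ∀ {k y r α β} V → Surplus y r V α β → ∀ {m} {g : Fin k → ℕ} X → g X ≡ r → Fam y V m g →
  (∃ λ W → W ≢ X × g W ≡ suc r) ⊎
  (∃ λ m₁ → m + α V ≤ m₁ + β V × Fam y V m₁ (g [ X ≔ suc r ]))
exchange zero B X gX nil = inj₂ (0 , Surplus.α≤β B z≤n , nil)
exchange {y = y} {r} {α} {β} (suc V) B {m} {g} X gX (skip F) with exchange V (Surplus-pred B) X gX F
... | inj₁ w = inj₁ w
... | inj₂ (m₁ , le , G) with y V ≟ r
... | yes q with Surplus.at-r B ≤-refl q
... | a , b = inj₂ (m₁ , ≤-trans (+-monoʳ-≤ m (≤-trans (n≤1+n _) (≤-reflexive (sym a))))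
                          (≤-trans le (≤-reflexive (cong (m₁ +_) b))) , skip G)
exchange {y = y} {r} {α} {β} (suc V) B {m} {g} X gX (skip F) | inj₂ (m₁ , le , G) | no nq with y V ≟ suc r
... | yes q₁ with Surplus.at-r₁ B ≤-refl q₁
-- A letter `r + 1` that no chain uses joins the chain `X`: this is the gain recorded by `β`.
... | a , b = inj₂ (suc m₁ ,
    ≤-trans (≤-reflexive (cong (m +_) (sym a))) (≤-trans le (≤-reflexive (trans (cong (m₁ +_) b) (+-suc m₁ _)))) ,
    take X (≤-reflexive (trans (upd-≡ g X (suc r)) (sym q₁)))
      (Fam-mono (λ j → upd-ind (λ j x → x ≤ (g [ X ≔ suc r ]) j) (g [ X ≔ suc r ]) X (y V)
         (≤-reflexive (trans q₁ (sym (upd-≡ g X (suc r))))) (λ _ _ → ≤-refl) j) G))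
exchange (suc V) B {m} X gX (skip F) | inj₂ (m₁ , le , G) | no nq | no nq₁ with Surplus.at-o B ≤-refl nq nq₁
... | a , b = inj₂ (m₁ , subst₂ _≤_ (cong (m +_) a) (cong (m₁ +_) b) le , skip G)
exchange {y = y} {r} {α} {β} (suc V) B {suc m} {g} X gX (take i p F) with i Fin.≟ X
exchange {y = y} {r} {α} {β} (suc V) B {suc m} {g} X gX (take i p F) | yes refl with m≤n⇒m<n∨m≡n (subst (_≤ y V) gX p)
... | inj₁ r<y = inj₂ (suc m , +-monoʳ-≤ (suc m) (Surplus.α≤β B ≤-refl) ,
    take X (≤-trans (≤-reflexive (upd-≡ g X (suc r))) r<y)
      (Fam-mono (upd-mono X (λ j ne → ≤-reflexive (upd-≢ g X (suc r) ne)) ≤-refl) F))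
... | inj₂ r≡y with exchange V (Surplus-pred B) X (trans (upd-≡ g X (y V)) (sym r≡y)) F
... | inj₁ (W , ne , gW) = inj₁ (W , ne , trans (sym (upd-≢ g X (y V) ne)) gW)
... | inj₂ (m₁ , le , G) with Surplus.at-r B ≤-refl (sym r≡y)
-- The letter `r` is dropped from the chain `X`; the loss of one is the amount by which `α V`
-- exceeds `α (suc V)`.
... | a , b = inj₂ (m₁ , ≤-trans (≤-reflexive (trans (sym (+-suc m (α (suc V)))) (cong (m +_) (sym a)))) (≤-trans le (≤-reflexive (cong (m₁ +_) b))) ,
    skip (Fam-mono (upd-mono X (λ j ne → ≤-reflexive (sym (upd-≢ g X (y V) ne))) ≤-refl) G))
exchange {y = y} {r} {α} {β} (suc V) B {suc m} {g} X gX (take i p F) | no i≢X with y V ≟ suc r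
exchange {y = y} {r} {α} {β} (suc V) B {suc m} {g} X gX (take i p F) | no i≢X | yes q₁ with g i ≟ suc r
... | yes gi = inj₁ (i , i≢X , gi)
-- The chains `X` and `i` trade their earlier parts: `X` takes the letter `r + 1`, and `i` inherits
-- the bound `r`, which suffices because its own bound is at most `r + 1` and differs from `r + 1`.
... | no gi = inj₂ (suc m , +-monoʳ-≤ (suc m) (Surplus.α≤β B ≤-refl) ,
    take X (≤-reflexive (trans (upd-≡ g X (suc r)) (sym q₁))) (Fam-mono h (Fam-swap X i F)))
  where
  g₁ = g [ i ≔ y V ]
  h : ((g [ X ≔ suc r ]) [ X ≔ y V ]) ⊑ (g₁ ∘ tp X i)
  h j with j Fin.≟ X
  ... | yes refl = ≤-reflexive (sym (upd-≡ g i (y V)))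
  ... | no jX with j Fin.≟ i
  ... | yes refl = ≤-trans (s≤s⁻¹ (≤∧≢⇒< (subst (g j ≤_) q₁ p) gi))
                     (≤-reflexive (sym (trans (upd-≢ g j (y V) (≢-sym jX)) gX)))
  ... | no ji = ≤-reflexive (sym (upd-≢ g i (y V) ji))
exchange {y = y} {r} {α} {β} (suc V) B {suc m} {g} X gX (take i p F) | no i≢X | no nq₁
  with exchange V (Surplus-pred B) X (trans (upd-≢ g i (y V) (≢-sym i≢X)) gX) F
... | inj₁ (W , ne , gW) = inj₁ (W , ne , trans (sym (upd-≢ g i (y V) W≢i)) gW)
  where
  W≢i : W ≢ i
  W≢i refl = nq₁ (trans (sym (upd-≡ g i (y V))) gW)
... | inj₂ (m₁ , le , G) = inj₂ (suc m₁ , s≤s (bound (y V ≟ r)) ,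
    take i (≤-trans (≤-reflexive (upd-≢ g X (suc r) i≢X)) p) (Fam-mono h G))
  where
  bound : Dec (y V ≡ r) → m + α (suc V) ≤ m₁ + β (suc V)
  bound (yes q) with Surplus.at-r B ≤-refl q
  ... | a , b = ≤-trans (+-monoʳ-≤ m (≤-trans (n≤1+n _) (≤-reflexive (sym a)))) (≤-trans le (≤-reflexive (cong (m₁ +_) b)))
  bound (no q) with Surplus.at-o B ≤-refl q nq₁
  ... | a , b = subst₂ _≤_ (cong (m +_) a) (cong (m₁ +_) b) le
  h : ((g [ X ≔ suc r ]) [ i ≔ y V ]) ⊑ ((g [ i ≔ y V ]) [ X ≔ suc r ])
  h = upd-⊑ i (y V) h₁ (≤-reflexive (sym (trans (upd-≢ (g [ i ≔ y V ]) X (suc r) i≢X) (upd-≡ g i (y V)))))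
    where
    h₁ : ∀ j → j ≢ i → (g [ X ≔ suc r ]) j ≤ ((g [ i ≔ y V ]) [ X ≔ suc r ]) j
    h₁ j ji with j Fin.≟ X
    ... | yes _ = ≤-refl
    ... | no _ = ≤-reflexive (sym (upd-≢ g i (y V) ji))

∸-suc′ : ∀ {m n} → n < m → m ∸ n ≡ suc (m ∸ suc n)
∸-suc′ {suc m} {zero} l = refl
∸-suc′ {suc m} {suc n} (s≤s l) = ∸-suc′ l

-- Bracket every letter `r` before `v` with a later letter `r + 1`, as for crystal operators: the
-- condition says that each of them finds a partner before `v`.
Ballot : (ℕ → ℕ) → ℕ → ℕ → Set
Ballot y r v = ∀ s d → s + d ≡ v →
  cnt (λ x → is (y (s + x)) r) d ≤ cnt (λ x → is (y (s + x)) (suc r)) d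

module _ {y : ℕ → ℕ} {r v : ℕ} (B : Ballot y r v) where
  private
    rest : ℕ → ℕ → ℕ
    rest a τ = cnt (λ u → is (y u) a) v ∸ cnt (λ u → is (y u) a) τ

    hit : ∀ {a τ} → τ < v → y τ ≡ a → rest a τ ≡ suc (rest a (suc τ))
    hit {a} {τ} l q = trans (∸-suc′ (≤-trans (≤-reflexive (sym (cnt-take p τ (is-t q)))) (cnt-mono-V p l)))
                          (cong (λ z → suc (cnt p v ∸ z)) (sym (cnt-take p τ (is-t q))))
      where p = λ u → is (y u) a

    miss : ∀ {a τ} → y τ ≢ a → rest a τ ≡ rest a (suc τ)
    miss {a} {τ} q = cong (cnt p v ∸_) (sym (cnt-skip p τ (is-f q)))
      where p = λ u → is (y u) a

  surplus : Surplus y r v (rest r) (rest (suc r))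
  surplus = record
    { at-r = λ l q → hit l q , miss (λ q₁ → m≢1+m+n r (trans (sym q) (trans q₁ (cong suc (sym (+-identityʳ r))))))
    ; at-r₁ = λ l q → miss (λ q₁ → m≢1+m+n r (trans (sym q₁) (trans q (cong suc (sym (+-identityʳ r)))))) , hit l q
    ; at-o = λ l q q₁ → miss q , miss q₁
    ; α≤β = le }
    where
    le : ∀ {τ} → τ ≤ v → rest r τ ≤ rest (suc r) τ
    le {τ} l = subst₂ _≤_ (eq r) (eq (suc r)) (B τ (v ∸ τ) (m+[n∸m]≡n l))
      where
      eq : ∀ a → cnt (λ x → is (y (τ + x)) a) (v ∸ τ) ≡ rest a τ
      eq a = sym (trans (cong (λ z → cnt p z ∸ cnt p τ) (sym (m+[n∸m]≡n l)))
                 (trans (cong (_∸ cnt p τ) (cnt-+ p τ (v ∸ τ))) (m+n∸m≡n (cnt p τ) _)))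
        where p = λ u → is (y u) a

  -- Only the chain that uses position `v` can break, because its earlier letters may equal `r`
  -- while the letter at `v` is `r + 1` in `y`. Either `exchange` rids it of these letters without
  -- loss, or another chain is already bounded by `r + 1` and takes the letter at `v` over.
  pull : ∀ {k} {y′ : ℕ → ℕ} → (∀ u → u ≢ v → y′ u ≡ y u) → y′ v ≡ r → y v ≡ suc r →
         ∀ {V m} {g : Fin k → ℕ} → Fam y′ V m g → ∃ λ m₁ → m ≤ m₁ × Fam y V m₁ g
  pull ag e′ e nil = 0 , z≤n , nil
  pull {y′ = y′} ag e′ e {suc V} {g = g} F with <-cmp V v
  ... | tri< l _ _ = _ , ≤-refl , Fam-cong (λ u lu → ag u (<⇒≢ (<-≤-trans lu l))) F
  pull ag e′ e (skip F) | tri≈ _ refl _ = _ , ≤-refl , skip (Fam-cong (λ u lu → ag u (<⇒≢ lu)) F)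
  pull {y′ = y′} ag e′ e {suc V} {suc m} {g = g} (take i p F) | tri≈ _ refl _
    with exchange V surplus i (trans (upd-≡ g i (y′ V)) e′) (Fam-cong (λ u lu → ag u (<⇒≢ lu)) F)
  ... | inj₁ (W , ne , gW) = _ , ≤-refl , take W (≤-trans (≤-reflexive (trans (sym (upd-≢ g i (y′ V) ne)) gW)) (≤-reflexive (sym e)))
        (Fam-mono h (Fam-cong (λ u lu → ag u (<⇒≢ lu)) F))
    where
    h : (g [ W ≔ y V ]) ⊑ (g [ i ≔ y′ V ])
    h = upd-⊑ W (y V) (λ j _ → ⊑-upd i (y′ V) (λ j _ → ≤-refl) p j) (≤-reflexive (trans e (sym gW)))
  ... | inj₂ (m₁ , le , G) = suc m₁ , s≤s (subst₂ _≤_ (trans (cong (m +_) (n∸n≡0 (cnt (λ u → is (y u) r) V))) (+-identityʳ m))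
                                                (trans (cong (m₁ +_) (n∸n≡0 (cnt (λ u → is (y u) (suc r)) V))) (+-identityʳ m₁)) le) ,
        take i (≤-trans p (≤-trans (≤-reflexive e′) (≤-trans (n≤1+n r) (≤-reflexive (sym e)))))
          (Fam-mono (upd-mono i (λ j ne → ≤-reflexive (sym (upd-≢ g i (y′ V) ne))) (≤-reflexive e)) G)
  pull ag e′ e (skip F) | tri> _ _ l with pull ag e′ e F
  ... | m₁ , le , G = m₁ , le , skip G
  pull {y′ = y′} ag e′ e {suc V} {g = g} (take i p F) | tri> _ V≢v l with pull ag e′ e F
  ... | m₁ , le , G = suc m₁ , s≤s le , take i (subst (g i ≤_) (ag V (>⇒≢ l)) p)
        (subst (λ z → Fam y V m₁ (g [ i ≔ z ])) (ag V (>⇒≢ l)) G)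

-- All windows are compared, not only prefixes, because promotion deletes the first letter and the
-- relation has to survive this (`≼-suc`).
record _≼_ (y z : ℕ → ℕ) : Set where
  field ≼-Has : ∀ k s V m → Has k (y ∘ (s +_)) V m → Has k (z ∘ (s +_)) V m
open _≼_ public

≼-refl : ∀ {y} → y ≼ y
≼-refl .≼-Has k s V m h = h

≼-trans : ∀ {x y z} → x ≼ y → y ≼ z → x ≼ z
≼-trans p q .≼-Has k s V m h = q .≼-Has k s V m (p .≼-Has k s V m h)

≼-suc : ∀ {y z} → y ≼ z → (y ∘ suc) ≼ (z ∘ suc)
≼-suc p .≼-Has k s V m h = p .≼-Has k (suc s) V m h

pull-≼ : ∀ {y y′ r v} → Ballot y r v → (∀ u → u ≢ v → y′ u ≡ y u) → y′ v ≡ r → y v ≡ suc r → y′ ≼ y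
pull-≼ {y} {y′} {r} {v} B ag e′ e .≼-Has k s V m (m₁ , le , F) with ≤-total s v
... | inj₁ s≤v = let (m₂ , le₂ , G) = pull B′ (λ u ne → ag (s + u) λ q → ne (trans (sym (m+n∸m≡n s u)) (cong (_∸ s) q)))
                         (trans (cong y′ sv) e′) (trans (cong y sv) e) F
                 in m₂ , ≤-trans le le₂ , G
  where
  sv : s + (v ∸ s) ≡ v
  sv = m+[n∸m]≡n s≤v
  B′ : Ballot (y ∘ (s +_)) r (v ∸ s)
  B′ s₁ d eq = subst₂ _≤_ (ass r) (ass (suc r)) (B (s + s₁) d (trans (+-assoc s s₁ d) (trans (cong (s +_) eq) sv)))
    where
    ass : ∀ a → cnt (λ x → is (y (s + s₁ + x)) a) d ≡ cnt (λ x → is (y (s + (s₁ + x))) a) d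
    ass a = cnt-cong d λ u _ → cong (λ z → is (y z) a) (+-assoc s s₁ u)
... | inj₂ v≤s with m≤n⇒m<n∨m≡n v≤s
... | inj₁ v<s = m₁ , le , Fam-cong (λ u _ → ag (s + u) (>⇒≢ (<-≤-trans v<s (m≤m+n s u)))) F
... | inj₂ refl = let (m₂ , le₂ , G) = pull {y = y ∘ (s +_)} {r} {0} (λ { zero zero _ → z≤n }) (λ u ne → ag (s + u) λ q → ne (+-cancelˡ-≡ s u 0 (trans q (sym (+-identityʳ s)))))
                        (trans (cong y′ (+-identityʳ s)) e′) (trans (cong y (+-identityʳ s)) e) F
                  in m₂ , ≤-trans le le₂ , G

-- Reversing the word and complementing the letters turns chains into chains.
opp : ℕ → ℕ → (ℕ → ℕ) → ℕ → ℕ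
opp K V y τ = K ∸ y (V ∸ suc τ)

-- `F` is consumed from its last letter, which comes first in the reversed word; `G` holds the `d`
-- letters already carried over. Its bounds `K ∸ g i` say that the carried letters of chain `i` were
-- at most `g i`, so the two parts of each chain fit together.
rev-acc : ∀ {k} K V y {W d m m₂} {g : Fin k → ℕ} → d + W ≡ V → Fam y W m g →
          Fam (opp K V y) d m₂ (λ i → K ∸ g i) → Fam {k} (opp K V y) V (m + m₂) (λ _ → 0)
rev-acc {k} K V y {d = d} eq nil G = subst (λ z → Fam {k} (opp K V y) z _ (λ _ → 0)) (trans (sym (+-identityʳ d)) eq) (Fam-mono (λ _ → z≤n) G)
rev-acc K V y {suc W} {d} eq (skip F) G = rev-acc K V y (trans (sym (+-suc d W)) eq) F (skip G)
rev-acc {k} K V y {suc W} {d} {suc m} {m₂} {g} eq (take i p F) G =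
  subst (λ z → Fam {k} (opp K V y) V z (λ _ → 0)) (+-suc m m₂)
    (rev-acc K V y (trans (sym (+-suc d W)) eq) F (take i h₁ (Fam-mono h₂ G)))
  where
  idx : V ∸ suc d ≡ W
  idx = trans (cong (_∸ suc d) (trans (sym eq) (+-suc d W))) (m+n∸m≡n (suc d) W)
  h₁ : K ∸ (g [ i ≔ y W ]) i ≤ opp K V y d
  h₁ = ≤-reflexive (cong (K ∸_) (trans (upd-≡ g i (y W)) (cong y (sym idx))))
  h₂ : ((λ j → K ∸ (g [ i ≔ y W ]) j) [ i ≔ opp K V y d ]) ⊑ (λ j → K ∸ g j)
  h₂ = upd-⊑ i _ (λ j ne → ≤-reflexive (cong (K ∸_) (upd-≢ g i (y W) ne))) (∸-monoʳ-≤ K (≤-trans p (≤-reflexive (cong y (sym idx)))))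

rev : ∀ {k} K {V y m} {g : Fin k → ℕ} → Fam y V m g → Fam {k} (opp K V y) V m (λ _ → 0)
rev {k} K {V} {y} {m} F = subst (λ z → Fam {k} (opp K V y) V z (λ _ → 0)) (+-identityʳ m) (rev-acc K V y {d = 0} refl F nil)

cnt-rev : ∀ p d → cnt (λ x → p (d ∸ suc x)) d ≡ cnt p d
cnt-rev p zero = refl
cnt-rev p (suc d) = begin
  b2n (p (d ∸ d)) + cnt (λ x → p (d ∸ x)) d ≡⟨ cong₂ _+_ (cong (b2n ∘ p) (n∸n≡0 d)) (cnt-cong d λ u l → cong p (∸-suc′ l)) ⟩
  b2n (p 0) + cnt (λ x → p (suc (d ∸ suc x))) d ≡⟨ cong (b2n (p 0) +_) (cnt-rev (p ∘ suc) d) ⟩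
  b2n (p 0) + cnt (p ∘ suc) d ≡⟨ cong (_+ cnt (p ∘ suc) d) (sym (+-identityʳ (b2n (p 0)))) ⟩
  b2n (p 0) + 0 + cnt (p ∘ suc) d ≡⟨ sym (cnt-+ p 1 d) ⟩
  cnt p (suc d) ∎
  where open ≡-Reasoning

-- This is `pull` for the reversed and complemented word, in which the letters after `v` come before
-- it and the letter `r` becomes one larger than the letter `r + 1`. With both lemmas, a letter can
-- be lowered without any effect on chain lengths.
push : ∀ K {k y y′ r v V m} → (∀ u → y u ≤ K) → (∀ u → u ≢ v → y′ u ≡ y u) → y′ v ≡ r → y v ≡ suc r →
       (∀ d → cnt (λ x → is (y (suc v + x)) (suc r)) d ≤ cnt (λ x → is (y (suc v + x)) r) d) →
       Has k y V m → Has k y′ V m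
push K {k} {y} {y′} {r} {v} {V} {m} yK ag e′ e ball (m₁ , le , F) with v <? V
... | no v≮V = m₁ , le , Fam-cong (λ u l → sym (ag u λ { refl → v≮V l })) F
... | yes v<V = let (m₂ , le₂ , G) = pull B z-o z-v (trans (cong (λ z → K ∸ y′ z) vv) (trans (cong (K ∸_) e′) (∸-suc′ r<K)))
                                       (Fam-cong toz (rev K F))
                in m₂ , ≤-trans le le₂ , Fam-cong back (rev K G)
  where
  r<K : r < K
  r<K = subst (_≤ K) e (yK v)
  y′K : ∀ u → y′ u ≤ K
  y′K u with u ≟ v
  ... | yes refl = ≤-trans (≤-reflexive e′) (<⇒≤ r<K)
  ... | no ne = ≤-trans (≤-reflexive (ag u ne)) (yK u)
  inv : ∀ {u} → u < V → V ∸ suc (V ∸ suc u) ≡ u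
  inv {u} l = trans (cong (V ∸_) (sym (∸-suc′ l))) (m∸[m∸n]≡n (<⇒≤ l))
  vv : V ∸ suc (V ∸ suc v) ≡ v
  vv = inv v<V
  back : ∀ u → u < V → opp K V (opp K V y′) u ≡ y′ u
  back u l = trans (cong (λ z → K ∸ (K ∸ y′ z)) (inv l)) (m∸[m∸n]≡n (y′K u))
  z : ℕ → ℕ
  -- `opp K V y` cannot replace `z`: truncated subtraction sends all positions from `V` on to
  -- position 0, so for `v` = 0 it would differ from `opp K V y′` in more than one place.
  z u = if is u (V ∸ suc v) then K ∸ suc r else opp K V y′ u
  z-v : z (V ∸ suc v) ≡ K ∸ suc r
  z-v rewrite is-t {V ∸ suc v} refl = refl
  z-o : ∀ u → u ≢ V ∸ suc v → z u ≡ opp K V y′ u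
  z-o u ne rewrite is-f ne = refl
  toz : ∀ u → u < V → opp K V y u ≡ z u
  toz u l with u ≟ V ∸ suc v
  ... | yes refl = trans (cong (λ x → K ∸ y x) vv) (trans (cong (K ∸_) e) (sym z-v))
  ... | no ne = trans (cong (K ∸_) (sym (ag _ λ q → ne (trans (sym (inv l)) (cong (λ x → V ∸ suc x) q))))) (sym (z-o u ne))
  B : Ballot (opp K V y′) (K ∸ suc r) (V ∸ suc v)
  B s d eq = subst₂ _≤_ (sym (conv (suc r) (K ∸ suc r) r<K refl)) (sym (conv r (suc (K ∸ suc r)) (<⇒≤ r<K) (∸-suc′ r<K))) (ball d)
    where
    conv : ∀ a b → a ≤ K → K ∸ a ≡ b → cnt (λ x → is (opp K V y′ (s + x)) b) d ≡ cnt (λ x → is (y (suc v + x)) a) d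
    conv a b aK q = trans (cnt-cong d pt) (cnt-rev (λ x → is (y (suc v + x)) a) d)
      where
      ix : ∀ x → x < d → opp K V y′ (s + x) ≡ K ∸ y (suc v + (d ∸ suc x))
      ix x l = cong (K ∸_) (trans (cong y′ ix₁) (ag _ (>⇒≢ (s≤s (m≤m+n v _)))))
        where
        V≡ : V ≡ suc (s + x) + (suc v + (d ∸ suc x))
        V≡ = begin
          V ≡⟨ sym (m+[n∸m]≡n v<V) ⟩
          suc v + (V ∸ suc v) ≡⟨ cong (suc v +_) (sym eq) ⟩
          suc v + (s + d) ≡⟨ cong (λ t → suc v + (s + t)) (sym (m+[n∸m]≡n l)) ⟩
          suc v + (s + (suc x + (d ∸ suc x))) ≡⟨ cong (suc v +_) (sym (+-assoc s (suc x) _)) ⟩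
          suc v + (s + suc x + (d ∸ suc x)) ≡⟨ cong (λ t → suc v + (t + (d ∸ suc x))) (+-suc s x) ⟩
          suc v + (suc (s + x) + (d ∸ suc x)) ≡⟨ x∙yz≈y∙xz (suc v) (suc (s + x)) _ ⟩
          suc (s + x) + (suc v + (d ∸ suc x)) ∎
          where open ≡-Reasoning
        ix₁ : V ∸ suc (s + x) ≡ suc v + (d ∸ suc x)
        ix₁ = trans (cong (_∸ suc (s + x)) V≡) (m+n∸m≡n (suc (s + x)) _)
      pt : ∀ x → x < d → is (opp K V y′ (s + x)) b ≡ is (y (suc v + (d ∸ suc x))) a
      pt x l with y (suc v + (d ∸ suc x)) ≟ a
      ... | yes p = trans (is-t (trans (ix x l) (trans (cong (K ∸_) p) q))) (sym (is-t p))
      ... | no np = trans (is-f λ q₁ → np (∸-cancelˡ-≡ (yK _) aK (trans (sym (ix x l)) (trans q₁ (sym q))))) (sym (is-f np))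

-- Upper bounds on chain lengths from decompositions into antichains

sumN : (ℕ → ℕ) → ℕ → ℕ
sumN f zero = 0
sumN f (suc K) = f K + sumN f K

sumN-cong : ∀ {f g} K → (∀ c → c < K → f c ≡ g c) → sumN f K ≡ sumN g K
sumN-cong zero h = refl
sumN-cong (suc K) h = cong₂ _+_ (h K ≤-refl) (sumN-cong K λ c l → h c (m≤n⇒m≤1+n l))

sumN-mono : ∀ {f g} K → (∀ c → c < K → f c ≤ g c) → sumN f K ≤ sumN g K
sumN-mono zero h = z≤n
sumN-mono (suc K) h = +-mono-≤ (h K ≤-refl) (sumN-mono K λ c l → h c (m≤n⇒m≤1+n l))

sumN-+ : ∀ f g K → sumN (λ c → f c + g c) K ≡ sumN f K + sumN g K
sumN-+ f g zero = refl
sumN-+ f g (suc K) = trans (cong (f K + g K +_) (sumN-+ f g K)) (interchange (f K) (g K) (sumN f K) (sumN g K))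

sumN-0 : ∀ {f} K → (∀ c → c < K → f c ≡ 0) → sumN f K ≡ 0
sumN-0 zero h = refl
sumN-0 (suc K) h = cong₂ _+_ (h K ≤-refl) (sumN-0 K λ c l → h c (m≤n⇒m≤1+n l))

sumN-δ : ∀ {f} K x → x < K → (∀ c → c ≢ x → f c ≡ 0) → sumN f K ≡ f x
sumN-δ {f} (suc K) x l h with x ≟ K
... | yes refl = trans (cong (f K +_) (sumN-0 K λ c l → h c (<⇒≢ l))) (+-identityʳ (f K))
... | no ne = trans (cong (_+ sumN f K) (h K (≢-sym ne))) (sumN-δ K x (≤∧≢⇒< (s≤s⁻¹ l) ne) h)

cnt-part : ∀ (κ : ℕ → ℕ) p K V → (∀ u → u < V → κ u < K) →
           sumN (λ c → cnt (λ u → is (κ u) c ∧ p u) V) K ≡ cnt p V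
cnt-part κ p K zero h = sumN-0 K λ _ _ → refl
cnt-part κ p K (suc V) h = trans (sumN-+ (λ c → b2n (is (κ V) c ∧ p V)) (λ c → cnt (λ u → is (κ u) c ∧ p u) V) K)
  (cong₂ _+_ (trans (sumN-δ K (κ V) (h V ≤-refl) λ c ne → cong (λ b → b2n (b ∧ p V)) (is-f (≢-sym ne))) (cong (λ b → b2n (b ∧ p V)) (is-t {κ V} refl)))
    (cnt-part κ p K V λ u l → h u (m≤n⇒m≤1+n l)))

ΣF : ∀ {k} → (Fin k → ℕ) → ℕ
ΣF {zero} f = 0
ΣF {suc k} f = f zero + ΣF (f ∘ suc)

ΣF-≤ : ∀ {k} (f : Fin k → ℕ) → (∀ i → f i ≤ 1) → ΣF f ≤ k
ΣF-≤ {zero} f h = z≤n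
ΣF-≤ {suc k} f h = +-mono-≤ (h zero) (ΣF-≤ (f ∘ suc) (h ∘ suc))

ΣF-bump : ∀ {k} (f f′ : Fin k → ℕ) i x → f′ i ≡ x + f i → (∀ j → j ≢ i → f′ j ≡ f j) → ΣF f′ ≡ x + ΣF f
ΣF-bump {suc k} f f′ zero x e o = trans (cong₂ _+_ e (cg (λ j → o (suc j) λ ()))) (+-assoc x (f zero) _)
  where
  cg : ∀ {k} {g h : Fin k → ℕ} → (∀ j → g j ≡ h j) → ΣF g ≡ ΣF h
  cg {zero} p = refl
  cg {suc k} p = cong₂ _+_ (p zero) (cg (p ∘ suc))
ΣF-bump {suc k} f f′ (suc i) x e o = trans (cong₂ _+_ (o zero λ ()) (ΣF-bump (f ∘ suc) (f′ ∘ suc) i x e λ j ne → o (suc j) (ne ∘ Fin.suc-injective)))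
  (x∙yz≈y∙xz (f zero) x _)

-- The easy half of Greene-Kleitman duality. If `κ` grows strictly along chains, each of its levels
-- is an antichain, and `k` chains take at most `k` elements of a level. `used` counts what a family
-- takes of a level, `usedBy` splits this by chains.
module Certificate {k : ℕ} (y κ : ℕ → ℕ) where

  used : ∀ {V m} {g : Fin k → ℕ} → Fam y V m g → ℕ → ℕ
  used nil c = 0
  used (skip F) c = used F c
  used (take {V} i p F) c = b2n (is (κ V) c) + used F c

  usedBy : ∀ {V m} {g : Fin k → ℕ} → Fam y V m g → ℕ → Fin k → ℕ
  usedBy nil c j = 0
  usedBy (skip F) c j = usedBy F c j
  usedBy (take {V} i p F) c j = (if does (j Fin.≟ i) then b2n (is (κ V) c) else 0) + usedBy F c j

  used≡ : ∀ {V m} {g : Fin k → ℕ} (F : Fam y V m g) c → used F c ≡ ΣF (usedBy F c)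
  used≡ nil c = sym (n≤0⇒n≡0 (lem k))
    where
    lem : ∀ k → ΣF {k} (λ _ → 0) ≤ 0
    lem zero = z≤n
    lem (suc k) = lem k
  used≡ (skip F) c = used≡ F c
  used≡ (take {V} i p F) c = trans (cong (b2n (is (κ V) c) +_) (used≡ F c)) (sym (ΣF-bump (usedBy F c) _ i _ e o))
    where
    e : usedBy (take i p F) c i ≡ b2n (is (κ V) c) + usedBy F c i
    e with i Fin.≟ i
    ... | yes _ = refl
    ... | no ne = ⊥-elim (ne refl)
    o : ∀ j → j ≢ i → usedBy (take i p F) c j ≡ usedBy F c j
    o j ne with j Fin.≟ i
    ... | yes q = ⊥-elim (ne q)
    ... | no _ = refl

  unused : ∀ {V m} {g : Fin k → ℕ} (F : Fam y V m g) c j b → b ≤ g j →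
           (∀ u → u < V → b ≤ y u → κ u ≢ c) → usedBy F c j ≡ 0
  unused nil c j b l h = refl
  unused (skip F) c j b l h = unused F c j b l λ u l → h u (m≤n⇒m≤1+n l)
  unused {suc V} {g = g} (take i p F) c j b l h with j Fin.≟ i
  ... | yes refl = trans (cong (λ z → b2n z + usedBy F c j) (is-f (h V ≤-refl (≤-trans l p))))
                     (unused F c j b (≤-trans (≤-trans l p) (≤-reflexive (sym (upd-≡ g j (y V))))) λ u l → h u (m≤n⇒m≤1+n l))
  ... | no ne = unused F c j b (≤-trans l (≤-reflexive (sym (upd-≢ g i (y V) ne)))) λ u l → h u (m≤n⇒m≤1+n l)

  module _ {W : ℕ} (inc : ∀ {u v} → u < v → v < W → y v ≤ y u → κ u < κ v) where

    once : ∀ {V m} {g : Fin k → ℕ} (F : Fam y V m g) → V ≤ W → ∀ c j → usedBy F c j ≤ 1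
    once nil VW c j = z≤n
    once (skip F) VW c j = once F (<⇒≤ VW) c j
    once {suc V} {g = g} (take i p F) VW c j with j Fin.≟ i
    ... | no ne = once F (<⇒≤ VW) c j
    ... | yes refl with κ V ≟ c
    ... | yes refl = ≤-reflexive (cong₂ _+_ (cong b2n (is-t {κ V} refl))
           (unused F (κ V) j (y V) (≤-reflexive (sym (upd-≡ g j (y V)))) λ u l q → <⇒≢ (inc l VW q)))
    ... | no nc = ≤-trans (≤-reflexive (cong (λ z → b2n z + usedBy F c j) (is-f nc))) (once F (<⇒≤ VW) c j)

    used≤k : ∀ {V m} {g : Fin k → ℕ} (F : Fam y V m g) → V ≤ W → ∀ c → used F c ≤ k
    used≤k F VW c = ≤-trans (≤-reflexive (used≡ F c)) (ΣF-≤ _ (once F VW c))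

    used≤cnt : ∀ {V m} {g : Fin k → ℕ} (F : Fam y V m g) c (p : ℕ → Bool) → (∀ u → u < V → κ u ≡ c → p u ≡ true) →
               used F c ≤ cnt (λ u → is (κ u) c ∧ p u) V
    used≤cnt nil c p h = z≤n
    used≤cnt (skip F) c p h = ≤-trans (used≤cnt F c p λ u l → h u (m≤n⇒m≤1+n l)) (m≤n+m _ _)
    used≤cnt (take {V} i _ F) c p h = +-mono-≤ le (used≤cnt F c p λ u l → h u (m≤n⇒m≤1+n l))
      where
      le : b2n (is (κ V) c) ≤ b2n (is (κ V) c ∧ p V)
      le with κ V ≟ c
      ... | no nc = ≤-trans (≤-reflexive (cong b2n (is-f nc))) z≤n
      ... | yes q rewrite is-t q | h V ≤-refl q = ≤-refl

    size≡ : ∀ K {V m} {g : Fin k → ℕ} (F : Fam y V m g) → (∀ u → u < V → κ u < K) → sumN (used F) K ≡ m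
    size≡ K nil h = sumN-0 K λ _ _ → refl
    size≡ K (skip F) h = size≡ K F λ u l → h u (m≤n⇒m≤1+n l)
    size≡ K (take {V} i p F) h = trans (sumN-+ (λ c → b2n (is (κ V) c)) (used F) K)
      (cong₂ _+_ (trans (sumN-δ K (κ V) (h V ≤-refl) λ c ne → cong b2n (is-f (≢-sym ne))) (cong b2n (is-t {κ V} refl)))
        (size≡ K F λ u l → h u (m≤n⇒m≤1+n l)))

    -- On each level `p` marks either everything or at least `k` elements, in both cases no fewer
    -- than the chains can take there; summing over the levels gives the bound.
    certify : ∀ (p : ℕ → Bool) → (∀ c → (∀ u → u < W → κ u ≡ c → p u ≡ true) ⊎ k ≤ cnt (λ u → is (κ u) c ∧ p u) W) →
              ∀ {m} {g : Fin k → ℕ} → Fam y W m g → m ≤ cnt p W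
    certify p cap F = subst₂ _≤_ (size≡ K F κ<K) (cnt-part κ p K W κ<K) (sumN-mono K λ c _ → le c)
      where
      K = suc (sumN κ W)
      κ<K : ∀ u → u < W → κ u < K
      κ<K u l = s≤s (go W l)
        where
        go : ∀ W → u < W → κ u ≤ sumN κ W
        go (suc W) l with m≤n⇒m<n∨m≡n l
        ... | inj₂ refl = m≤m+n _ _
        ... | inj₁ (s≤s l′) = ≤-trans (go W l′) (m≤n+m _ _)
      le : ∀ c → used F c ≤ cnt (λ u → is (κ u) c ∧ p u) W
      le c with cap c
      ... | inj₁ all = used≤cnt F c p all
      ... | inj₂ k≤ = ≤-trans (used≤k F ≤-refl c) k≤

-- Periodic words

per-* : ∀ {n} (f : ℕ → ℕ) → (∀ u → f (u + n) ≡ f u) → ∀ u t → f (u + t * n) ≡ f u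
per-* f p u zero = cong f (+-identityʳ u)
per-* {n} f p u (suc t) = trans (cong f (trans (cong (u +_) (+-comm n (t * n))) (sym (+-assoc u (t * n) n)))) (trans (p (u + t * n)) (per-* f p u t))

-- `ρ` is the class of an entry. `w i` is the least entry of class `i`, so `w` is the given
-- permutation with values counted from 0 and diagonal boxes numbered by their rows; `val i t` is
-- what `w i` becomes after `t` additions of `n`.
record Per (ν : ℕ) (ρ : ℕ → ℕ) : Set where
  n : ℕ
  n = suc ν
  field
    ρ≤    : ∀ u → ρ u ≤ ν
    ρ-per : ∀ u → ρ (u + n) ≡ ρ u
    ρ-inj : ∀ {u v} → u < v → v < u + n → ρ u ≢ ρ v
    w     : ℕ → ℕ
    w<    : ∀ {i} → i ≤ ν → w i < n
    ρw    : ∀ {i} → i ≤ ν → ρ (w i) ≡ i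

  ρ-per* : ∀ u t → ρ (u + t * n) ≡ ρ u
  ρ-per* = per-* ρ ρ-per

  ρ-inj₀ : ∀ {u v} → u < n → v < n → ρ u ≡ ρ v → u ≡ v
  ρ-inj₀ {u} {v} lu lv q with <-cmp u v
  ... | tri< l _ _ = ⊥-elim (ρ-inj l (<-≤-trans lv (m≤n+m n u)) q)
  ... | tri≈ _ p _ = p
  ... | tri> _ _ l = ⊥-elim (ρ-inj l (<-≤-trans lu (m≤n+m n v)) (sym q))

  val : ℕ → ℕ → ℕ
  val i t = w i + t * n

  ρ-val : ∀ {i} t → i ≤ ν → ρ (val i t) ≡ i
  ρ-val {i} t l = trans (ρ-per* (w i) t) (ρw l)

  %≡w : ∀ u → u % n ≡ w (ρ u)
  %≡w u = ρ-inj₀ (m%n<n u n) (w< (ρ≤ u)) (trans (trans (sym (ρ-per* (u % n) (u / n))) (cong ρ (sym (m≡m%n+[m/n]*n u n)))) (sym (ρw (ρ≤ u))))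

  val-u : ∀ u → u ≡ val (ρ u) (u / n)
  val-u u = trans (m≡m%n+[m/n]*n u n) (cong (_+ u / n * n) (%≡w u))

  val-/ : ∀ {i} t → i ≤ ν → val i t / n ≡ t
  val-/ {i} t l = trans (+-distrib-/-∣ʳ (w i) (n∣m*n t)) (cong₂ _+_ (m<n⇒m/n≡0 (w< l)) (m*n/n≡m t n))

  u<N*n⇒ : ∀ {u N} → u < N * n → u / n < N
  u<N*n⇒ {u} {N} l = m<n*o⇒m/o<n l

  val<N*n : ∀ {i t N} → i ≤ ν → t < N → val i t < N * n
  val<N*n {i} {t} l tN = ≤-trans (+-monoˡ-< (t * n) (w< l)) (*-monoˡ-≤ n tN)

  w-inj : ∀ {i j} → i ≤ ν → j ≤ ν → w i ≡ w j → i ≡ j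
  w-inj li lj q = trans (sym (ρw li)) (trans (cong ρ q) (ρw lj))

  asc : ℕ → ℕ
  asc zero = 0
  asc (suc d) = b2n (lt (w d) (w (suc d))) + asc d

  b2n≤1 : ∀ b → b2n b ≤ 1
  b2n≤1 true = ≤-refl
  b2n≤1 false = z≤n

  asc-≤ : ∀ x d → asc (d + x) ≤ d + asc x
  asc-≤ x zero = ≤-refl
  asc-≤ x (suc d) = +-mono-≤ (b2n≤1 (lt (w (d + x)) (w (suc (d + x))))) (asc-≤ x d)

  asc-mono : ∀ x d → asc x ≤ asc (d + x)
  asc-mono x zero = ≤-refl
  asc-mono x (suc d) = ≤-trans (asc-mono x d) (m≤n+m _ _)

  asc-desc : ∀ x d → w (d + x) < w x → asc (d + x) < d + asc x
  asc-desc x zero l = ⊥-elim (<-irrefl refl l)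
  asc-desc x (suc d) l with w (d + x) <? w x
  ... | yes l′ = +-mono-≤-< (b2n≤1 (lt (w (d + x)) (w (suc (d + x))))) (asc-desc x d l′)
  ... | no nl rewrite lt-f {w (d + x)} {w (suc (d + x))} (≤-trans (<⇒≤ l) (≮⇒≥ nl)) = s≤s (asc-≤ x d)

  asc-asc : ∀ x d → w x < w (d + x) → asc x < asc (d + x)
  asc-asc x zero l = ⊥-elim (<-irrefl refl l)
  asc-asc x (suc d) l with w x <? w (d + x)
  ... | yes l′ = ≤-trans (asc-asc x d l′) (m≤n+m _ _)
  ... | no nl rewrite lt-t {w (d + x)} {w (suc (d + x))} (≤-<-trans (≮⇒≥ nl) l) = s≤s (asc-mono x d)

  asc≤ : ∀ x → asc x ≤ x
  asc≤ x = subst₂ (λ a b → asc a ≤ b) (+-identityʳ x) (+-identityʳ x) (asc-≤ 0 x)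

  asc-mono′ : ∀ {x x′} → x ≤ x′ → asc x ≤ asc x′
  asc-mono′ {x} {x′} l = subst (λ z → asc x ≤ asc z) (m∸n+n≡m l) (asc-mono x (x′ ∸ x))

  asc-≤′ : ∀ {x x′} → x ≤ x′ → asc x′ ≤ (x′ ∸ x) + asc x
  asc-≤′ {x} {x′} l = subst (λ z → asc z ≤ (x′ ∸ x) + asc x) (m∸n+n≡m l) (asc-≤ x (x′ ∸ x))

allOr : ∀ (p : ℕ → Bool) V → (∀ u → u < V → p u ≡ true) ⊎ (∃ λ u → u < V × p u ≡ false)
allOr p zero = inj₁ λ u ()
allOr p (suc V) with p V in eq
... | false = inj₂ (V , ≤-refl , eq)
... | true with allOr p V
... | inj₂ (u , l , q) = inj₂ (u , m≤n⇒m≤1+n l , q)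
... | inj₁ h = inj₁ λ u l → case m≤n⇒m<n∨m≡n (s≤s⁻¹ l) of λ { (inj₁ l′) → h u l′ ; (inj₂ refl) → eq }

sumN-split : ∀ f k d → sumN f (d + k) ≡ sumN (λ i → f (i + k)) d + sumN f k
sumN-split f k zero = refl
sumN-split f k (suc d) = trans (cong (f (d + k) +_) (sumN-split f k d)) (sym (+-assoc (f (d + k)) _ _))

sumN-first : ∀ f d → sumN f (suc d) ≡ sumN (f ∘ suc) d + f 0
sumN-first f zero = +-identityʳ (f 0)
sumN-first f (suc d) = trans (cong (f (suc d) +_) (sumN-first f d)) (sym (+-assoc (f (suc d)) _ _))

sumN-rev : ∀ f d → sumN f d ≡ sumN (λ i → f (d ∸ suc i)) d
sumN-rev f zero = refl
sumN-rev f (suc d) = trans (sumN-first f d) (trans (+-comm _ (f 0))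
  (cong₂ _+_ (cong f (sym (n∸n≡0 d))) (trans (sumN-rev (f ∘ suc) d) (sumN-cong d λ c l → cong f (sym (∸-suc′ l))))))

sumN-trunc : ∀ f k d → k ≤ d → (∀ i → k ≤ i → i < d → f i ≡ 0) → sumN f d ≡ sumN f k
sumN-trunc f k d l h = trans (cong (sumN f) (sym (m∸n+n≡m l))) (trans (sumN-split f k (d ∸ k))
  (cong (_+ sumN f k) (sumN-0 (d ∸ k) λ c l′ → h (c + k) (m≤n+m k c) (<-≤-trans (+-monoˡ-< k l′) (≤-reflexive (m∸n+n≡m l))))))

sumN-const : ∀ N r → sumN (λ _ → N) r ≡ r * N
sumN-const N zero = refl
sumN-const N (suc r) = cong (N +_) (sumN-const N r)

cnt-all : ∀ k → cnt (λ _ → true) k ≡ k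
cnt-all zero = refl
cnt-all (suc k) = cong suc (cnt-all k)

cnt-none : ∀ p V → (∀ u → u < V → p u ≡ false) → cnt p V ≡ 0
cnt-none p zero h = refl
cnt-none p (suc V) h rewrite h V ≤-refl = cnt-none p V λ u l → h u (m≤n⇒m≤1+n l)

cnt-one : ∀ p V x → x < V → p x ≡ true → (∀ u → u < V → u ≢ x → p u ≡ false) → cnt p V ≡ 1
cnt-one p (suc V) x l px h with x ≟ V
... | yes refl rewrite px = cong suc (cnt-none p V λ u lu → h u (m≤n⇒m≤1+n lu) (<⇒≢ lu))
... | no ne rewrite h V ≤-refl (≢-sym ne) = cnt-one p V x (≤∧≢⇒< (s≤s⁻¹ l) ne) px λ u lu → h u (m≤n⇒m≤1+n lu)

cnt-lt : ∀ q V → cnt (λ u → lt u q) V ≤ q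
cnt-lt q zero = z≤n
cnt-lt q (suc V) with V <? q
... | yes l = ≤-trans (+-mono-≤ (≤-reflexive (cong b2n (lt-t l))) (≤-trans (cnt-mono-p V λ _ _ _ → refl) (≤-reflexive (cnt-all V)))) l
... | no nl = ≤-trans (≤-reflexive (cnt-skip (λ u → lt u q) V (lt-f (≮⇒≥ nl)))) (cnt-lt q V)

cnt-∨ : ∀ p q r V → (∀ u → u < V → p u ≡ true → q u ≡ true ⊎ r u ≡ true) → cnt p V ≤ cnt q V + cnt r V
cnt-∨ p q r zero h = z≤n
cnt-∨ p q r (suc V) h = ≤-trans (+-mono-≤ (g (p V) (q V) (r V) (h V ≤-refl)) (cnt-∨ p q r V λ u l → h u (m≤n⇒m≤1+n l)))
                           (≤-reflexive (interchange (b2n (q V)) (b2n (r V)) _ _))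
  where
  g : ∀ a b c → (a ≡ true → b ≡ true ⊎ c ≡ true) → b2n a ≤ b2n b + b2n c
  g false b c f = z≤n
  g true b c f with f refl
  ... | inj₁ refl = s≤s z≤n
  ... | inj₂ refl = m≤n+m 1 (b2n b)

∧-T : ∀ {a b} → a ∧ b ≡ true → a ≡ true × b ≡ true
∧-T {true} {true} refl = refl , refl

∧-I : ∀ {a b} → a ≡ true → b ≡ true → a ∧ b ≡ true
∧-I refl refl = refl

module _ {ν ρ} (P : Per ν ρ) where
  open Per P

  cnt-class : ∀ x (f : ℕ → Bool) N → x ≤ ν → cnt (λ u → is (ρ u) x ∧ f (u / n)) (N * n) ≡ cnt f N
  cnt-class x f zero l = refl
  cnt-class x f (suc N) l = begin
    cnt p (n + N * n) ≡⟨ cong (cnt p) (+-comm n (N * n)) ⟩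
    cnt p (N * n + n) ≡⟨ cnt-+ p (N * n) n ⟩
    cnt p (N * n) + cnt (λ u → p (N * n + u)) n ≡⟨ cong₂ _+_ (cnt-class x f N l) win ⟩
    cnt f N + b2n (f N) ≡⟨ +-comm (cnt f N) _ ⟩
    b2n (f N) + cnt f N ∎
    where
    open ≡-Reasoning
    p = λ u → is (ρ u) x ∧ f (u / n)
    win : cnt (λ u → p (N * n + u)) n ≡ b2n (f N)
    win = trans (cnt-cong n eq) (go (f N))
      where
      eq : ∀ u → u < n → p (N * n + u) ≡ is (ρ u) x ∧ f N
      eq u lu = cong₂ (λ a b → is a x ∧ f b) (trans (cong ρ (+-comm (N * n) u)) (ρ-per* u N))
        (trans (cong (_/ n) (+-comm (N * n) u)) (trans (+-distrib-/-∣ʳ u (n∣m*n N)) (cong₂ _+_ (m<n⇒m/n≡0 lu) (m*n/n≡m N n))))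
      go : ∀ b → cnt (λ u → is (ρ u) x ∧ b) n ≡ b2n b
      go false = cnt-none _ n λ u _ → ∧-zeroʳ′ (is (ρ u) x)
        where
        ∧-zeroʳ′ : ∀ a → a ∧ false ≡ false
        ∧-zeroʳ′ true = refl
        ∧-zeroʳ′ false = refl
      go true = cnt-one _ n (w x) (w< l) (∧-I (is-t (ρw l)) refl)
        λ u lu ne → cong (_∧ true) (is-f λ q → ne (ρ-inj₀ lu (w< l) (trans q (sym (ρw l)))))

  -- ℓ is the identity (rows) or the reversal (columns) of the classes.
  module FCert (ℓ : ℕ → ℕ) (ℓ≤ : ∀ {x} → x ≤ ν → ℓ x ≤ ν) (ℓℓ : ∀ {x} → x ≤ ν → ℓ (ℓ x) ≡ x)
               (o : ℕ → ℕ)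
               (o-mono : ∀ {x x′} → x ≤ ν → x′ ≤ ν → ℓ x′ ≤ ℓ x → o x ≤ o x′)
               (o-strict : ∀ {x x′} → x ≤ ν → x′ ≤ ν → ℓ x′ ≤ ℓ x → w x < w x′ → o x < o x′)
               (N : ℕ) (o≤N : ∀ {x} → x ≤ ν → o x ≤ N) where
    κ : ℕ → ℕ
    κ u = u / n + o (ρ u)

    y : ℕ → ℕ
    y u = ℓ (ρ u)

    inc : ∀ {u v} → u < v → v < N * n → y v ≤ y u → κ u < κ v
    inc {u} {v} l _ q with m≤n⇒m<n∨m≡n (/-monoˡ-≤ n (<⇒≤ l))
    ... | inj₁ l/ = +-mono-<-≤ l/ (o-mono (ρ≤ u) (ρ≤ v) q)
    ... | inj₂ e/ = +-mono-≤-< (≤-reflexive e/) (o-strict (ρ≤ u) (ρ≤ v) q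
            (subst₂ _<_ (%≡w u) (%≡w v) (+-cancelʳ-< (v / n * n) _ _ (subst₂ _<_ (trans (m≡m%n+[m/n]*n u n) (cong (λ z → u % n + z * n) e/)) (m≡m%n+[m/n]*n v n) l))))

    elem : ℕ → ℕ → ℕ
    elem c j = val (ℓ j) (c ∸ o (ℓ j))

    module _ {c j} (jν : j ≤ ν) (oc : o (ℓ j) ≤ c) where
      elem-ρ : ρ (elem c j) ≡ ℓ j
      elem-ρ = ρ-val (c ∸ o (ℓ j)) (ℓ≤ jν)
      elem-y : y (elem c j) ≡ j
      elem-y = trans (cong ℓ elem-ρ) (ℓℓ jν)
      elem-κ : κ (elem c j) ≡ c
      elem-κ = trans (cong₂ _+_ (val-/ (c ∸ o (ℓ j)) (ℓ≤ jν)) (cong o elem-ρ)) (m∸n+n≡m oc)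

    elem-mono : ∀ {c j j′} → j < j′ → j′ ≤ ν → o (ℓ j) ≤ c → elem c j < elem c j′
    elem-mono {c} {j} {j′} l l′ oc with m≤n⇒m<n∨m≡n (o-mono (ℓ≤ l′) (ℓ≤ jν) (subst₂ _≤_ (sym (ℓℓ jν)) (sym (ℓℓ l′)) (<⇒≤ l)))
      where jν = ≤-trans (<⇒≤ l) l′
    ... | inj₁ ol = <-≤-trans (+-monoˡ-< _ (w< (ℓ≤ jν))) (≤-trans (*-monoˡ-≤ n (∸-monoʳ-< ol oc)) (m≤n+m _ (w (ℓ j′))))
      where jν = ≤-trans (<⇒≤ l) l′
    ... | inj₂ oe = subst (λ z → elem c j < w (ℓ j′) + (c ∸ z) * n) (sym oe) (+-monoˡ-< _ w<w)
      where
      jν = ≤-trans (<⇒≤ l) l′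
      w<w : w (ℓ j) < w (ℓ j′)
      w<w with <-cmp (w (ℓ j)) (w (ℓ j′))
      ... | tri< p _ _ = p
      ... | tri≈ _ p _ = ⊥-elim (<⇒≢ l (trans (sym (ℓℓ jν)) (trans (cong ℓ (w-inj (ℓ≤ jν) (ℓ≤ l′) p)) (ℓℓ l′))))
      ... | tri> _ _ p = ⊥-elim (<⇒≢ (o-strict (ℓ≤ l′) (ℓ≤ jν) (subst₂ _≤_ (sym (ℓℓ jν)) (sym (ℓℓ l′)) (<⇒≤ l)) p) oe)

    module _ {k} (k≤n : k ≤ n) where
      -- By `o-mono` larger letters have smaller offsets. Hence the letters on a level below `N`
      -- form an upper set, those on a level from `N` on a lower set. Marking the `k` largest
      -- letters in the first case and the `k` smallest in the second exhausts the level or hits it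
      -- `k` times.
      p : ℕ → Bool
      p u = if lt (κ u) N then lt ν (y u + k) else lt (y u) k

      many : ∀ c j₀ → j₀ + k ≤ n → (∀ i → i < k → o (ℓ (j₀ + i)) ≤ c × elem c (j₀ + i) < N * n × p (elem c (j₀ + i)) ≡ true) →
             k ≤ cnt (λ u → is (κ u) c ∧ p u) (N * n)
      many c j₀ jk h = subst (_≤ cnt (λ u → is (κ u) c ∧ p u) (N * n)) (cnt-all k) (cnt-inj {λ _ → true} {λ u → is (κ u) c ∧ p u} Φ mono k (N * n) λ i l _ → elem c (j₀ + i) , (l , refl) , proj₁ (proj₂ (h i l)) ,
                         ∧-I (is-t (elem-κ (jν l) (proj₁ (h i l)))) (proj₂ (proj₂ (h i l))))
        where
        jν : ∀ {i} → i < k → j₀ + i ≤ ν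
        jν {i} l = s≤s⁻¹ (≤-trans (≤-reflexive (sym (+-suc j₀ i))) (≤-trans (+-monoʳ-≤ j₀ l) jk))
        Φ : ℕ → ℕ → Set
        Φ i u = i < k × u ≡ elem c (j₀ + i)
        mono : ∀ {u u₁ v v₁} → Φ u u₁ → Φ v v₁ → u < v → u₁ < v₁
        mono {u} {v = v} (lu , refl) (lv , refl) l = elem-mono (+-monoʳ-< j₀ l) (jν lv) (proj₁ (h u lu))

      cap : ∀ c → (∀ u → u < N * n → κ u ≡ c → p u ≡ true) ⊎ k ≤ cnt (λ u → is (κ u) c ∧ p u) (N * n)
      cap c with allOr (λ u → not (is (κ u) c) ∨ p u) (N * n)
      ... | inj₁ h = inj₁ λ u l q → subst (λ z → not z ∨ p u ≡ true) (is-t q) (h u l)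
      ... | inj₂ (u , l , q) with κ u ≟ c
      ... | no nc = case trans (sym q) (cong (λ z → not z ∨ p u) (is-f nc)) of λ ()
      ... | yes refl with κ u <? N
      ... | yes c<N = inj₂ (many (κ u) (n ∸ k) (≤-reflexive (m∸n+n≡m k≤n)) good)
        where
        pf : lt ν (y u + k) ≡ false
        pf = trans (sym (cong (λ z → if z then lt ν (y u + k) else lt (y u) k) (lt-t c<N))) (trans (sym (cong (λ z → not z ∨ p u) (is-t {κ u} refl))) q)
        yk : y u + k ≤ ν
        yk = ≮⇒≥ λ l → case trans (sym pf) (lt-t l) of λ ()
        good : ∀ i → i < k → o (ℓ (n ∸ k + i)) ≤ κ u × elem (κ u) (n ∸ k + i) < N * n × p (elem (κ u) (n ∸ k + i)) ≡ true
        good i ik = oc , val<N*n (ℓ≤ jν) (≤-<-trans (m∸n≤m (κ u) (o (ℓ (n ∸ k + i)))) c<N) ,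
            trans (cong (λ z → if z then lt ν (y (elem (κ u) j) + k) else lt (y (elem (κ u) j)) k) (trans (cong (λ z → lt z N) (elem-κ jν oc)) (lt-t c<N)))
              (lt-t (≤-trans (≤-reflexive (sym (m∸n+n≡m k≤n))) (+-monoˡ-≤ k (≤-trans (m≤m+n (n ∸ k) i) (≤-reflexive (sym (elem-y jν oc)))))))
          where
          j = n ∸ k + i
          jν : j ≤ ν
          jν = s≤s⁻¹ (≤-trans (≤-reflexive (sym (+-suc (n ∸ k) i))) (≤-trans (+-monoʳ-≤ (n ∸ k) ik) (≤-reflexive (m∸n+n≡m k≤n))))
          oc : o (ℓ j) ≤ κ u
          oc = ≤-trans (o-mono (ℓ≤ jν) (ρ≤ u) (≤-trans (+-cancelʳ-≤ k _ _ (≤-trans yk (≤-trans (n≤1+n ν) (≤-reflexive (sym (m∸n+n≡m k≤n)))))) (≤-trans (m≤m+n (n ∸ k) i) (≤-reflexive (sym (ℓℓ jν)))))) (m≤n+m _ (u / n))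
      ... | no c≮N = inj₂ (many (κ u) 0 k≤n good)
        where
        pf : lt (y u) k ≡ false
        pf = trans (sym (cong (λ z → if z then lt ν (y u + k) else lt (y u) k) (lt-f (≮⇒≥ c≮N)))) (trans (sym (cong (λ z → not z ∨ p u) (is-t {κ u} refl))) q)
        yk : k ≤ y u
        yk = ≮⇒≥ λ l → case trans (sym pf) (lt-t l) of λ ()
        good : ∀ i → i < k → o (ℓ i) ≤ κ u × elem (κ u) i < N * n × p (elem (κ u) i) ≡ true
        good i ik = oc , val<N*n (ℓ≤ iν) (≤-<-trans t≤ (u<N*n⇒ {u} {N} l)) ,
            trans (cong (λ z → if z then lt ν (y (elem (κ u) i) + k) else lt (y (elem (κ u) i)) k) (trans (cong (λ z → lt z N) (elem-κ iν oc)) (lt-f (≮⇒≥ c≮N))))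
              (lt-t (≤-<-trans (≤-reflexive (elem-y iν oc)) ik))
          where
          iν : i ≤ ν
          iν = s≤s⁻¹ (<-≤-trans ik k≤n)
          oc : o (ℓ i) ≤ κ u
          oc = ≤-trans (o≤N (ℓ≤ iν)) (≮⇒≥ c≮N)
          t≤ : κ u ∸ o (ℓ i) ≤ u / n
          t≤ = ≤-trans (∸-monoʳ-≤ (κ u) (o-mono (ρ≤ u) (ℓ≤ iν) (≤-trans (≤-reflexive (ℓℓ iν)) (<⇒≤ (<-≤-trans ik yk))))) (≤-reflexive (m+n∸n≡m (u / n) (o (ρ u))))

      private
        W = N * n

        is-ℓ : ∀ u j → j ≤ ν → is (y u) j ≡ true → is (ρ u) (ℓ j) ≡ true
        is-ℓ u j jν q = is-t (trans (sym (ℓℓ (ρ≤ u))) (cong ℓ (is-T {y u} {j} q)))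

        q₁ q₂ : ℕ → Bool
        q₁ u = lt (κ u) N ∧ lt ν (y u + k)
        q₂ u = not (lt (κ u) N) ∧ lt (y u) k

        pq : ∀ u → p u ≡ true → q₁ u ≡ true ⊎ q₂ u ≡ true
        pq u h with lt (κ u) N
        ... | true = inj₁ h
        ... | false = inj₂ h

        part : ∀ q → sumN (λ j → cnt (λ u → is (y u) j ∧ q u) W) n ≡ cnt q W
        part q = cnt-part y q n W λ u _ → s≤s (ℓ≤ (ρ≤ u))

        c₁ : ∀ j → j ≤ ν → cnt (λ u → is (y u) j ∧ q₁ u) W ≤ N ∸ o (ℓ j)
        c₁ j jν = ≤-trans (cnt-mono-p W imp) (≤-trans (≤-reflexive (cnt-class (ℓ j) (λ t → lt t (N ∸ o (ℓ j))) N (ℓ≤ jν))) (cnt-lt _ N))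
          where
          imp : ∀ u → u < W → is (y u) j ∧ q₁ u ≡ true → is (ρ u) (ℓ j) ∧ lt (u / n) (N ∸ o (ℓ j)) ≡ true
          imp u _ h with ∧-T {is (y u) j} h
          ... | a , b = ∧-I (is-ℓ u j jν a) (lt-t (m+n≤o⇒m≤o∸n (suc (u / n)) (subst (λ z → suc (u / n + o z) ≤ N) (is-T (is-ℓ u j jν a)) (lt-T (proj₁ (∧-T b))))))

        c₁₀ : ∀ j → j + k ≤ ν → cnt (λ u → is (y u) j ∧ q₁ u) W ≡ 0
        c₁₀ j jk = cnt-none _ W λ u _ → f u
          where
          f : ∀ u → is (y u) j ∧ q₁ u ≡ false
          f u with is (y u) j in eq | lt (κ u) N
          ... | false | _ = refl
          ... | true | false = refl
          ... | true | true = lt-f (subst (λ z → z + k ≤ ν) (sym (is-T {y u} eq)) jk)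

        c₂ : ∀ j → j ≤ ν → cnt (λ u → is (y u) j ∧ q₂ u) W ≤ o (ℓ j)
        c₂ j jν = ≤-trans (cnt-mono-p W imp) (≤-trans (≤-reflexive (cnt-class (ℓ j) (λ t → not (lt t (N ∸ o (ℓ j)))) N (ℓ≤ jν))) fin)
          where
          oN = o≤N (ℓ≤ jν)
          imp : ∀ u → u < W → is (y u) j ∧ q₂ u ≡ true → is (ρ u) (ℓ j) ∧ not (lt (u / n) (N ∸ o (ℓ j))) ≡ true
          imp u _ h with ∧-T {is (y u) j} h
          ... | a , b = ∧-I (is-ℓ u j jν a) (cong not (lt-f (≤-trans (∸-monoˡ-≤ (o (ℓ j)) N≤) (≤-reflexive (m+n∸n≡m (u / n) (o (ℓ j)))))))
            where
            N≤ : N ≤ u / n + o (ℓ j)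
            N≤ = subst (λ z → N ≤ u / n + o z) (is-T (is-ℓ u j jν a)) (≮⇒≥ λ l → case trans (sym (proj₁ (∧-T b))) (cong not (lt-t l)) of λ ())
          fin : cnt (λ t → not (lt t (N ∸ o (ℓ j)))) N ≤ o (ℓ j)
          fin = ≤-trans (≤-reflexive (trans (cong (cnt f) (sym (m∸n+n≡m oN))) (cnt-+ f (N ∸ o (ℓ j)) (o (ℓ j)))))
                  (+-mono-≤ (≤-reflexive (cnt-none f (N ∸ o (ℓ j)) λ u l → cong not (lt-t l))) (≤-trans (cnt-mono-p {q = λ _ → true} (o (ℓ j)) λ _ _ _ → refl) (≤-reflexive (cnt-all _))))
            where f = λ t → not (lt t (N ∸ o (ℓ j)))

        c₂₀ : ∀ j → k ≤ j → cnt (λ u → is (y u) j ∧ q₂ u) W ≡ 0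
        c₂₀ j jk = cnt-none _ W λ u _ → f u
          where
          f : ∀ u → is (y u) j ∧ q₂ u ≡ false
          f u with is (y u) j in eq | lt (κ u) N
          ... | false | _ = refl
          ... | true | true = refl
          ... | true | false = lt-f (subst (k ≤_) (sym (is-T {y u} eq)) jk)

      -- The marked entries are counted by letter: each of the `k` largest letters `j` occurs at
      -- most `N ∸ o (ℓ j)` times on levels below `N`, and each of the `k` smallest at most
      -- `o (ℓ j)` times on the other levels.
      bound : ∀ {m} {g : Fin k → ℕ} → Fam y W m g →
              m + sumN (λ i → o (ℓ (ν ∸ i))) k ≤ k * N + sumN (λ i → o (ℓ i)) k
      bound {m} F = begin
        m + S₁ ≤⟨ +-monoˡ-≤ S₁ (≤-trans (Certificate.certify y κ inc p cap F) (cnt-∨ p q₁ q₂ W λ u _ → pq u)) ⟩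
        cnt q₁ W + cnt q₂ W + S₁ ≤⟨ +-monoˡ-≤ S₁ (+-mono-≤ b₁ b₂) ⟩
        sumN (λ i → N ∸ o (ℓ (ν ∸ i))) k + S₂ + S₁ ≡⟨ trans (+-assoc T₁ S₂ S₁) (trans (cong (T₁ +_) (+-comm S₂ S₁)) (sym (+-assoc T₁ S₁ S₂))) ⟩
        T₁ + S₁ + S₂ ≡⟨ cong (_+ S₂) (trans (sym (sumN-+ (λ i → N ∸ o (ℓ (ν ∸ i))) (λ i → o (ℓ (ν ∸ i))) k)) (trans (sumN-cong k λ c _ → m∸n+n≡m (o≤N (ℓ≤ (m∸n≤m ν c)))) (sumN-const N k))) ⟩
        k * N + S₂ ∎
        where
        open ≤-Reasoning
        S₁ = sumN (λ i → o (ℓ (ν ∸ i))) k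
        S₂ = sumN (λ i → o (ℓ i)) k
        T₁ = sumN (λ i → N ∸ o (ℓ (ν ∸ i))) k
        b₁ : cnt q₁ W ≤ T₁
        b₁ = ≤-trans (≤-reflexive (trans (sym (part q₁)) (trans (sumN-rev _ n) (sumN-trunc _ k n k≤n λ i ki il → c₁₀ (ν ∸ i) (≤-trans (+-monoʳ-≤ (ν ∸ i) ki) (≤-reflexive (m∸n+n≡m (s≤s⁻¹ il))))))))
               (sumN-mono k λ i ik → c₁ (ν ∸ i) (m∸n≤m ν i))
        b₂ : cnt q₂ W ≤ S₂
        b₂ = ≤-trans (≤-reflexive (trans (sym (part q₂)) (sumN-trunc _ k n k≤n λ i ki _ → c₂₀ i ki)))
               (sumN-mono k λ i ik → c₂ i (s≤s⁻¹ (<-≤-trans ik k≤n)))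

-- Partially filled tableaux

_⟨_≔_⟩ : (ℕ → ℕ) → ℕ → ℕ → ℕ → ℕ
(f ⟨ v ≔ x ⟩) u = if is u v then x else f u

⟨⟩-≡ : ∀ f v x → (f ⟨ v ≔ x ⟩) v ≡ x
⟨⟩-≡ f v x rewrite is-t {v} refl = refl

⟨⟩-≢ : ∀ f v x {u} → u ≢ v → (f ⟨ v ≔ x ⟩) u ≡ f u
⟨⟩-≢ f v x ne rewrite is-f ne = refl

-- cx u and cy u are the row and the column of the diagonal box of the class of u.
record Diag (ν : ℕ) (cx cy : ℕ → ℕ) : Set where
  field
    per-x : ∀ u → cx (u + suc ν) ≡ cx u
    per-y : ∀ u → cy (u + suc ν) ≡ cy u
    win   : ∀ {u v} → cx u ≡ cx v → u < v → u + suc ν ≤ v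
    xy    : ∀ {u v} → cx u < cx v → cy v < cy u
    yx    : ∀ {u v} → cy u < cy v → cx v < cx u

  x⇒y : ∀ {u v} → cx u ≡ cx v → cy u ≡ cy v
  x⇒y {u} {v} q with <-cmp (cy u) (cy v)
  ... | tri< l _ _ = ⊥-elim (<⇒≢ (yx l) (sym q))
  ... | tri≈ _ p _ = p
  ... | tri> _ _ l = ⊥-elim (<⇒≢ (yx l) q)

  y⇒x : ∀ {u v} → cy u ≡ cy v → cx u ≡ cx v
  y⇒x {u} {v} q with <-cmp (cx u) (cx v)
  ... | tri< l _ _ = ⊥-elim (<⇒≢ (xy l) (sym q))
  ... | tri≈ _ p _ = p
  ... | tri> _ _ l = ⊥-elim (<⇒≢ (xy l) q)

trD : ∀ {ν cx cy} → Diag ν cx cy → Diag ν cy cx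
trD D = record { per-x = per-y ; per-y = per-x ; win = λ q → win (y⇒x q) ; xy = yx ; yx = xy }
  where open Diag D

Dom : (ℕ → ℕ) → (ℕ → ℕ) → ℕ → ℕ → Set
Dom cx cy a b = ∃ λ u → a ≤ cx u × b ≤ cy u

∅₂ : ℕ → ℕ → Set
∅₂ _ _ = ⊥

At : ℕ → ℕ → ℕ → ℕ → Set
At a b x y = x ≡ a × y ≡ b

-- A partially filled tableau: the entry u sits in the box (R u , C u); I is
-- the region not filled yet, H the hole.  An entry that has not entered yet
-- carries the coordinates of the diagonal box of its class.
record Conf (cx cy : ℕ → ℕ) (I H : ℕ → ℕ → Set) : Set where
  field
    -- `ê u` is the last entered entry of the class of `u`; it occupies the diagonal box of the
    -- class unless the hole is there. Presence thus becomes a comparison with `ê u`.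
    R C ê : ℕ → ℕ
  Pres : ℕ → Set
  Pres u = u ≤ ê u
  field
    ê-x   : ∀ u → cx (ê u) ≡ cx u
    ê-y   : ∀ u → cy (ê u) ≡ cy u
    ê-cx  : ∀ {u v} → cx u ≡ cx v → ê u ≡ ê v
    ê-cy  : ∀ {u v} → cy u ≡ cy v → ê u ≡ ê v
    tailR : ∀ {u} → ¬ Pres u → R u ≡ cx u
    tailC : ∀ {u} → ¬ Pres u → C u ≡ cy u
    R≤    : ∀ u → R u ≤ cx u
    C≤    : ∀ u → C u ≤ cy u
    notI  : ∀ {u} → Pres u → ¬ I (R u) (C u)
    notH  : ∀ {u} → Pres u → ¬ H (R u) (C u)
    fill  : ∀ {a b} → Dom cx cy a b → ¬ I a b → ¬ H a b → ∃ λ u → Pres u × R u ≡ a × C u ≡ b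
    ord   : ∀ {u v} → Pres u → Pres v → R u ≤ R v → C u ≤ C v → u ≤ v
    diag  : ∀ u → ¬ H (cx u) (cy u) → R (ê u) ≡ cx u × C (ê u) ≡ cy u
    I-down : ∀ {a b a′ b′} → I a b → a′ ≤ a → b′ ≤ b → I a′ b′
    I-diag : ∀ u → ¬ I (cx u) (cy u)

  ê-pres : ∀ u → Pres (ê u)
  ê-pres u = ≤-reflexive (sym (ê-cx (ê-x u)))

  same : ∀ {u v} → Pres u → Pres v → R u ≡ R v → C u ≡ C v → u ≡ v
  same pu pv r c = ≤-antisym (ord pu pv (≤-reflexive r) (≤-reflexive c)) (ord pv pu (≤-reflexive (sym r)) (≤-reflexive (sym c)))

trC : ∀ {cx cy I H} → Conf cx cy I H → Conf cy cx (flip I) (flip H)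
trC c = record
  { R = C ; C = R ; ê = ê ; ê-x = ê-y ; ê-y = ê-x ; ê-cx = ê-cy ; ê-cy = ê-cx
  ; tailR = tailC ; tailC = tailR ; R≤ = C≤ ; C≤ = R≤ ; notI = notI ; notH = notH
  ; fill = λ { (u , p , q) i h → let (v , pv , r , s) = fill (u , q , p) i h in v , pv , s , r }
  ; ord = λ pu pv r s → ord pu pv s r ; diag = λ u h → swap (diag u h)
  ; I-down = λ i p q → I-down i q p ; I-diag = I-diag }
  where open Conf c

mapH : ∀ {cx cy I H H′} → (∀ {a b} → H a b → H′ a b) → (∀ {a b} → H′ a b → H a b) → Conf cx cy I H → Conf cx cy I H′
mapH f g c = record
  { R = R ; C = C ; ê = ê ; ê-x = ê-x ; ê-y = ê-y ; ê-cx = ê-cx ; ê-cy = ê-cy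
  ; tailR = tailR ; tailC = tailC ; R≤ = R≤ ; C≤ = C≤ ; notI = notI ; notH = λ p h → notH p (g h)
  ; fill = λ d i h → fill d i (h ∘ f) ; ord = ord ; diag = λ u h → diag u (h ∘ f) ; I-down = I-down ; I-diag = I-diag }
  where open Conf c

-- `top` has content only when the hole is at a diagonal box. It remembers which entries the
-- departed occupant dominated, so that the larger entry of the same class can take its place
-- without breaking the order.
record HConf (cx cy : ℕ → ℕ) (I : ℕ → ℕ → Set) : Set where
  field
    ha hb : ℕ
    conf : Conf cx cy I (At ha hb)
  open Conf conf public
  field
    hdom : Dom cx cy ha hb
    hI   : ¬ I ha hb
    top  : ∀ {u} → ha ≡ cx u → hb ≡ cy u → ∀ {x} → Pres x → R x ≤ ha → C x ≤ hb → x ≤ ê u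

trH : ∀ {cx cy I} → HConf cx cy I → HConf cy cx (flip I)
trH c = record
  { ha = hb ; hb = ha ; conf = mapH swap swap (trC conf) ; hdom = let (u , p , q) = hdom in u , q , p
  ; hI = hI ; top = λ p q px r s → top q p px s r }
  where open HConf c

-- The vertical move of a slide. Horizontal moves are this module for the transposed configuration,
-- so that facts about rows and columns are proved once.
module Down {ν cx cy I} (D : Diag ν cx cy) (c : HConf cx cy I) (v : ℕ)
            (pv : v ≤ HConf.ê c v) (rv : HConf.R c v ≡ suc (HConf.ha c)) (cv : HConf.C c v ≡ HConf.hb c)
            (mn : ∀ u → u ≤ HConf.ê c u → HConf.R c u ≡ HConf.ha c → HConf.C c u ≡ suc (HConf.hb c) → v ≤ u) where
  open Diag D
  open HConf c

  ha<cx : suc ha ≤ cx v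
  ha<cx = subst (_≤ cx v) rv (R≤ v)

  hb≤cy : hb ≤ cy v
  hb≤cy = subst (_≤ cy v) cv (C≤ v)

  notDiag : ∀ u → ¬ At ha hb (cx u) (cy u)
  notDiag u (p , q) = <⇒≱ (xy {u} {v} (≤-trans (s≤s (≤-reflexive p)) ha<cx)) (≤-trans (≤-reflexive q) hb≤cy)

  beyond : ∀ {u} → Pres u → R u ≡ ha → hb ≤ C u → v < u
  beyond {u} pu ru cu with m≤n⇒m<n∨m≡n cu
  ... | inj₂ e = ⊥-elim (notH pu (ru , sym e))
  ... | inj₁ l with fill {ha} {suc hb} (u , ≤-trans (≤-reflexive (sym ru)) (R≤ u) , ≤-trans l (C≤ u))
                     (λ i → hI (I-down i ≤-refl (n≤1+n hb))) (λ { (_ , q) → 1+n≢n q })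
  ... | z , pz , rz , cz = ≤∧≢⇒< (≤-trans (mn z pz rz cz) (ord pz pu (≤-reflexive (trans rz (sym ru))) (≤-trans (≤-reflexive cz) l)))
                             λ { refl → 1+n≢n (trans (sym rv) ru) }

  R′ : ℕ → ℕ
  R′ = R ⟨ v ≔ ha ⟩

  R′v : R′ v ≡ ha
  R′v = ⟨⟩-≡ R v ha

  R′o : ∀ {u} → u ≢ v → R′ u ≡ R u
  R′o = ⟨⟩-≢ R v ha

  ê≢v : ∀ u → ¬ At (suc ha) hb (cx u) (cy u) → ê u ≢ v
  ê≢v u na q = na (trans (sym (proj₁ (diag u (notDiag u)))) (trans (cong R q) rv) , trans (sym (proj₂ (diag u (notDiag u)))) (trans (cong C q) cv))

  moved : HConf cx cy I
  moved = record
    { ha = suc ha ; hb = hb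
    ; conf = record
      { R = R′ ; C = C ; ê = ê ; ê-x = ê-x ; ê-y = ê-y ; ê-cx = ê-cx ; ê-cy = ê-cy
      ; tailR = λ {u} np → trans (R′o λ { refl → np pv }) (tailR np) ; tailC = tailC
      ; R≤ = R′≤ ; C≤ = C≤ ; notI = notI′ ; notH = notH′ ; fill = fill′ ; ord = ord′
      ; diag = λ u na → trans (R′o (ê≢v u na)) (proj₁ (diag u (notDiag u))) , proj₂ (diag u (notDiag u))
      ; I-down = I-down ; I-diag = I-diag }
    ; hdom = v , ha<cx , hb≤cy
    ; hI = λ i → hI (I-down i (n≤1+n ha) ≤-refl)
    ; top = top′ }
    where
    R′≤ : ∀ u → R′ u ≤ cx u
    R′≤ u with u ≟ v
    ... | yes refl = ≤-trans (≤-reflexive R′v) (<⇒≤ ha<cx)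
    ... | no ne = ≤-trans (≤-reflexive (R′o ne)) (R≤ u)
    notI′ : ∀ {u} → Pres u → ¬ I (R′ u) (C u)
    notI′ {u} pu i with u ≟ v
    ... | yes refl = hI (subst₂ I R′v cv i)
    ... | no ne = notI pu (subst (λ z → I z (C u)) (R′o ne) i)
    notH′ : ∀ {u} → Pres u → ¬ At (suc ha) hb (R′ u) (C u)
    notH′ {u} pu (p , q) with u ≟ v
    ... | yes refl = 1+n≢n (trans (sym p) R′v)
    ... | no ne = ne (same pu pv (trans (sym (R′o ne)) (trans p (sym rv))) (trans q (sym cv)))
    fill′ : ∀ {a b} → Dom cx cy a b → ¬ I a b → ¬ At (suc ha) hb a b → ∃ λ u → Pres u × R′ u ≡ a × C u ≡ b
    fill′ {a} {b} d i h with a ≟ ha | b ≟ hb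
    ... | yes refl | yes refl = v , pv , R′v , cv
    ... | yes refl | no nb = let (u , pu , r , s) = fill d i (nb ∘ proj₂) in u , pu , trans (R′o λ { refl → h (trans (sym r) rv , trans (sym s) cv) }) r , s
    ... | no na | _ = let (u , pu , r , s) = fill d i (na ∘ proj₁) in u , pu , trans (R′o λ { refl → h (trans (sym r) rv , trans (sym s) cv) }) r , s
    ord′ : ∀ {u u′} → Pres u → Pres u′ → R′ u ≤ R′ u′ → C u ≤ C u′ → u ≤ u′
    ord′ {u} {u′} pu pu′ r s with u ≟ v | u′ ≟ v
    ... | yes refl | yes refl = ≤-refl
    ... | no ne | no ne′ = ord pu pu′ (subst₂ _≤_ (R′o ne) (R′o ne′) r) s
    ... | no ne | yes refl = ord pu pv (≤-trans (subst₂ _≤_ (R′o ne) R′v r) (≤-trans (n≤1+n ha) (≤-reflexive (sym rv)))) s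
    ... | yes refl | no ne′ with m≤n⇒m<n∨m≡n (subst₂ _≤_ R′v (R′o ne′) r)
    ... | inj₁ l = ord pv pu′ (≤-trans (≤-reflexive rv) l) s
    ... | inj₂ e = <⇒≤ (beyond pu′ (sym e) (subst (_≤ C u′) cv s))
    top′ : ∀ {u} → suc ha ≡ cx u → hb ≡ cy u → ∀ {x} → Pres x → R′ x ≤ suc ha → C x ≤ hb → x ≤ ê u
    top′ {u} p q {x} px r s = ≤-trans x≤v (≤-reflexive v≡)
      where
      v≡ : v ≡ ê u
      v≡ = same pv (ê-pres u) (trans rv (trans p (sym (proj₁ (diag u (notDiag u)))))) (trans cv (trans q (sym (proj₂ (diag u (notDiag u))))))
      x≤v : x ≤ v
      x≤v with x ≟ v
      ... | yes refl = ≤-refl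
      ... | no ne = ord px pv (≤-trans (subst (_≤ suc ha) (R′o ne) r) (≤-reflexive (sym rv))) (≤-trans s (≤-reflexive (sym cv)))

  -- If `u` had not entered, `ha` would be the row of its diagonal box. That box is not left of the
  -- hole, so its occupant `ê u` exceeds `v` by `beyond`, although it is smaller than `u`.
  earlier-pres : ∀ {u} → u < v → R u ≡ ha → Pres u
  earlier-pres {u} u<v ru with u ≤? ê u
  ... | yes p = p
  ... | no np = ⊥-elim (<-asym u<v (<-trans v<ê (≰⇒> np)))
    where
    dg = diag u (notDiag u)
    cxu : cx u ≡ ha
    cxu = trans (sym (tailR np)) ru
    v<ê : v < ê u
    v<ê = beyond (ê-pres u) (trans (proj₁ dg) cxu)
            (≤-trans hb≤cy (≤-trans (<⇒≤ (xy {u} {v} (≤-trans (s≤s (≤-reflexive cxu)) ha<cx))) (≤-reflexive (sym (proj₂ dg)))))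

  -- The matching sends an entry to the one directly below it. An entry of row `ha` before `v` lies
  -- left of the hole by `beyond`, so the box below it lies left of that of `v`, and its entry still
  -- precedes `v`.
  ball : Ballot R ha v
  ball s d sd = cnt-inj Φ mono d d ex
    where
    Φ : ℕ → ℕ → Set
    Φ x x₁ = Pres (s + x) × Pres (s + x₁) × R (s + x) ≡ ha × R (s + x₁) ≡ suc ha × C (s + x) ≡ C (s + x₁)
    mono : ∀ {x x₁ z z₁} → Φ x x₁ → Φ z z₁ → x < z → x₁ < z₁
    mono {x} {x₁} {z} {z₁} (px , px₁ , rx , rx₁ , cx₁) (pz , pz₁ , rz , rz₁ , cz₁) l = +-cancelˡ-< s x₁ z₁
        (≤∧≢⇒< (ord px₁ pz₁ (≤-reflexive (trans rx₁ (sym rz₁))) (<⇒≤ cc)) λ q → <⇒≢ cc (cong C q))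
      where
      cc : C (s + x₁) < C (s + z₁)
      cc = ≰⇒> λ le → <⇒≱ (+-monoʳ-< s l) (ord pz px (≤-reflexive (trans rz (sym rx))) (subst₂ _≤_ (sym cz₁) (sym cx₁) le))
    ex : ∀ x → x < d → is (R (s + x)) ha ≡ true → ∃ λ x₁ → Φ x x₁ × x₁ < d × is (R (s + x₁)) (suc ha) ≡ true
    ex x l q = u′ ∸ s , (pu , subst Pres (sym su) pu′ , ru , trans (cong R su) ru′ , sym (trans (cong C su) cu′)) ,
               +-cancelˡ-< s _ d (subst₂ _<_ (sym su) (sym sd) u′<v) , is-t (trans (cong R su) ru′)
      where
      u = s + x
      u<v : u < v
      u<v = subst (u <_) sd (+-monoʳ-< s l)
      ru : R u ≡ ha
      ru = is-T {R u} q
      pu = earlier-pres u<v ru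
      cu : C u < hb
      cu = ≰⇒> λ le → <-asym u<v (beyond pu ru le)
      F = fill {suc ha} {C u} (v , ha<cx , ≤-trans (<⇒≤ cu) hb≤cy) (λ i → notI pu (I-down i (≤-trans (≤-reflexive ru) (n≤1+n ha)) ≤-refl)) (λ { (p , _) → 1+n≢n p })
      u′ = proj₁ F
      pu′ = proj₁ (proj₂ F)
      ru′ = proj₁ (proj₂ (proj₂ F))
      cu′ = proj₂ (proj₂ (proj₂ F))
      u≤u′ : u ≤ u′
      u≤u′ = ord pu pu′ (≤-trans (≤-reflexive ru) (≤-trans (n≤1+n ha) (≤-reflexive (sym ru′)))) (≤-reflexive (sym cu′))
      u′<v : u′ < v
      u′<v = ≤∧≢⇒< (ord pu′ pv (≤-reflexive (trans ru′ (sym rv))) (≤-trans (≤-reflexive cu′) (≤-trans (<⇒≤ cu) (≤-reflexive (sym cv)))))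
               λ { e → <⇒≢ cu (trans (sym cu′) (trans (cong C e) cv)) }
      su : s + (u′ ∸ s) ≡ u′
      su = m+[n∸m]≡n (≤-trans (m≤m+n s x) u≤u′)

  R′≼R : R′ ≼ R
  R′≼R = pull-≼ ball (λ u → R′o) R′v rv

data Moves {ν cx cy} {I : ℕ → ℕ → Set} (D : Diag ν cx cy) : HConf cx cy I → HConf cx cy I → Set where
  here  : ∀ {c} → Moves D c c
  down  : ∀ {c c′} v pv rv cv mn → Moves D (Down.moved D c v pv rv cv mn) c′ → Moves D c c′
  right : ∀ {c c′} v pv rv cv mn → Moves D (trH (Down.moved (trD D) (trH c) v pv rv cv mn)) c′ → Moves D c c′

module _ {ν cx cy} {I : ℕ → ℕ → Set} (D : Diag ν cx cy) where

  Moves-≼ : ∀ {c c′ : HConf cx cy I} → Moves D c c′ →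
            (HConf.R c′ ≼ HConf.R c) × (HConf.C c′ ≼ HConf.C c) × (∀ u → HConf.ê c′ u ≡ HConf.ê c u)
  Moves-≼ here = ≼-refl , ≼-refl , λ _ → refl
  Moves-≼ (down {c} v pv rv cv mn m) = let (p , q , r) = Moves-≼ m in ≼-trans p (Down.R′≼R D c v pv rv cv mn) , q , r
  Moves-≼ (right {c} v pv rv cv mn m) = let (p , q , r) = Moves-≼ m in p , ≼-trans q (Down.R′≼R (trD D) (trH c) v pv rv cv mn) , r

  -- The corner of the diagonal at which the path ended receives the next entry of its class.
  module Refill (c : HConf cx cy I) (z : ℕ) (az : HConf.ha c ≡ cx z) (bz : HConf.hb c ≡ cy z) where
    open Diag D
    open HConf c

    ê′ : ℕ → ℕ
    ê′ u = if is (cx u) (cx z) then ê u + suc ν else ê u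

    ê′-t : ∀ {u} → cx u ≡ cx z → ê′ u ≡ ê u + suc ν
    ê′-t q rewrite is-t q = refl

    ê′-f : ∀ {u} → cx u ≢ cx z → ê′ u ≡ ê u
    ê′-f q rewrite is-f q = refl

    ê≤ê′ : ∀ u → ê u ≤ ê′ u
    ê≤ê′ u with is (cx u) (cx z)
    ... | true = m≤m+n _ _
    ... | false = ≤-refl

    nu : ℕ
    nu = ê z + suc ν

    cxnu : cx nu ≡ cx z
    cxnu = trans (per-x (ê z)) (ê-x z)
    cynu : cy nu ≡ cy z
    cynu = trans (per-y (ê z)) (ê-y z)

    ênu : ê nu ≡ ê z
    ênu = ê-cx cxnu

    npnu : ¬ Pres nu
    npnu p = <⇒≱ (m<m+n (ê z) (s≤s z≤n)) (≤-trans p (≤-reflexive ênu))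

    old? : ∀ {u} → u ≤ ê′ u → Pres u ⊎ u ≡ nu
    old? {u} p with u ≤? ê u
    ... | yes q = inj₁ q
    ... | no nq with cx u ≟ cx z
    ... | no ne = ⊥-elim (nq (≤-trans p (≤-reflexive (ê′-f ne))))
    ... | yes e = inj₂ (≤-antisym (≤-trans p (≤-reflexive (trans (ê′-t e) (cong (_+ suc ν) (ê-cx e)))))
                    (win (trans (ê-x z) (sym e)) (≤-<-trans (≤-reflexive (sym (ê-cx e))) (≰⇒> nq))))

    Rnu = trans (tailR npnu) cxnu
    Cnu = trans (tailC npnu) cynu

    refilled : Conf cx cy I ∅₂
    refilled = record
      { R = R ; C = C ; ê = ê′ ; ê-x = êx ; ê-y = êy ; ê-cx = êcx ; ê-cy = λ q → êcx (y⇒x q)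
      ; tailR = λ np → tailR λ p → np (≤-trans p (ê≤ê′ _))
      ; tailC = λ np → tailC λ p → np (≤-trans p (ê≤ê′ _))
      ; R≤ = R≤ ; C≤ = C≤ ; notI = notI′ ; notH = λ _ ()
      ; fill = fill′ ; ord = ord′ ; diag = diag′ ; I-down = I-down ; I-diag = I-diag }
      where
      êx : ∀ u → cx (ê′ u) ≡ cx u
      êx u with is (cx u) (cx z)
      ... | true = trans (per-x (ê u)) (ê-x u)
      ... | false = ê-x u
      êy : ∀ u → cy (ê′ u) ≡ cy u
      êy u with is (cx u) (cx z)
      ... | true = trans (per-y (ê u)) (ê-y u)
      ... | false = ê-y u
      êcx : ∀ {u v} → cx u ≡ cx v → ê′ u ≡ ê′ v
      êcx {u} {v} q rewrite q | ê-cx q = refl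
      notI′ : ∀ {u} → u ≤ ê′ u → ¬ I (R u) (C u)
      notI′ {u} p i with old? p
      ... | inj₁ q = notI q i
      ... | inj₂ refl = I-diag z (subst₂ I Rnu Cnu i)
      fill′ : ∀ {a b} → Dom cx cy a b → ¬ I a b → ¬ ⊥ → ∃ λ u → u ≤ ê′ u × R u ≡ a × C u ≡ b
      fill′ {a} {b} d i _ with a ≟ ha | b ≟ hb
      ... | yes refl | yes refl = nu , ≤-reflexive (sym (trans (ê′-t cxnu) (cong (_+ suc ν) ênu))) , trans Rnu (sym az) , trans Cnu (sym bz)
      ... | no na | _ = let (u , p , r) = fill d i (na ∘ proj₁) in u , ≤-trans p (ê≤ê′ u) , r
      ... | yes _ | no nb = let (u , p , r) = fill d i (nb ∘ proj₂) in u , ≤-trans p (ê≤ê′ u) , r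
      ord′ : ∀ {u v} → u ≤ ê′ u → v ≤ ê′ v → R u ≤ R v → C u ≤ C v → u ≤ v
      ord′ {u} {v} pu pv r s with old? pu | old? pv
      ... | inj₁ qu | inj₁ qv = ord qu qv r s
      ... | inj₂ refl | inj₂ refl = ≤-refl
      ... | inj₁ qu | inj₂ refl = ≤-trans (top az bz qu (≤-trans r (≤-reflexive (trans Rnu (sym az)))) (≤-trans s (≤-reflexive (trans Cnu (sym bz))))) (m≤m+n (ê z) (suc ν))
      -- An entry weakly southeast of a diagonal box can only sit in that box itself, and this box
      -- is the hole.
      ... | inj₂ refl | inj₁ qv = ⊥-elim (notH qv (trans rv (sym az) , trans cv (sym bz)))
        where
        zr : cx z ≤ R v
        zr = ≤-trans (≤-reflexive (sym Rnu)) r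
        zc : cy z ≤ C v
        zc = ≤-trans (≤-reflexive (sym Cnu)) s
        cxe : cx z ≡ cx v
        cxe with m≤n⇒m<n∨m≡n (≤-trans zr (R≤ v))
        ... | inj₂ e = e
        ... | inj₁ l = ⊥-elim (<⇒≱ (xy {z} {v} l) (≤-trans zc (C≤ v)))
        rv : R v ≡ cx z
        rv = ≤-antisym (≤-trans (R≤ v) (≤-reflexive (sym cxe))) zr
        cv : C v ≡ cy z
        cv = ≤-antisym (≤-trans (C≤ v) (≤-reflexive (sym (x⇒y cxe)))) zc
      diag′ : ∀ u → ¬ ⊥ → R (ê′ u) ≡ cx u × C (ê′ u) ≡ cy u
      diag′ u _ with cx u ≟ cx z
      ... | yes e = trans (cong R eq) (trans Rnu (sym e)) , trans (cong C eq) (trans Cnu (sym (x⇒y e)))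
        where
        eq : ê′ u ≡ nu
        eq = trans (ê′-t e) (cong (_+ suc ν) (ê-cx e))
      ... | no ne = let (p , q) = diag u λ { (a , _) → ne (trans a az) } in trans (cong R (ê′-f ne)) p , trans (cong C (ê′-f ne)) q

module _ {cx cy : ℕ → ℕ} {I : ℕ → ℕ → Set} (c : Conf cx cy I ∅₂) (I′ : ℕ → ℕ → Set) (a b : ℕ)
         (I⇒ : ∀ {x y} → I′ x y → I x y × ¬ At a b x y) (⇒I : ∀ {x y} → I x y → ¬ At a b x y → I′ x y)
         (down′ : ∀ {x y x′ y′} → I′ x y → x′ ≤ x → y′ ≤ y → I′ x′ y′) (Iab : I a b) (dab : Dom cx cy a b) where
  open Conf c

  open-corner : HConf cx cy I′
  open-corner = record
    { ha = a ; hb = b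
    ; conf = record
      { R = R ; C = C ; ê = ê ; ê-x = ê-x ; ê-y = ê-y ; ê-cx = ê-cx ; ê-cy = ê-cy
      ; tailR = tailR ; tailC = tailC ; R≤ = R≤ ; C≤ = C≤
      ; notI = λ p i → notI p (proj₁ (I⇒ i))
      ; notH = λ { p (refl , refl) → notI p Iab }
      ; fill = λ d i h → fill d (λ j → i (⇒I j h)) (λ ())
      ; ord = ord ; diag = λ u _ → diag u (λ ()) ; I-down = down′ ; I-diag = λ u i → I-diag u (proj₁ (I⇒ i)) }
    ; hdom = dab
    ; hI = λ i → proj₂ (I⇒ i) (refl , refl)
    ; top = λ { {u} refl refl → ⊥-elim (I-diag u Iab) } }

per-% : ∀ {ν} (f : ℕ → ℕ) → (∀ u → f (u + suc ν) ≡ f u) → ∀ u → f (u % suc ν) ≡ f u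
per-% {ν} f p u = trans (sym (per-* f p (u % suc ν) (u / suc ν))) (cong f (sym (m≡m%n+[m/n]*n u (suc ν))))

module _ {ν cx cy} (D : Diag ν cx cy) where
  open Diag D

  Dom? : ∀ a b → Dec (Dom cx cy a b)
  Dom? a b with allOr (λ u → lt (cx u) a ∨ lt (cy u) b) (suc ν)
  ... | inj₂ (u , _ , q) = yes (u , ge (proj₁ (∨-F q)) , ge (proj₂ (∨-F q)))
    where
    ∨-F : ∀ {a b} → a ∨ b ≡ false → a ≡ false × b ≡ false
    ∨-F {false} {false} refl = refl , refl
    ge : ∀ {x y} → lt x y ≡ false → y ≤ x
    ge p = ≮⇒≥ λ l → case trans (sym p) (lt-t l) of λ ()
  ... | inj₁ h = no λ (u , p , q) → case trans (sym (h (u % suc ν) (m%n<n u (suc ν))))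
                   (cong₂ _∨_ (lt-f (≤-trans p (≤-reflexive (sym (per-% cx per-x u))))) (lt-f (≤-trans q (≤-reflexive (sym (per-% cy per-y u)))))) of λ ()

  exits : ∀ {I} (c : HConf cx cy I) → ¬ Dom cx cy (suc (HConf.ha c)) (HConf.hb c) → ¬ Dom cx cy (HConf.ha c) (suc (HConf.hb c)) →
          ∃ λ z → HConf.ha c ≡ cx z × HConf.hb c ≡ cy z
  exits c nd nr with HConf.hdom c
  ... | z , p , q = z , ≤-antisym p (≮⇒≥ λ l → nd (z , l , q)) , ≤-antisym q (≮⇒≥ λ l → nr (z , p , l))

  AtDiag : ∀ {I} → HConf cx cy I → Set
  AtDiag c = ∃ λ z → HConf.ha c ≡ cx z × HConf.hb c ≡ cy z

  module _ {I : ℕ → ℕ → Set} (B : ℕ) (bnd : ∀ u → cx u + cy u ≤ B) where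

    -- Every move raises the sum of the coordinates of the hole, which `B` bounds on the domain; `k`
    -- is the room that is left.
    slides : ∀ k (c : HConf cx cy I) → B ≤ k + (HConf.ha c + HConf.hb c) → ∃ λ c′ → Moves D c c′ × AtDiag c′
    slides k c le with Dom? (suc (HConf.ha c)) (HConf.hb c) | Dom? (HConf.ha c) (suc (HConf.hb c))
    ... | no nd | no nr = c , here , exits c nd nr
    slides zero c le | yes (u , p , q) | _ = ⊥-elim (<⇒≱ (+-mono-<-≤ p q) (≤-trans (bnd u) le))
    slides zero c le | no _ | yes (u , p , q) = ⊥-elim (<⇒≱ (+-mono-≤-< p q) (≤-trans (bnd u) le))
    slides (suc k) c le | dd | dr = go dd dr
      where
      open HConf c
      D! : Dom cx cy (suc ha) hb → ∃ λ u → Pres u × R u ≡ suc ha × C u ≡ hb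
      D! d = fill d (λ i → hI (I-down i (n≤1+n ha) ≤-refl)) (λ (p , _) → 1+n≢n p)
      R! : Dom cx cy ha (suc hb) → ∃ λ u → Pres u × R u ≡ ha × C u ≡ suc hb
      R! d = fill d (λ i → hI (I-down i ≤-refl (n≤1+n hb))) (λ (_ , p) → 1+n≢n p)
      leR : B ≤ k + (suc ha + hb)
      leR = ≤-trans le (≤-reflexive (sym (+-suc k (ha + hb))))
      leC : B ≤ k + (ha + suc hb)
      leC = ≤-trans leR (≤-reflexive (cong (k +_) (sym (+-suc ha hb))))
      down! : ∀ v → Pres v → R v ≡ suc ha → C v ≡ hb → (∀ u → Pres u → R u ≡ ha → C u ≡ suc hb → v ≤ u) → ∃ λ c′ → Moves D c c′ × AtDiag c′
      down! v pv rv cv mn = let (c′ , m , z) = slides k (Down.moved D c v pv rv cv mn) leR in c′ , down v pv rv cv mn m , z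
      right! : ∀ v → Pres v → R v ≡ ha → C v ≡ suc hb → (∀ u → Pres u → R u ≡ suc ha → C u ≡ hb → v ≤ u) → ∃ λ c′ → Moves D c c′ × AtDiag c′
      right! v pv rv cv mn = let (c′ , m , z) = slides k (trH (Down.moved (trD D) (trH c) v pv cv rv (λ u pu a b → mn u pu b a))) leC
                             in c′ , right v pv cv rv (λ u pu a b → mn u pu b a) m , z
      go : Dec (Dom cx cy (suc ha) hb) → Dec (Dom cx cy ha (suc hb)) → ∃ λ c′ → Moves D c c′ × AtDiag c′
      go (no nd) (no nr) = c , here , exits c nd nr
      go (yes d) (no nr) = let (v , pv , rv , cv) = D! d in down! v pv rv cv λ u pu ru cu → ⊥-elim (nr (u , ≤-trans (≤-reflexive (sym ru)) (R≤ u) , ≤-trans (≤-reflexive (sym cu)) (C≤ u)))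
      go (no nd) (yes d) = let (v , pv , rv , cv) = R! d in right! v pv rv cv λ u pu ru cu → ⊥-elim (nd (u , ≤-trans (≤-reflexive (sym ru)) (R≤ u) , ≤-trans (≤-reflexive (sym cu)) (C≤ u)))
      go (yes d) (yes d′) with D! d | R! d′
      ... | v , pv , rv , cv | v′ , pv′ , rv′ , cv′ with ≤-total v v′
      ... | inj₁ l = down! v pv rv cv λ u pu ru cu → ≤-trans l (≤-reflexive (same pv′ pu (trans rv′ (sym ru)) (trans cv′ (sym cu))))
      ... | inj₂ l = right! v′ pv′ rv′ cv′ λ u pu ru cu → ≤-trans l (≤-reflexive (same pv pu (trans rv (sym ru)) (trans cv (sym cu))))

-- Runs of slides over the inner region

record State (cx cy : ℕ → ℕ) (I : ℕ → ℕ → Set) : Set where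
  field
    conf : Conf cx cy I ∅₂
  open Conf conf public
  field
    -- `cx` and `cy` are also the words of the initial filling, so these fields compare the present
    -- words with those at the start.
    R≼ : R ≼ cx
    C≼ : C ≼ cy

trS : ∀ {cx cy I} → State cx cy I → State cy cx (flip I)
trS S = record { conf = mapH id id (trC conf) ; R≼ = C≼ ; C≼ = R≼ }
  where open State S

mapI : ∀ {cx cy I I′} → (∀ {a b} → I a b → I′ a b) → (∀ {a b} → I′ a b → I a b) → State cx cy I → State cx cy I′
mapI f g S = record
  { conf = record
    { R = R ; C = C ; ê = ê ; ê-x = ê-x ; ê-y = ê-y ; ê-cx = ê-cx ; ê-cy = ê-cy
    ; tailR = tailR ; tailC = tailC ; R≤ = R≤ ; C≤ = C≤ ; notI = λ p i → notI p (g i) ; notH = notH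
    ; fill = λ d i h → fill d (i ∘ f) h ; ord = ord ; diag = diag ; I-down = λ i p q → f (I-down (g i) p q) ; I-diag = λ u i → I-diag u (g i) }
  ; R≼ = R≼ ; C≼ = C≼ }
  where open State S

start : ∀ {ν cx cy} → Diag ν cx cy → ∀ (I : ℕ → ℕ → Set) →
        (∀ {a b a′ b′} → I a b → a′ ≤ a → b′ ≤ b → I a′ b′) → (∀ u → ¬ I (cx u) (cy u)) →
        (∀ {a b} → Dom cx cy a b → ¬ I a b → ∃ λ u → cx u ≡ a × cy u ≡ b) → State cx cy I
start {ν} {cx} {cy} D I dn dg cover = record
  { conf = record
    { R = cx ; C = cy ; ê = _% n ; ê-x = x% ; ê-y = y% ; ê-cx = ê-c ; ê-cy = ê-c ∘ y⇒x
    ; tailR = λ _ → refl ; tailC = λ _ → refl ; R≤ = λ _ → ≤-refl ; C≤ = λ _ → ≤-refl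
    ; notI = λ _ → dg _ ; notH = λ _ ()
    ; fill = λ d i _ → let (u , p , q) = cover d i in u % n , ≤-reflexive (sym (m%n%n≡m%n u n)) , trans (x% u) p , trans (y% u) q
    ; ord = λ {u} {v} pu pv r c → case m≤n⇒m<n∨m≡n r of λ
        { (inj₁ l) → ⊥-elim (<⇒≱ (xy {u} {v} l) c)
        ; (inj₂ e) → ≤-trans pu (≤-trans (≤-reflexive (ê-c e)) (m%n≤m v n)) }
    ; diag = λ u _ → x% u , y% u ; I-down = dn ; I-diag = dg }
  ; R≼ = ≼-refl ; C≼ = ≼-refl }
  where
  open Diag D
  n = suc ν
  x% = per-% {ν} cx per-x
  y% = per-% {ν} cy per-y
  ê-c : ∀ {u v} → cx u ≡ cx v → u % n ≡ v % n
  ê-c {u} {v} q with <-cmp (u % n) (v % n)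
  ... | tri≈ _ e _ = e
  ... | tri< l _ _ = ⊥-elim (<⇒≱ (m%n<n v n) (≤-trans (m≤n+m n (u % n)) (win (trans (x% u) (trans q (sym (x% v)))) l)))
  ... | tri> _ _ l = ⊥-elim (<⇒≱ (m%n<n u n) (≤-trans (m≤n+m n (v % n)) (win (trans (x% v) (trans (sym q) (sym (x% u)))) l)))

Under : (ℕ → ℕ) → ℕ → ℕ → Set
Under f a b = b < f a

Corner : (ℕ → ℕ) → ℕ → ℕ → Set
Corner f a b = f a ≡ suc b × f (suc a) ≤ b

-- The last row is removed first and every row from its right end, so that the next box is always a
-- corner. The property is arbitrary because the same order of removal serves configurations here
-- and runs of the construction later.
peel : ∀ {ℓ} (S : (ℕ → ℕ) → Set ℓ) → (∀ f a b → Corner f a b → S f → S (f ⟨ a ≔ b ⟩)) →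
       ∀ A f → (∀ x → A ≤ x → f x ≡ 0) → S f → ∃ λ f′ → (∀ x → f′ x ≡ 0) × S f′
peel S st zero f z s = f , (λ x → z x z≤n) , s
peel S st (suc A) f z s = go (f A) f refl z s
  where
  go : ∀ l f → f A ≡ l → (∀ x → suc A ≤ x → f x ≡ 0) → S f → ∃ λ f′ → (∀ x → f′ x ≡ 0) × S f′
  go zero f e z s = peel S st A f (λ x l → case m≤n⇒m<n∨m≡n l of λ { (inj₁ l) → z x l ; (inj₂ refl) → e }) s
  go (suc l) f e z s = go l (f ⟨ A ≔ l ⟩) (⟨⟩-≡ f A l) (λ x p → trans (⟨⟩-≢ f A l (>⇒≢ p)) (z x p))
                         (st f A l (e , ≤-trans (≤-reflexive (z (suc A) ≤-refl)) z≤n) s)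

module Advance {ν cx cy f} (D : Diag ν cx cy) (S : State cx cy (Under f)) {a b : ℕ} (co : Corner f a b) (dab : Dom cx cy a b) where
  open State S
  f′ = f ⟨ a ≔ b ⟩

  f′≤f : ∀ x → f′ x ≤ f x
  f′≤f x with x ≟ a
  ... | yes refl = ≤-trans (≤-reflexive (⟨⟩-≡ f a b)) (≤-trans (n≤1+n b) (≤-reflexive (sym (proj₁ co))))
  ... | no ne = ≤-reflexive (⟨⟩-≢ f a b ne)

  opened : HConf cx cy (Under f′)
  opened = open-corner conf (Under f′) a b
    (λ {x} {y} l → <-≤-trans l (f′≤f x) , λ { (refl , refl) → <-irrefl refl (subst (b <_) (⟨⟩-≡ f a b) l) })
    (λ {x} {y} → keep x y) down′ (≤-reflexive (sym (proj₁ co))) dab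
    where
    keep : ∀ x y → y < f x → ¬ At a b x y → y < f′ x
    keep x y l na with x ≟ a
    ... | yes refl = subst (y <_) (sym (⟨⟩-≡ f a b)) (≤∧≢⇒< (s≤s⁻¹ (≤-trans l (≤-reflexive (proj₁ co)))) λ q → na (refl , q))
    ... | no ne = subst (y <_) (sym (⟨⟩-≢ f a b ne)) l
    down′ : ∀ {x y x′ y′} → y < f′ x → x′ ≤ x → y′ ≤ y → y′ < f′ x′
    down′ {x} {y} {x′} {y′} l p q = keep x′ y′ (I-down (<-≤-trans l (f′≤f x)) p q) nat
      where
      nat : ¬ At a b x′ y′
      nat (refl , refl) with m≤n⇒m<n∨m≡n p
      ... | inj₂ refl = <-irrefl refl (<-≤-trans (subst (y <_) (⟨⟩-≡ f a b) l) q)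
      ... | inj₁ l′ = <⇒≱ (I-down (<-≤-trans l (f′≤f x)) l′ q) (proj₂ co)

  module _ {c′} (m : Moves D opened c′) (dg : AtDiag D c′) where
    after : State cx cy (Under f′)
    after = record
      { conf = Refill.refilled D c′ (proj₁ dg) (proj₁ (proj₂ dg)) (proj₂ (proj₂ dg))
      ; R≼ = ≼-trans (proj₁ (Moves-≼ D m)) R≼ ; C≼ = ≼-trans (proj₁ (proj₂ (Moves-≼ D m))) C≼ }

    after-ê : ∀ u → ê u ≤ State.ê after u
    after-ê u = ≤-trans (≤-reflexive (sym (proj₂ (proj₂ (Moves-≼ D m)) u))) (Refill.ê≤ê′ D c′ (proj₁ dg) (proj₁ (proj₂ dg)) (proj₂ (proj₂ dg)) u)

-- The inequality is what the lemma is for: since `ê` never decreases, a bound for the entries of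
-- completed tableaux holds in the middle of a run too.
completes : ∀ {ν cx cy f} (D : Diag ν cx cy) B → (∀ u → cx u + cy u ≤ B) → ∀ A → (∀ x → A ≤ x → f x ≡ 0) →
            (∀ {a b} → Under f a b → Dom cx cy a b) → (S : State cx cy (Under f)) →
            ∃ λ (S′ : State cx cy ∅₂) → ∀ u → State.ê S u ≤ State.ê S′ u
completes {ν} {cx} {cy} {f} D B bnd A z sub S =
  let (f′ , z′ , _ , S′ , le) = peel Q advance-corner A f z (sub , S , λ _ → ≤-refl)
  in mapI (λ {a} l → ⊥-elim (n≮0 (<-≤-trans l (≤-reflexive (z′ a))))) (λ ()) S′ , le
  where
  Q : (ℕ → ℕ) → Set
  Q g = (∀ {a b} → Under g a b → Dom cx cy a b) × ∃ λ (S′ : State cx cy (Under g)) → ∀ u → State.ê S u ≤ State.ê S′ u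
  advance-corner : ∀ g a b → Corner g a b → Q g → Q (g ⟨ a ≔ b ⟩)
  advance-corner g a b co (sub , S′ , le) = (λ {x} l → sub (<-≤-trans l (f′≤f x))) , after m dg , λ u → ≤-trans (le u) (after-ê m dg u)
    where
    open Advance D S′ co (sub (≤-reflexive (sym (proj₁ co))))
    sl = slides D B bnd B opened (m≤m+n B _)
    m = proj₁ (proj₂ sl)
    dg = proj₂ (proj₂ sl)

-- The staircase diagonal

record Stair (ν : ℕ) (cx cy : ℕ → ℕ) : Set where
  field
    P   : Per ν cx
    sum : ∀ u → cx u + cy u ≡ ν

  cy≡ : ∀ u → cy u ≡ ν ∸ cx u
  cy≡ u = sym (trans (cong (_∸ cx u) (sym (sum u))) (m+n∸m≡n (cx u) (cy u)))

  cx≡ : ∀ u → cx u ≡ ν ∸ cy u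
  cx≡ u = sym (trans (cong (_∸ cy u) (sym (sum u))) (m+n∸n≡m (cx u) (cy u)))

diagP : ∀ {ν cx cy} → Per ν cx → (∀ {u v} → cx u < cx v → cy v < cy u) → (∀ {u v} → cx u ≡ cx v → cy u ≡ cy v) → Diag ν cx cy
diagP {cx = cx} {cy} P xy xe = record
  { per-x = ρ-per ; per-y = λ u → xe (ρ-per u)
  ; win = λ {u} {v} q l → ≮⇒≥ λ l′ → ρ-inj l l′ q
  ; xy = xy
  ; yx = λ {u} {v} l → case <-cmp (cx v) (cx u) of λ
      { (tri< p _ _) → p
      ; (tri≈ _ p _) → ⊥-elim (<⇒≢ l (xe (sym p)))
      ; (tri> _ _ p) → ⊥-elim (<-asym l (xy p)) } }
  where open Per P

module _ {ν cx cy} (St : Stair ν cx cy) where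
  open Stair St
  open Per P

  stairD : Diag ν cx cy
  stairD = diagP P (λ {u} {v} l → subst₂ _<_ (sym (cy≡ v)) (sym (cy≡ u)) (∸-monoʳ-< l (ρ≤ v)))
                   (λ {u} {v} q → trans (cy≡ u) (trans (cong (ν ∸_) q) (sym (cy≡ v))))

  trStair : Stair ν cy cx
  trStair = record { sum = λ u → trans (+-comm (cy u) (cx u)) (sum u) ; P = record
    { ρ≤ = λ u → ≤-trans (≤-reflexive (cy≡ u)) (m∸n≤m ν (cx u))
    ; ρ-per = λ u → trans (cy≡ (u + n)) (trans (cong (ν ∸_) (ρ-per u)) (sym (cy≡ u)))
    ; ρ-inj = λ {u} {v} l l′ q → ρ-inj l l′ (trans (cx≡ u) (trans (cong (ν ∸_) q) (sym (cx≡ v))))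
    ; w = λ b → w (ν ∸ b)
    ; w< = λ {b} _ → w< (m∸n≤m ν b)
    ; ρw = λ {b} l → trans (cy≡ (w (ν ∸ b))) (trans (cong (ν ∸_) (ρw (m∸n≤m ν b))) (m∸[m∸n]≡n l)) } }

cnt-sum : ∀ {p q s} V → (∀ u → b2n (p u) ≡ b2n (q u) + b2n (s u)) → cnt p V ≡ cnt q V + cnt s V
cnt-sum zero h = refl
cnt-sum {p} {q} {s} (suc V) h = trans (cong₂ _+_ (h V) (cnt-sum {p} {q} {s} V h)) (lem (b2n (q V)) (b2n (s V)) (cnt q V) (cnt s V))
  where
  open +-*-Solver
  lem : ∀ a b c d → a + b + (c + d) ≡ a + c + (b + d)
  lem = solve 4 (λ a b c d → a :+ b :+ (c :+ d) := a :+ c :+ (b :+ d)) refl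

cnt-below : ∀ (y : ℕ → ℕ) W r → cnt (λ u → lt (y u) r) W ≡ sumN (λ a → cnt (λ u → is (y u) a) W) r
cnt-below y W zero = cnt-none (λ u → lt (y u) 0) W λ u _ → lt-f {y u} z≤n
cnt-below y W (suc r) = trans (cnt-sum W pt) (cong (cnt (λ u → is (y u) r) W +_) (cnt-below y W r))
  where
  pt : ∀ u → b2n (lt (y u) (suc r)) ≡ b2n (is (y u) r) + b2n (lt (y u) r)
  pt u with <-cmp (y u) r
  ... | tri< l ne _ rewrite lt-t l | is-f ne | lt-t (m<n⇒m<1+n l) = refl
  ... | tri≈ _ e _ rewrite lt-f {y u} {r} (≤-reflexive (sym e)) | is-t e | lt-t {y u} {suc r} (s≤s (≤-reflexive e)) = refl
  ... | tri> _ ne l rewrite lt-f (<⇒≤ l) | is-f ne | lt-f {y u} {suc r} l = refl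

-- One chain for each letter below k.
rows-Fam : ∀ k y V → Has k y V (cnt (λ u → lt (y u) k) V)
rows-Fam k y V = _ , ≤-refl , Fam-mono (λ _ → z≤n) (go V)
  where
  go : ∀ V → Fam {k} y V (cnt (λ u → lt (y u) k) V) toℕ
  go zero = nil
  go (suc V) with y V <? k
  ... | no nl rewrite lt-f (≮⇒≥ nl) = skip (go V)
  ... | yes l rewrite lt-t l = take i (≤-reflexive ti) (Fam-mono (upd-⊑ i (y V) (λ _ _ → ≤-refl) (≤-reflexive (sym ti))) (go V))
    where
    i = fromℕ< l
    ti : toℕ i ≡ y V
    ti = Fin.toℕ-fromℕ< l

-- Ranks of entries in their rows

module Rank {cx cy} (D : ∃ λ ν → Diag ν cx cy) (S : State cx cy ∅₂) where
  open Diag (proj₂ D)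
  open State S

  at : ∀ {a b} → Dom cx cy a b → ∃ λ u → Pres u × R u ≡ a × C u ≡ b
  at d = fill d (λ ()) (λ ())

  diag! : ∀ u → R (ê u) ≡ cx u × C (ê u) ≡ cy u
  diag! u = diag u (λ ())

  -- The diagonal box is the last box of its row.
  ≤ê : ∀ {u v} → Pres u → R u ≡ cx v → u ≤ ê v
  ≤ê {u} {v} pu q = ord pu (ê-pres v) (≤-reflexive (trans q (sym (proj₁ (diag! v))))) (≤-trans (C≤ u) (≤-trans le (≤-reflexive (sym (proj₂ (diag! v))))))
    where
    le : cy u ≤ cy v
    le = ≮⇒≥ λ l → <⇒≱ (yx {v} {u} l) (≤-trans (≤-reflexive (sym q)) (R≤ u))

  row-mono : ∀ {u v} → Pres u → Pres v → R u ≡ R v → C u < C v → u < v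
  row-mono pu pv r c = ≤∧≢⇒< (ord pu pv (≤-reflexive r) (<⇒≤ c)) λ { refl → <-irrefl refl c }

  row-anti : ∀ {u v} → Pres u → Pres v → R u ≡ R v → u < v → C u < C v
  row-anti pu pv r l = ≰⇒> λ le → <⇒≱ l (ord pv pu (≤-reflexive (sym r)) le)

  rank-≥ : ∀ {a V} k → (∀ b → b < k → ∃ λ x → x < V × Pres x × R x ≡ a × C x ≡ b) → k ≤ cnt (λ x → is (R x) a) V
  rank-≥ {a} {V} k h = subst (_≤ cnt (λ x → is (R x) a) V) (cnt-all k)
    (cnt-inj {λ _ → true} {λ x → is (R x) a} (λ b x → Pres x × R x ≡ a × C x ≡ b)
      (λ { {b} {x} {b′} {x′} (px , rx , cx₁) (px′ , rx′ , cx₁′) l → row-mono px px′ (trans rx (sym rx′)) (subst₂ _<_ (sym cx₁) (sym cx₁′) l) }) k V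
      λ b l _ → let (x , lx , px , rx , cx₁) = h b l in x , (px , rx , cx₁) , lx , is-t rx)

  rank-≤ : ∀ {u} → Pres u → cnt (λ x → is (R x) (R u)) u ≤ C u
  rank-≤ {u} pu = subst (cnt (λ x → is (R x) (R u)) u ≤_) (cnt-all (C u))
    (cnt-inj {λ x → is (R x) (R u)} {λ _ → true} (λ x b → Pres x × R x ≡ R u × C x ≡ b)
      (λ { (px , rx , refl) (px′ , rx′ , refl) l → row-anti px px′ (trans rx (sym rx′)) l }) u (C u)
      λ x l q → let rx = is-T {R x} q ; px = pr x l rx in C x , (px , rx , refl) , row-anti px pu rx l , refl)
    where
    pr : ∀ x → x < u → R x ≡ R u → Pres x
    pr x l rx with x ≤? ê x
    ... | yes p = p
    ... | no np = ⊥-elim (<⇒≱ (<-trans (≰⇒> np) l) (≤ê pu (trans (sym rx) (tailR np))))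

  -- The rows of a completed tableau have no gaps. The columns are therefore determined by the word
  -- of rows, and uniqueness can be proved for the latter alone.
  rank : ∀ {u} → Pres u → cnt (λ x → is (R x) (R u)) u ≡ C u
  rank {u} pu = ≤-antisym (rank-≤ pu) (rank-≥ (C u) λ b l →
    let (x , px , rx , cx₁) = at {R u} {b} (u , R≤ u , ≤-trans (<⇒≤ l) (C≤ u)) in x , row-mono px pu rx (<-≤-trans (s≤s (≤-reflexive cx₁)) l) , px , rx , cx₁)

  rank-tail : ∀ {u} → ¬ Pres u → cy u < cnt (λ x → is (R x) (cx u)) u
  rank-tail {u} np = rank-≥ (suc (cy u)) λ b l →
    let (x , px , rx , cx₁) = at {cx u} {b} (u , ≤-refl , s≤s⁻¹ l) in x , ≤-<-trans (≤ê px rx) (≰⇒> np) , px , rx , cx₁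

module RowCount {ν cx cy} (P : Per ν cx) (D : Diag ν cx cy) (S : State cx cy ∅₂) where
  open Per P
  open State S
  open Rank (ν , D) S

  e : ℕ → ℕ
  e a = ê (w a)

  q : ℕ → ℕ
  q a = e a / n

  e-ρ : ∀ {a} → a ≤ ν → cx (e a) ≡ a
  e-ρ {a} l = trans (ê-x (w a)) (ρw l)

  e≡ : ∀ {a} → a ≤ ν → e a ≡ val a (q a)
  e≡ {a} l = trans (val-u (e a)) (cong (λ z → val z (q a)) (e-ρ l))

  ê≡e : ∀ u → ê u ≡ e (cx u)
  ê≡e u = ê-cx (sym (ρw (ρ≤ u)))

  cnt-val : ∀ {a} q → a ≤ ν → cnt (λ u → is (cx u) a) (val a q) ≡ q
  cnt-val {a} zero l = trans (cong (cnt (λ u → is (cx u) a)) (+-identityʳ (w a)))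
                         (cnt-none _ (w a) λ u lu → is-f λ p → <⇒≢ lu (ρ-inj₀ (<-trans lu (w< l)) (w< l) (trans p (sym (ρw l)))))
  cnt-val {a} (suc q) l = begin
    cnt p (w a + (n + q * n)) ≡⟨ cong (cnt p) (trans (cong (w a +_) (+-comm n (q * n))) (sym (+-assoc (w a) (q * n) n))) ⟩
    cnt p (val a q + n) ≡⟨ cnt-+ p (val a q) n ⟩
    cnt p (val a q) + cnt (λ x → p (val a q + x)) n ≡⟨ cong₂ _+_ (cnt-val q l) (cnt-one _ n 0 (s≤s z≤n) (is-t (trans (cong cx (+-identityʳ _)) ρv)) one) ⟩
    q + 1 ≡⟨ +-comm q 1 ⟩
    suc q ∎
    where
    open ≡-Reasoning
    p = λ u → is (cx u) a
    ρv = ρ-val q l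
    one : ∀ u → u < n → u ≢ 0 → p (val a q + u) ≡ false
    one u lu ne = is-f λ h → ρ-inj (m<m+n (val a q) (n≢0⇒n>0 ne)) (+-monoʳ-< (val a q) lu) (trans ρv (sym h))

  -- Cut at `e a`, the entry of the diagonal box of row `a`. Before it, the row has received the
  -- `cy (w a)` entries to its left and the class has had `q a` members; from it on, row and class
  -- coincide, because every later entry of the row is still to enter.
  row-count : ∀ {a V} → a ≤ ν → e a ≤ V → cnt (λ u → is (R u) a) V + q a ≡ cnt (λ u → is (cx u) a) V + cy (w a)
  row-count {a} {V} l eV = begin
    cnt (λ u → is (R u) a) V + q a ≡⟨ cong (_+ q a) (split R) ⟩
    cnt (λ u → is (R u) a) (e a) + cnt (λ x → is (R (e a + x)) a) d + q a ≡⟨ cong₂ (λ x y → x + y + q a) hd (cnt-cong d tl) ⟩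
    cy (w a) + t + q a ≡⟨ lem (cy (w a)) t (q a) ⟩
    q a + t + cy (w a) ≡⟨ cong (λ z → z + t + cy (w a)) (sym (trans (cong (cnt (λ u → is (cx u) a)) (e≡ l)) (cnt-val (q a) l))) ⟩
    cnt (λ u → is (cx u) a) (e a) + t + cy (w a) ≡⟨ cong (_+ cy (w a)) (sym (split cx)) ⟩
    cnt (λ u → is (cx u) a) V + cy (w a) ∎
    where
    open ≡-Reasoning
    d = V ∸ e a
    t = cnt (λ x → is (cx (e a + x)) a) d
    split : ∀ (y : ℕ → ℕ) → cnt (λ u → is (y u) a) V ≡ cnt (λ u → is (y u) a) (e a) + cnt (λ x → is (y (e a + x)) a) d
    split y = trans (cong (cnt (λ u → is (y u) a)) (sym (m+[n∸m]≡n eV))) (cnt-+ (λ u → is (y u) a) (e a) d)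
    dg : R (e a) ≡ a × C (e a) ≡ cy (w a)
    dg = trans (proj₁ (diag! (w a))) (ρw l) , proj₂ (diag! (w a))
    hd : cnt (λ u → is (R u) a) (e a) ≡ cy (w a)
    hd = trans (cong (λ z → cnt (λ u → is (R u) z) (e a)) (sym (proj₁ dg))) (trans (rank (ê-pres (w a))) (proj₂ dg))
    tl : ∀ x → x < d → is (R (e a + x)) a ≡ is (cx (e a + x)) a
    tl zero _ = trans (is-t (trans (cong R (+-identityʳ (e a))) (proj₁ dg))) (sym (is-t (trans (cong cx (+-identityʳ (e a))) (e-ρ l))))
    tl x@(suc _) _ with e a + x ≤? ê (e a + x)
    ... | no np = cong (λ z → is z a) (tailR np)
    ... | yes p = trans (is-f λ r → <⇒≱ (m<m+n (e a) (s≤s z≤n)) (≤ê p (trans r (sym (ρw l)))))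
                    (sym (is-f λ r → <⇒≱ (m<m+n (e a) (s≤s z≤n)) (≤-trans p (≤-reflexive (ê-cx (trans r (sym (ρw l))))))))
    lem : ∀ a b c → a + b + c ≡ c + b + a
    lem = solve 3 (λ a b c → a :+ b :+ c := c :+ b :+ a) refl
      where open +-*-Solver

  row-total : ∀ {a} N → a ≤ ν → q a < N → cnt (λ u → is (R u) a) (N * n) + q a ≡ N + cy (w a)
  row-total {a} N l qN = trans (row-count l (<⇒≤ (subst (_< N * n) (sym (e≡ l)) (val<N*n l qN)))) (cong (_+ cy (w a))
    (trans (cnt-cong (N * n) λ u _ → sym (∧-identityʳ (is (cx u) a))) (trans (cnt-class P a (λ _ → true) N l) (cnt-all N))))

sumN-≥ : ∀ f {i K} → i < K → f i ≤ sumN f K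
sumN-≥ f {i} {suc K} l with m≤n⇒m<n∨m≡n (s≤s⁻¹ l)
... | inj₁ l′ = ≤-trans (sumN-≥ f l′) (m≤n+m _ (f K))
... | inj₂ refl = m≤m+n (f i) _

sumN-compl : ∀ f ν r k → r + k ≡ suc ν → sumN f r + sumN (λ i → f (ν ∸ i)) k ≡ sumN f (suc ν)
sumN-compl f ν r zero eq = trans (+-identityʳ _) (cong (sumN f) (trans (sym (+-identityʳ r)) eq))
sumN-compl f ν r (suc k) eq = begin
  sumN f r + (f (ν ∸ k) + sumN (λ i → f (ν ∸ i)) k) ≡⟨ cong (λ z → sumN f r + (f z + sumN (λ i → f (ν ∸ i)) k)) νk ⟩
  sumN f r + (f r + sumN (λ i → f (ν ∸ i)) k) ≡⟨ sym (+-assoc (sumN f r) (f r) _) ⟩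
  sumN f r + f r + sumN (λ i → f (ν ∸ i)) k ≡⟨ cong (_+ sumN (λ i → f (ν ∸ i)) k) (+-comm (sumN f r) (f r)) ⟩
  sumN f (suc r) + sumN (λ i → f (ν ∸ i)) k ≡⟨ sumN-compl f ν (suc r) k (trans (sym (+-suc r k)) eq) ⟩
  sumN f (suc ν) ∎
  where
  open ≡-Reasoning
  νk : ν ∸ k ≡ r
  νk = trans (cong (_∸ k) (suc-injective (trans (sym eq) (+-suc r k)))) (m+n∸n≡m r k)

module StairCount {ν cx cy} (St : Stair ν cx cy) (S : State cx cy ∅₂) where
  open Stair St
  open Per P
  open State S
  private
    D = stairD St
    St′ = trStair St
    module X = RowCount P D S
    module Y = RowCount (Stair.P St′) (trD D) (trS S)
  open X public using (e; q; e≡; e-ρ; ê≡e)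

  private
    -- The number of periods in the window only has to exceed every `q a` and to bound both offset
    -- functions, which are at most `ν`.
    N = suc (sumN q n) + ν
    W = N * n

    q<N : ∀ {a} → a ≤ ν → q a < N
    q<N l = s≤s (≤-trans (sumN-≥ q (s≤s l)) (m≤m+n _ ν))

    -- A bar stands for the sum over the last `r` classes instead of the first `r`.
    A = sumN asc
    Ā = sumN (λ i → asc (ν ∸ i))
    G = sumN id
    Ḡ = sumN (λ i → ν ∸ i)
    Q = sumN q
    Q̄ = sumN (λ i → q (ν ∸ i))

    X Y : ℕ → ℕ
    X r = cnt (λ u → lt (R u) r) W
    Y r = cnt (λ u → lt (C u) r) W

    bounded : ∀ {r i} → r ≤ n → i < r → i ≤ ν
    bounded l l′ = s≤s⁻¹ (<-≤-trans l′ l)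

    X-sum : ∀ r → r ≤ n → X r + Q r ≡ r * N + Ḡ r
    X-sum r l = trans (cong (_+ Q r) (cnt-below R W r)) (trans (sym (sumN-+ _ q r)) (trans (sumN-cong r λ a la →
        trans (X.row-total N (bounded l la) (q<N (bounded l la))) (cong (N +_) (trans (cy≡ (w a)) (cong (ν ∸_) (ρw (bounded l la))))))
        (trans (sumN-+ (λ _ → N) (λ a → ν ∸ a) r) (cong (_+ Ḡ r) (sumN-const N r)))))

    Y-sum : ∀ r → r ≤ n → Y r + Q̄ r ≡ r * N + Ḡ r
    Y-sum r l = trans (cong (_+ Q̄ r) (cnt-below C W r)) (trans (sym (sumN-+ _ (λ i → q (ν ∸ i)) r)) (trans (sumN-cong r λ a la →
        trans (Y.row-total N (bounded l la) (q<N (m∸n≤m ν a))) (cong (N +_) (ρw (m∸n≤m ν a))))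
        (trans (sumN-+ (λ _ → N) (λ a → ν ∸ a) r) (cong (_+ Ḡ r) (sumN-const N r)))))

  private
    -- For classes up to `ν` this is `ν` minus the number of descents of `w` before `x`. It drops at
    -- descents, as the levels for rows require; for columns `asc`, which grows at ascents, plays
    -- this part.
    oR : ℕ → ℕ
    oR x = asc x + (ν ∸ x)

    shift : ∀ {x x′} → x ≤ ν → x′ ≤ x → (x ∸ x′) + asc x′ + (ν ∸ x) ≡ oR x′
    shift {x} {x′} l l′ = trans (cong (_+ (ν ∸ x)) (+-comm (x ∸ x′) (asc x′))) (trans (+-assoc (asc x′) _ _) (cong (asc x′ +_)
      (+-cancelʳ-≡ x′ _ _ (trans (trans (+-assoc (x ∸ x′) (ν ∸ x) x′) (trans (cong (x ∸ x′ +_) (+-comm (ν ∸ x) x′)) (trans (sym (+-assoc (x ∸ x′) x′ _)) (trans (cong (_+ (ν ∸ x)) (m∸n+n≡m l′)) (m+[n∸m]≡n l))))) (sym (m∸n+n≡m (≤-trans l′ l)))))))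

    oR-mono : ∀ {x x′} → x ≤ ν → x′ ≤ ν → x′ ≤ x → oR x ≤ oR x′
    oR-mono {x} l _ p = ≤-trans (+-monoˡ-≤ (ν ∸ x) (asc-≤′ p)) (≤-reflexive (shift l p))

    oR-strict : ∀ {x x′} → x ≤ ν → x′ ≤ ν → x′ ≤ x → w x < w x′ → oR x < oR x′
    oR-strict {x} {x′} l _ p ww = ≤-trans (+-monoˡ-≤ (ν ∸ x) (subst (λ z → asc z < (x ∸ x′) + asc x′) (m∸n+n≡m p)
      (asc-desc x′ (x ∸ x′) (subst (λ z → w z < w x′) (sym (m∸n+n≡m p)) ww)))) (≤-reflexive (shift l p))

    oR≤N : ∀ {x} → x ≤ ν → oR x ≤ N
    oR≤N {x} l = ≤-trans (+-monoˡ-≤ (ν ∸ x) (asc≤ x)) (≤-trans (≤-reflexive (m+[n∸m]≡n l)) (m≤n+m ν _))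

    ∸-rev : ∀ {x x′} → x ≤ ν → ν ∸ x′ ≤ ν ∸ x → x ≤ x′
    ∸-rev l p = ≮⇒≥ λ x′<x → <⇒≱ (∸-monoʳ-< x′<x l) p

    ∸≤ν : ∀ {x} → x ≤ ν → ν ∸ x ≤ ν
    ∸≤ν {x} _ = m∸n≤m ν x

    oC-mono : ∀ {x x′} → x ≤ ν → x′ ≤ ν → ν ∸ x′ ≤ ν ∸ x → asc x ≤ asc x′
    oC-mono {x} {x′} l _ p = asc-mono′ {x} {x′} (∸-rev l p)

    oC-strict : ∀ {x x′} → x ≤ ν → x′ ≤ ν → ν ∸ x′ ≤ ν ∸ x → w x < w x′ → asc x < asc x′
    oC-strict {x} {x′} l _ p ww = subst (λ z → asc x < asc z) (m∸n+n≡m (∸-rev {x} {x′} l p)) (asc-asc x (x′ ∸ x) (subst (λ z → w x < w z) (sym (m∸n+n≡m (∸-rev {x} {x′} l p))) ww))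

    oC≤N : ∀ {x} → x ≤ ν → asc x ≤ N
    oC≤N {x} l = ≤-trans (asc≤ x) (≤-trans l (m≤n+m ν _))

    module RB = FCert P id id (λ _ → refl) oR oR-mono oR-strict N oR≤N
    module CB = FCert P (ν ∸_) ∸≤ν m∸[m∸n]≡n asc oC-mono oC-strict N oC≤N

    row-bound : ∀ r → r ≤ n → X r + (Ā r + G r) ≤ r * N + (A r + Ḡ r)
    row-bound r l with ≼-Has R≼ r 0 W (X r) (rows-Fam r R W)
    ... | m , le , F = subst₂ (λ x y → X r + x ≤ r * N + y)
            (trans (sumN-+ (λ i → asc (ν ∸ i)) (λ i → ν ∸ (ν ∸ i)) r) (cong (Ā r +_) (sumN-cong r λ i li → m∸[m∸n]≡n (bounded l li))))
            (sumN-+ asc (λ i → ν ∸ i) r)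
            (≤-trans (+-monoˡ-≤ _ le) (RB.bound l F))

    col-bound : ∀ r → r ≤ n → Y r + A r ≤ r * N + Ā r
    col-bound r l with ≼-Has C≼ r 0 W (Y r) (rows-Fam r C W)
    ... | m , le , F = subst (λ x → Y r + x ≤ r * N + Ā r) (sumN-cong r λ i li → cong asc (m∸[m∸n]≡n (bounded l li)))
            (≤-trans (+-monoˡ-≤ _ le) (CB.bound l (Fam-cong (λ u _ → cy≡ u) F)))

    open +-*-Solver

    ineq₁ : ∀ r → r ≤ n → Ā r + G r ≤ A r + Q r
    ineq₁ r l = +-cancelˡ-≤ (X r + Q r) _ _ (begin
      X r + Q r + (Ā r + G r) ≡⟨ solve 3 (λ x q a → x :+ q :+ a := x :+ a :+ q) refl (X r) (Q r) (Ā r + G r) ⟩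
      X r + (Ā r + G r) + Q r ≤⟨ +-monoˡ-≤ (Q r) (row-bound r l) ⟩
      r * N + (A r + Ḡ r) + Q r ≡⟨ solve 4 (λ x a g q → x :+ (a :+ g) :+ q := x :+ g :+ (a :+ q)) refl (r * N) (A r) (Ḡ r) (Q r) ⟩
      r * N + Ḡ r + (A r + Q r) ≡⟨ cong (_+ (A r + Q r)) (sym (X-sum r l)) ⟩
      X r + Q r + (A r + Q r) ∎)
      where open ≤-Reasoning

    ineq₂ : ∀ r → r ≤ n → A r + Ḡ r ≤ Ā r + Q̄ r
    ineq₂ r l = +-cancelˡ-≤ (Y r + Q̄ r) _ _ (begin
      Y r + Q̄ r + (A r + Ḡ r) ≡⟨ solve 4 (λ x q a g → x :+ q :+ (a :+ g) := x :+ a :+ (q :+ g)) refl (Y r) (Q̄ r) (A r) (Ḡ r) ⟩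
      Y r + A r + (Q̄ r + Ḡ r) ≤⟨ +-monoˡ-≤ (Q̄ r + Ḡ r) (col-bound r l) ⟩
      r * N + Ā r + (Q̄ r + Ḡ r) ≡⟨ solve 4 (λ x a g q → x :+ a :+ (q :+ g) := x :+ g :+ (a :+ q)) refl (r * N) (Ā r) (Ḡ r) (Q̄ r) ⟩
      r * N + Ḡ r + (Ā r + Q̄ r) ≡⟨ cong (_+ (Ā r + Q̄ r)) (sym (Y-sum r l)) ⟩
      Y r + Q̄ r + (Ā r + Q̄ r) ∎)
      where open ≤-Reasoning

    Qn : Q n ≡ Ḡ n
    Qn = +-cancelˡ-≡ (n * N) _ _ (trans (cong (_+ Q n) (sym Xn)) (X-sum n ≤-refl))
      where
      Xn : X n ≡ n * N
      Xn = trans (cnt-cong W λ u _ → lt-t (s≤s (≤-trans (R≤ u) (ρ≤ u)))) (trans (cnt-all W) (*-comm N n))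

    -- `ineq₁` bounds the first `r` of the numbers `q a` from below, `ineq₂` the last `n ∸ r`. The
    -- two bounds add up to the total given by `Qn`, so neither can be strict.
    Q+A : ∀ r → r ≤ n → A r + Q r ≡ Ā r + G r
    Q+A r l = ≤-antisym (+-cancelʳ-≤ (A k + Ḡ k + Ā k + Q̄ k) _ _ (begin
        A r + Q r + (A k + Ḡ k + Ā k + Q̄ k) ≡⟨ solve 6 (λ a q a′ g b q′ → a :+ q :+ (a′ :+ g :+ b :+ q′) := (a :+ b) :+ (q :+ q′) :+ (a′ :+ g)) refl (A r) (Q r) (A k) (Ḡ k) (Ā k) (Q̄ k) ⟩
        (A r + Ā k) + (Q r + Q̄ k) + (A k + Ḡ k) ≤⟨ +-mono-≤ (≤-reflexive (cong₂ _+_ AA QQ)) (ineq₂ k (≤-trans (m≤n+m k r) (≤-reflexive rk))) ⟩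
        (Ā r + A k) + (G r + Ḡ k) + (Ā k + Q̄ k) ≡⟨ solve 6 (λ a q a′ g b q′ → (a :+ a′) :+ (q :+ g) :+ (b :+ q′) := a :+ q :+ (a′ :+ g :+ b :+ q′)) refl (Ā r) (G r) (A k) (Ḡ k) (Ā k) (Q̄ k) ⟩
        Ā r + G r + (A k + Ḡ k + Ā k + Q̄ k) ∎)) (ineq₁ r l)
      where
      open ≤-Reasoning
      k = n ∸ r
      rk : r + k ≡ n
      rk = m+[n∸m]≡n l
      kr : k + r ≡ n
      kr = m∸n+n≡m l
      AA : A r + Ā k ≡ Ā r + A k
      AA = trans (sumN-compl asc ν r k rk) (trans (sym (sumN-compl asc ν k r kr)) (+-comm (A k) (Ā r)))
      QQ : Q r + Q̄ k ≡ G r + Ḡ k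
      QQ = trans (sumN-compl q ν r k rk) (trans Qn (trans (sumN-compl id ν 0 n refl) (sym (sumN-compl id ν r k rk))))

  q-formula : ∀ {i} → i ≤ ν → q i + asc i ≡ i + asc (ν ∸ i)
  q-formula {i} l = +-cancelʳ-≡ (A i + Q i) _ _ (begin
    q i + asc i + (A i + Q i) ≡⟨ solve 4 (λ q a A Q → q :+ a :+ (A :+ Q) := a :+ A :+ (q :+ Q)) refl (q i) (asc i) (A i) (Q i) ⟩
    A (suc i) + Q (suc i) ≡⟨ Q+A (suc i) (s≤s l) ⟩
    Ā (suc i) + G (suc i) ≡⟨ solve 4 (λ q a A Q → a :+ A :+ (q :+ Q) := q :+ a :+ (A :+ Q)) refl i (asc (ν ∸ i)) (Ā i) (G i) ⟩
    i + asc (ν ∸ i) + (Ā i + G i) ≡⟨ cong (i + asc (ν ∸ i) +_) (sym (Q+A i (≤-trans l (n≤1+n ν)))) ⟩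
    i + asc (ν ∸ i) + (A i + Q i) ∎)
    where open ≡-Reasoning

  q-step : ∀ {i} → suc i ≤ ν → q (suc i) + asc (suc i) ≤ suc (q i + asc i)
  q-step {i} l = begin
    q (suc i) + asc (suc i) ≡⟨ q-formula l ⟩
    suc (i + asc (ν ∸ suc i)) ≤⟨ s≤s (+-monoʳ-≤ i (asc-mono′ (∸-monoʳ-≤ ν (n≤1+n i)))) ⟩
    suc (i + asc (ν ∸ i)) ≡⟨ cong suc (sym (q-formula (<⇒≤ l))) ⟩
    suc (q i + asc i) ∎
    where open ≤-Reasoning

  -- By `q-step`, `q` does not grow at an ascent of `w`, and at a descent it grows by at most one
  -- while the remainder gets smaller. Either way the step is shorter than a period.
  e-step : ∀ {i} → suc i ≤ ν → e (suc i) < e i + n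
  e-step {i} l = subst₂ _<_ (sym (e≡ l)) (cong (_+ n) (sym (e≡ (<⇒≤ l)))) go
    where
    go : val (suc i) (q (suc i)) < val i (q i) + n
    go with <-cmp (w i) (w (suc i))
    ... | tri≈ _ p _ = ⊥-elim (1+n≢n (sym (w-inj (<⇒≤ l) l p)))
    ... | tri< p _ _ = ≤-trans (+-mono-≤ (w< l) (*-monoˡ-≤ n qq)) (≤-trans (≤-reflexive (+-comm n (q i * n))) (+-monoˡ-≤ n (m≤n+m (q i * n) (w i))))
      where
      qq : q (suc i) ≤ q i
      qq = +-cancelʳ-≤ (suc (asc i)) _ _ (≤-trans (subst (λ z → q (suc i) + z ≤ suc (q i + asc i)) (cong (λ z → b2n z + asc i) (lt-t p)) (q-step l)) (≤-reflexive (sym (+-suc (q i) (asc i)))))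
    ... | tri> _ _ p = ≤-trans (+-mono-≤ p (*-monoˡ-≤ n qq)) (≤-reflexive (trans (cong (w i +_) (+-comm n (q i * n))) (sym (+-assoc (w i) (q i * n) n))))
      where
      qq : q (suc i) ≤ suc (q i)
      qq = +-cancelʳ-≤ (asc i) _ _ (subst (λ z → q (suc i) + z ≤ suc (q i + asc i)) (cong (λ z → b2n z + asc i) (lt-f (<⇒≤ p))) (q-step l))

  ê-step : ∀ {u v} → cx v ≡ suc (cx u) → ê v < ê u + n
  ê-step {u} {v} eq = subst₂ (λ x y → x < y + n) (trans (cong e (sym eq)) (sym (ê≡e v))) (sym (ê≡e u)) (e-step (≤-trans (≤-reflexive (sym eq)) (ρ≤ v)))

  e<2νn : ∀ {i} → i ≤ ν → e i < suc (ν + ν) * n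
  e<2νn {i} l = subst (_< suc (ν + ν) * n) (sym (e≡ l)) (val<N*n l (s≤s (≤-trans (m≤m+n (q i) (asc i)) (≤-trans (≤-reflexive (q-formula l)) (+-mono-≤ l (≤-trans (asc≤ _) (m∸n≤m ν i)))))))

-- Promotion

-- The Yamanouchi condition on all prefixes, which holds for the words of rows of standard tableaux
-- of straight shape.
Lattice : (ℕ → ℕ) → Set
Lattice y = ∀ a V → cnt (λ u → is (y u) (suc a)) V ≤ cnt (λ u → is (y u) a) V

cnt-nth : ∀ p c V → c < cnt p V → ∃ λ u → u < V × p u ≡ true × cnt p u ≡ c
cnt-nth p c (suc V) l with p V in eq
... | false = let (u , lu , r) = cnt-nth p c V l in u , m<n⇒m<1+n lu , r
... | true with m≤n⇒m<n∨m≡n (s≤s⁻¹ l)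
... | inj₁ l′ = let (u , lu , r) = cnt-nth p c V l′ in u , m<n⇒m<1+n lu , r
... | inj₂ e = V , ≤-refl , eq , sym e

module _ {y : ℕ → ℕ} (L : Lattice y) where

  private
    row : ℕ → ℕ → ℕ
    row a = cnt (λ u → is (y u) a)

    κ : ℕ → ℕ
    κ u = row (y u) u

  lattice-≤ : ∀ {a b} V → b ≤ a → row a V ≤ row b V
  lattice-≤ {a} {b} V l = subst (λ z → row z V ≤ row b V) (m∸n+n≡m l) (go (a ∸ b))
    where
    go : ∀ d → row (d + b) V ≤ row b V
    go zero = ≤-refl
    go (suc d) = ≤-trans (L (d + b) V) (go d)

  private
    take-row : ∀ u → row (y u) (suc u) ≡ suc (κ u)
    take-row u = cnt-take (λ x → is (y x) (y u)) u (is-t {y u} refl)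

  lattice-inc : ∀ {u v} → u < v → y v ≤ y u → κ u < κ v
  lattice-inc {u} {v} l q = ≤-trans (≤-reflexive (sym (take-row u))) (≤-trans (cnt-mono-V _ l) (lattice-≤ v q))

  private
    κ-mono : ∀ {u v} → κ u ≡ κ v → y u < y v → u < v
    κ-mono {u} {v} e l = ≰⇒> λ le → case m≤n⇒m<n∨m≡n le of λ
      { (inj₁ l′) → <⇒≢ (lattice-inc l′ (<⇒≤ l)) (sym e) ; (inj₂ refl) → <-irrefl refl l }

  -- The levels of the certificate are the columns: `κ u` counts the earlier letters equal to `y u`.
  -- By the lattice condition a column has no gaps upwards, so it stays within the first `k` rows or
  -- meets each of them.
  lattice-max : ∀ {k V m} → Has k y V m → m ≤ cnt (λ u → lt (y u) k) V
  lattice-max {k} {V} (m , le , F) = ≤-trans le (Certificate.certify y κ (λ l _ → lattice-inc l) p cap F)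
    where
    p : ℕ → Bool
    p u = lt (y u) k
    cap : ∀ c → (∀ u → u < V → κ u ≡ c → p u ≡ true) ⊎ k ≤ cnt (λ u → is (κ u) c ∧ p u) V
    cap c with allOr (λ u → not (is (κ u) c) ∨ p u) V
    ... | inj₁ h = inj₁ λ u l q → subst (λ z → not z ∨ p u ≡ true) (is-t q) (h u l)
    ... | inj₂ (u , l , q) with κ u ≟ c
    ... | no nc = case trans (sym q) (cong (λ z → not z ∨ p u) (is-f nc)) of λ ()
    ... | yes refl = inj₂ (subst (_≤ cnt (λ x → is (κ x) (κ u) ∧ p x) V) (cnt-all k)
            (cnt-inj {λ _ → true} {λ x → is (κ x) (κ u) ∧ p x} (λ b x → y x ≡ b × κ x ≡ κ u)
              (λ { (refl , e) (refl , e′) l → κ-mono (trans e (sym e′)) l }) k V el))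
      where
      k≤ : k ≤ y u
      k≤ = ≮⇒≥ λ l → case trans (sym q) (trans (cong (λ z → not z ∨ p u) (is-t {κ u} refl)) (lt-t l)) of λ ()
      el : ∀ b → b < k → true ≡ true → ∃ λ x → (y x ≡ b × κ x ≡ κ u) × x < V × is (κ x) (κ u) ∧ p x ≡ true
      el b lb _ with cnt-nth (λ x → is (y x) b) (κ u) V (≤-trans (≤-reflexive (sym (take-row u))) (≤-trans (cnt-mono-V _ l) (lattice-≤ V (≤-trans (<⇒≤ lb) k≤))))
      ... | x , lx , yx , cx with is-T {y x} yx
      ... | refl = x , (refl , cx) , lx , ∧-I (is-t cx) (lt-t lb)

-- Each entry of row r + 1 is sent to the one above it; the entries that have
-- not entered yet continue the two rows periodically.
module Match {ν cx cy I H} (St : Stair ν cx cy) (c : Conf cx cy I H) where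
  open Stair St
  open Per P
  open Diag (stairD St) using (xy)
  open Conf c

  module _ (bal : ∀ {u v} → cx v ≡ suc (cx u) → ê u < ê v + n)
           (dg : ∀ u → R (ê u) ≡ cx u × C (ê u) ≡ cy u)
           (r : ℕ) where

    z : ℕ
    z = w r

    Φ : ℕ → ℕ → Set
    Φ u u₁ = R u ≡ suc r × R u₁ ≡ r ×
      -- The first entry of row `r + 1` still to enter, `ê u + n`, goes to `ê z`, the last entered
      -- entry of row `r`, below whose box the domain ends. Later entries follow at multiples of the
      -- period.
      ((Pres u × Pres u₁ × C u₁ ≡ C u) ⊎ (¬ Pres u × ê z ≤ u₁ × u₁ + (ê u + n) ≡ u + ê z))

    private
      r≤ : ∀ {u} → R u ≡ suc r → r ≤ ν
      r≤ {u} q = ≤-trans (n≤1+n r) (≤-trans (≤-reflexive (sym q)) (≤-trans (R≤ u) (ρ≤ u)))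

      strict : ∀ {u v} → Pres u → Pres v → R u ≡ R v → C u < C v → u < v
      strict pu pv q l = ≤∧≢⇒< (ord pu pv (≤-reflexive q) (<⇒≤ l)) λ { refl → <-irrefl refl l }

    mono : ∀ {u u₁ v v₁} → Φ u u₁ → Φ v v₁ → u < v → u₁ < v₁
    mono (ru , ru₁ , inj₁ (pu , pu₁ , cu)) (rv , rv₁ , inj₁ (pv , pv₁ , cv)) l =
      strict pu₁ pv₁ (trans ru₁ (sym rv₁)) (subst₂ _<_ (sym cu) (sym cv) (≰⇒> λ le → <⇒≱ l (ord pv pu (≤-reflexive (trans rv (sym ru))) le)))
    mono {u} {u₁} (ru , ru₁ , inj₁ (pu , pu₁ , cu)) (rv , rv₁ , inj₂ (_ , le , _)) l =
      <-≤-trans (strict pu₁ (ê-pres z) (trans ru₁ (sym (trans (proj₁ (dg z)) (ρw (r≤ ru)))))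
        (≤-<-trans (≤-trans (≤-reflexive cu) (C≤ u)) (<-≤-trans (xy {z} {u} (≤-trans (s≤s (≤-reflexive (ρw (r≤ ru)))) (≤-trans (≤-reflexive (sym ru)) (R≤ u)))) (≤-reflexive (sym (proj₂ (dg z))))))) le
    mono {u} {v = v} (ru , _ , inj₂ (nu , _)) (rv , _ , inj₁ (pv , _)) l = ⊥-elim (<⇒≱ (<-trans (≰⇒> nu) l)
      (ord pv (ê-pres u) (≤-reflexive (trans rv (trans (sym ru) (trans (tailR nu) (sym (proj₁ (dg u)))))))
        (≤-trans (C≤ v) (≤-trans (≮⇒≥ λ q → <⇒≱ (Diag.yx (stairD St) {u} {v} q) (≤-trans (≤-reflexive (trans (sym (tailR nu)) (trans ru (sym rv)))) (R≤ v))) (≤-reflexive (sym (proj₂ (dg u))))))))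
    mono {u} {u₁} {v} {v₁} (ru , _ , inj₂ (nu , _ , eu)) (rv , _ , inj₂ (nv , _ , ev)) l =
      +-cancelʳ-< (ê u + n) u₁ v₁ (subst₂ _<_ (sym eu) (sym (trans (cong (λ q → v₁ + (q + n)) (ê-cx (trans (sym (tailR nu)) (trans ru (trans (sym rv) (tailR nv)))))) ev)) (+-monoˡ-< (ê z) l))

    above : ∀ {u} → R u ≡ suc r → (Pres u → ∃ λ u₁ → Pres u₁ × R u₁ ≡ r × C u₁ ≡ C u) →
            ∃ λ u₁ → Φ u u₁ × u₁ < u × R u₁ ≡ r
    above {u} ru up with u ≤? ê u
    ... | yes pu = let (u₁ , p₁ , r₁ , c₁) = up pu in u₁ , (ru , r₁ , inj₁ (pu , p₁ , c₁)) ,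
            ≤∧≢⇒< (ord p₁ pu (≤-trans (≤-reflexive r₁) (≤-trans (n≤1+n r) (≤-reflexive (sym ru)))) (≤-reflexive c₁)) (λ q → 1+n≢n (trans (sym ru) (trans (sym (cong R q)) r₁))) , r₁
    ... | no nu = u₁ , (ru , r₁ , inj₂ (nu , m≤m+n (ê z) _ , eq)) , u₁<u , r₁
      where
      cu : cx u ≡ suc r
      cu = trans (sym (tailR nu)) ru
      cz : cx z ≡ r
      cz = ρw (r≤ ru)
      k = u / n ∸ suc (ê u / n)
      cxê : cx (ê u) ≡ cx u
      cxê = ê-x u
      ue : u ≡ ê u + suc k * n
      ue = begin
        u ≡⟨ val-u u ⟩
        w (cx u) + u / n * n ≡⟨ cong (λ t → w (cx u) + t * n) (sym (m+[n∸m]≡n {suc (ê u / n)} lt/)) ⟩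
        w (cx u) + (suc (ê u / n) + k) * n ≡⟨ lem (w (cx u)) (ê u / n) k n ⟩
        w (cx u) + ê u / n * n + suc k * n ≡⟨ cong (λ t → w t + ê u / n * n + suc k * n) (sym cxê) ⟩
        val (cx (ê u)) (ê u / n) + suc k * n ≡⟨ cong (_+ suc k * n) (sym (val-u (ê u))) ⟩
        ê u + suc k * n ∎
        where
        open ≡-Reasoning
        open +-*-Solver
        lem : ∀ a b k n → a + (suc b + k) * n ≡ a + b * n + suc k * n
        lem = solve 4 (λ a b k n → a :+ (con 1 :+ b :+ k) :* n := a :+ b :* n :+ (con 1 :+ k) :* n) refl
        lt/ : ê u / n < u / n
        lt/ = ≰⇒> λ le → nu (subst₂ _≤_ (sym (val-u u)) (trans (cong (λ t → val t (ê u / n)) (sym cxê)) (sym (val-u (ê u)))) (+-monoʳ-≤ (w (cx u)) (*-monoˡ-≤ n le)))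
      u₁ = ê z + k * n
      eq : u₁ + (ê u + n) ≡ u + ê z
      eq = trans (lem (ê z) (k * n) (ê u) n) (cong (_+ ê z) (sym ue))
        where
        open +-*-Solver
        lem : ∀ a b c d → a + b + (c + d) ≡ c + (d + b) + a
        lem = solve 4 (λ a b c d → a :+ b :+ (c :+ d) := c :+ (d :+ b) :+ a) refl
      u₁<u : u₁ < u
      u₁<u = subst (u₁ <_) (trans (+-assoc (ê u) n (k * n)) (sym ue)) (+-monoˡ-< (k * n) (bal {z} {u} (trans cu (cong suc (sym cz)))))
      cu₁ : cx u₁ ≡ r
      cu₁ = trans (ρ-per* (ê z) k) (trans (ê-x z) cz)
      r₁ : R u₁ ≡ r
      r₁ with u₁ ≤? ê u₁
      ... | no np = trans (tailR np) cu₁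
      ... | yes p = trans (cong R (trans (≤-antisym (≤-trans p (≤-reflexive êq)) (m≤m+n (ê z) _)) refl)) (trans (proj₁ (dg z)) cz)
        where
        êq : ê u₁ ≡ ê z
        êq = ê-cx (trans cu₁ (sym cz))

record Balanced (ν : ℕ) (cx cy ê : ℕ → ℕ) : Set where
  field
    bx : ∀ {u v} → cx v ≡ suc (cx u) → ê u < ê v + suc ν
    by : ∀ {u v} → cy v ≡ suc (cy u) → ê u < ê v + suc ν

module _ {ν cx cy} (St : Stair ν cx cy) where
  open Stair St

  step-swap : ∀ {u v} → cx v ≡ suc (cx u) → cy u ≡ suc (cy v)
  step-swap {u} {v} q = +-cancelˡ-≡ (cx u) _ _ (trans (sum u) (trans (sym (sum v)) (trans (cong (_+ cy v) q) (sym (+-suc (cx u) (cy v))))))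

module _ {ν cx cy} (St : Stair ν cx cy) where

  balanced : (S : State cx cy ∅₂) → Balanced ν cx cy (State.ê S)
  balanced S = record
    { bx = λ {u} {v} q → StairCount.ê-step (trStair St) (trS S) (step-swap St {u} {v} q)
    ; by = λ {u} {v} q → StairCount.ê-step St S (step-swap (trStair St) {u} {v} q) }

  lattice : (S : State cx cy ∅₂) → Lattice (State.R S)
  lattice S r V = cnt-inj {λ u → is (R u) (suc r)} {λ u → is (R u) r} (Φ bx diag! r) (mono bx diag! r) V V ex
    where
    open Stair St
    open State S
    open Rank (ν , stairD St) S using (at; diag!)
    open Balanced (balanced S)
    open Match St conf
    ex : ∀ u → u < V → is (R u) (suc r) ≡ true → ∃ λ u₁ → Φ bx diag! r u u₁ × u₁ < V × is (R u₁) r ≡ true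
    ex u l q with above bx diag! r {u} (is-T {R u} q) (λ pu → at (u , ≤-trans (n≤1+n r) (≤-trans (≤-reflexive (sym (is-T {R u} q))) (R≤ u)) , C≤ u))
    ... | u₁ , φ , l₁ , r₁ = u₁ , φ , <-trans l₁ l , is-t r₁

-- The converse of `_≼_` for windows that start at one place `s`. At first the words are known to
-- agree only beyond all entered entries; each promotion then brings the starting place one step
-- closer to 0.
Pushes : ℕ → (ℕ → ℕ) → (ℕ → ℕ) → Set
Pushes s y z = ∀ k V m → Has k (y ∘ (s +_)) V m → Has k (z ∘ (s +_)) V m

module _ {ν cx cy I} (St : Stair ν cx cy) (c : HConf cx cy I) (bal : ∀ {u v} → cx v ≡ suc (cx u) → HConf.ê c u < HConf.ê c v + suc ν)
         (v : ℕ) (pv : v ≤ HConf.ê c v) (rv : HConf.R c v ≡ suc (HConf.ha c)) (cv : HConf.C c v ≡ HConf.hb c)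
         (mn : ∀ u → u ≤ HConf.ê c u → HConf.R c u ≡ HConf.ha c → HConf.C c u ≡ suc (HConf.hb c) → v ≤ u) where
  open Stair St
  open Per P
  open HConf c
  open Down (stairD St) c v pv rv cv mn
  open Match St conf

  private
    dg : ∀ u → R (ê u) ≡ cx u × C (ê u) ≡ cy u
    dg u = diag u (notDiag u)
    r = ha

  -- An entry of row `ha + 1` after `v` lies right of the hole, hence the one above it exceeds `v`
  -- by `beyond`. The partner of an entry still to enter is at least the diagonal entry of row `ha`,
  -- to which `beyond` applies as well.
  suffix : ∀ d → cnt (λ x → is (R (suc v + x)) (suc r)) d ≤ cnt (λ x → is (R (suc v + x)) r) d
  suffix d = cnt-inj {λ x → is (R (suc v + x)) (suc r)} {λ x → is (R (suc v + x)) r} (λ x x₁ → Φ bal dg r (suc v + x) (suc v + x₁))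
    (λ φ ψ l → +-cancelˡ-< (suc v) _ _ (mono bal dg r φ ψ (+-monoʳ-< (suc v) l))) d d ex
    where
    ex : ∀ x → x < d → is (R (suc v + x)) (suc r) ≡ true →
         ∃ λ x₁ → Φ bal dg r (suc v + x) (suc v + x₁) × x₁ < d × is (R (suc v + x₁)) r ≡ true
    ex x l q = u₁ ∸ suc v , subst (Φ bal dg r u) (sym eq) φ , +-cancelˡ-< (suc v) _ d (≤-<-trans (≤-reflexive eq) (<-trans u₁<u (+-monoʳ-< (suc v) l))) , is-t (trans (cong R eq) r₁)
      where
      u = suc v + x
      ru : R u ≡ suc r
      ru = is-T {R u} q
      hb<C : Pres u → hb < C u
      hb<C pu = ≰⇒> λ le → <⇒≱ (s≤s (m≤m+n v x)) (ord pu pv (≤-reflexive (trans ru (sym rv))) (≤-trans le (≤-reflexive (sym cv))))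
      A = above bal dg r {u} ru λ pu → fill {ha} {C u} (u , ≤-trans (n≤1+n r) (≤-trans (≤-reflexive (sym ru)) (R≤ u)) , C≤ u)
            (λ i → hI (I-down i ≤-refl (<⇒≤ (hb<C pu)))) λ (_ , p) → <⇒≢ (hb<C pu) (sym p)
      u₁ = proj₁ A
      φ = proj₁ (proj₂ A)
      u₁<u = proj₁ (proj₂ (proj₂ A))
      r₁ = proj₂ (proj₂ (proj₂ A))
      v<u₁ : v < u₁
      v<u₁ with φ
      ... | _ , _ , inj₁ (pu , pu₁ , cu) = beyond pu₁ r₁ (<⇒≤ (<-≤-trans (hb<C pu) (≤-reflexive (sym cu))))
      ... | _ , _ , inj₂ (_ , le , _) = <-≤-trans (beyond (ê-pres z₀) (trans (proj₁ (dg z₀)) cz) (≤-trans hb≤cy (≤-trans (<⇒≤ (Diag.xy (stairD St) {z₀} {v} (≤-trans (s≤s (≤-reflexive cz)) ha<cx))) (≤-reflexive (sym (proj₂ (dg z₀))))))) le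
        where
        z₀ = w r
        cz : cx z₀ ≡ r
        cz = ρw (≤-trans (<⇒≤ ha<cx) (ρ≤ v))
      eq : suc v + (u₁ ∸ suc v) ≡ u₁
      eq = m+[n∸m]≡n v<u₁

  push-down : ∀ s → Pushes s R R′
  push-down s k V m h with s ≤? v
  ... | no s≰v = let (m₁ , le , F) = h in m₁ , le , Fam-cong (λ u _ → sym (R′o (>⇒≢ (<-≤-trans (≰⇒> s≰v) (m≤m+n s u))))) F
  ... | yes s≤v = push ν {v = v ∸ s} (λ u → ≤-trans (R≤ (s + u)) (ρ≤ (s + u))) (λ u ne → R′o λ q → ne (trans (sym (m+n∸m≡n s u)) (cong (_∸ s) q)))
                    (trans (cong R′ sv) R′v) (trans (cong R sv) rv) (λ d → subst₂ _≤_ (sh (suc r) d) (sh r d) (suffix d)) h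
    where
    sv : s + (v ∸ s) ≡ v
    sv = m+[n∸m]≡n s≤v
    sh : ∀ a d → cnt (λ x → is (R (suc v + x)) a) d ≡ cnt (λ x → is (R (s + (suc (v ∸ s) + x))) a) d
    sh a d = cnt-cong d λ x _ → cong (λ t → is (R t) a) (sym (trans (+-suc s (v ∸ s + x)) (cong suc (trans (sym (+-assoc s (v ∸ s) x)) (cong (_+ x) sv)))))

push-moves : ∀ {ν cx cy I} (St : Stair ν cx cy) {c c′ : HConf cx cy I} → Balanced ν cx cy (HConf.ê c) → Moves (stairD St) c c′ →
             ∀ s → Pushes s (HConf.R c) (HConf.R c′) × Pushes s (HConf.C c) (HConf.C c′)
push-moves St b here s = (λ k V m h → h) , λ k V m h → h
push-moves St {c} b (down v pv rv cv mn m) s with push-moves St b m s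
... | p , q = (λ k V m h → p k V m (push-down St c (Balanced.bx b) v pv rv cv mn s k V m h)) , q
push-moves St {c} b (right v pv rv cv mn m) s with push-moves St b m s
... | p , q = p , λ k V m h → q k V m (push-down (trStair St) (trH c) (Balanced.by b) v pv rv cv mn s k V m h)

sucP : ∀ {ν ρ} → Per ν ρ → Per ν (ρ ∘ suc)
sucP {ν} {ρ} P = record
  { ρ≤ = ρ≤ ∘ suc ; ρ-per = ρ-per ∘ suc ; ρ-inj = λ l l′ → ρ-inj (s≤s l) (s≤s l′)
  ; w = λ i → prev (w i) ; w< = λ l → prev< (w< l) ; ρw = λ {i} l → trans (prev-ρ (w i)) (ρw l) }
  where
  open Per P
  prev : ℕ → ℕ
  -- When 0 leaves, the least entry of its class becomes `n`, which the renumbering turns into `ν`.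
  prev zero = ν
  prev (suc x) = x
  prev< : ∀ {x} → x < n → prev x < n
  prev< {zero} l = ≤-refl
  prev< {suc x} l = <-trans ≤-refl l
  prev-ρ : ∀ x → ρ (suc (prev x)) ≡ ρ x
  prev-ρ zero = ρ-per 0
  prev-ρ (suc x) = refl

sucStair : ∀ {ν cx cy} → Stair ν cx cy → Stair ν (cx ∘ suc) (cy ∘ suc)
sucStair St = record { P = sucP (Stair.P St) ; sum = Stair.sum St ∘ suc }

-- Schützenberger's promotion: 0 leaves the corner, all other entries drop by one, the hole slides,
-- and the next entry of the class at which it ends enters. `1 ≤ ν` keeps the corner off the
-- diagonal.
module Promote {ν cx cy} (St : Stair ν cx cy) (ν≥1 : 1 ≤ ν) (S : State cx cy ∅₂) where
  open Stair St
  open State S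
  open Rank (ν , stairD St) S using (at; diag!)

  first : ∀ {u} → Pres u → R u ≡ 0 → C u ≡ 0 → u ≡ 0
  first {u} pu r c = n≤0⇒n≡0 (ord {u} {0} pu z≤n (≤-trans (≤-reflexive r) z≤n) (≤-trans (≤-reflexive c) z≤n))

  off-diag : ∀ {u} → cx u ≡ 0 → cy u ≡ 0 → ⊥
  off-diag {u} p q = <⇒≢ ν≥1 (trans (sym (cong₂ _+_ p q)) (sum u))

  ê≥1 : ∀ u → 1 ≤ ê u
  ê≥1 u = n≢0⇒n>0 λ e → let (x , px , r , c) = at {0} {0} (0 , z≤n , z≤n)
                            x≡ê = trans (n≤0⇒n≡0 (≤-trans (ord px (ê-pres u) (≤-trans (≤-reflexive r) z≤n) (≤-trans (≤-reflexive c) z≤n)) (≤-reflexive e))) (sym e)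
                        in off-diag {u} (trans (sym (proj₁ (diag! u))) (trans (cong R (sym x≡ê)) r)) (trans (sym (proj₂ (diag! u))) (trans (cong C (sym x≡ê)) c))

  ê⁻ : ℕ → ℕ
  ê⁻ u = pred (ê (suc u))

  suc-ê⁻ : ∀ u → suc (ê⁻ u) ≡ ê (suc u)
  suc-ê⁻ u = suc-pred (ê (suc u)) ⦃ >-nonZero (ê≥1 (suc u)) ⦄

  pres : ∀ {u} → u ≤ ê⁻ u → Pres (suc u)
  pres {u} p = ≤-trans (s≤s p) (≤-reflexive (suc-ê⁻ u))

  pres⁻ : ∀ {u} → Pres (suc u) → u ≤ ê⁻ u
  pres⁻ {u} p = s≤s⁻¹ (≤-trans p (≤-reflexive (sym (suc-ê⁻ u))))

  vacated : HConf (cx ∘ suc) (cy ∘ suc) ∅₂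
  vacated = record
    { ha = 0 ; hb = 0
    ; conf = record
      { R = R ∘ suc ; C = C ∘ suc ; ê = ê⁻
      ; ê-x = λ u → trans (cong cx (suc-ê⁻ u)) (ê-x (suc u)) ; ê-y = λ u → trans (cong cy (suc-ê⁻ u)) (ê-y (suc u))
      ; ê-cx = λ q → cong pred (ê-cx q) ; ê-cy = λ q → cong pred (ê-cy q)
      ; tailR = λ np → tailR (np ∘ pres⁻) ; tailC = λ np → tailC (np ∘ pres⁻)
      ; R≤ = R≤ ∘ suc ; C≤ = C≤ ∘ suc ; notI = λ _ ()
      ; notH = λ { p (r , c) → 1+n≢0 (first (pres p) r c) }
      ; fill = λ { (u , p , q) _ h → fill′ (at (suc u , p , q)) h }
      ; ord = λ pu pv r c → s≤s⁻¹ (ord (pres pu) (pres pv) r c)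
      ; diag = λ u _ → trans (cong R (suc-ê⁻ u)) (proj₁ (diag! (suc u))) , trans (cong C (suc-ê⁻ u)) (proj₂ (diag! (suc u)))
      ; I-down = λ () ; I-diag = λ _ () }
    ; hdom = 0 , z≤n , z≤n ; hI = λ () ; top = λ {u} p q → ⊥-elim (off-diag {suc u} (sym p) (sym q)) }
    where
    fill′ : ∀ {a b} → (∃ λ u → Pres u × R u ≡ a × C u ≡ b) → ¬ At 0 0 a b → ∃ λ u → u ≤ ê⁻ u × R (suc u) ≡ a × C (suc u) ≡ b
    fill′ (suc u , p , r , c) h = u , pres⁻ p , r , c
    fill′ (zero , p , r , c) h = let (x , px , rx , cx₁) = at {0} {0} (0 , z≤n , z≤n) ; x≡0 = first px rx cx₁
                                 in ⊥-elim (h (trans (sym r) (trans (cong R (sym x≡0)) rx) , trans (sym c) (trans (cong C (sym x≡0)) cx₁)))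

  bal : Balanced ν (cx ∘ suc) (cy ∘ suc) ê⁻
  bal = record
    { bx = λ {u} {v} q → s≤s⁻¹ (subst₂ (λ x y → x < y + suc ν) (sym (suc-ê⁻ u)) (sym (suc-ê⁻ v)) (bx q))
    ; by = λ {u} {v} q → s≤s⁻¹ (subst₂ (λ x y → x < y + suc ν) (sym (suc-ê⁻ u)) (sym (suc-ê⁻ v)) (by q)) }
    where open Balanced (balanced St S)

  private
    St⁺ = sucStair St
    sl = slides (stairD St⁺) ν (λ u → ≤-reflexive (sum (suc u))) ν vacated (m≤m+n ν 0)
    c′ = proj₁ sl
    mv = proj₁ (proj₂ sl)
    dg = proj₂ (proj₂ sl)

  promoted : State (cx ∘ suc) (cy ∘ suc) ∅₂
  promoted = record
    { conf = Refill.refilled (stairD St⁺) c′ (proj₁ dg) (proj₁ (proj₂ dg)) (proj₂ (proj₂ dg))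
    ; R≼ = ≼-trans (proj₁ (Moves-≼ (stairD St⁺) mv)) (≼-suc R≼) ; C≼ = ≼-trans (proj₁ (proj₂ (Moves-≼ (stairD St⁺) mv))) (≼-suc C≼) }

  promoted-pushes : ∀ s → Pushes (suc s) cx R → Pushes (suc s) cy C →
                    Pushes s (cx ∘ suc) (State.R promoted) × Pushes s (cy ∘ suc) (State.C promoted)
  promoted-pushes s p q = let (p′ , q′) = push-moves St⁺ bal mv s in
    (λ k V m h → p′ k V m (p k V m h)) , λ k V m h → q′ k V m (q k V m h)

-- The tableau with maximal chain lengths

shift : ℕ → (ℕ → ℕ) → ℕ → ℕ
shift zero f = f
shift (suc s) f = shift s (f ∘ suc)

shift≡ : ∀ s f u → shift s f u ≡ f (s + u)
shift≡ zero f u = refl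
shift≡ (suc s) f u = shift≡ s (f ∘ suc) u

shiftStair : ∀ {ν cx cy} s → Stair ν cx cy → Stair ν (shift s cx) (shift s cy)
shiftStair zero St = St
shiftStair (suc s) St = shiftStair s (sucStair St)

promotes : ∀ {ν cx cy} s (St : Stair ν cx cy) → 1 ≤ ν → (S : State cx cy ∅₂) → Pushes s cx (State.R S) → Pushes s cy (State.C S) →
           ∃ λ (S′ : State (shift s cx) (shift s cy) ∅₂) → Pushes 0 (shift s cx) (State.R S′) × Pushes 0 (shift s cy) (State.C S′)
promotes zero St l S p q = S , p , q
promotes (suc s) St l S p q = let (p′ , q′) = Promote.promoted-pushes St l S s p q in promotes s (sucStair St) l (Promote.promoted St l S) p′ q′

Maximal : (ℕ → ℕ) → (ℕ → ℕ) → Set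
Maximal y z = ∀ {k V m} → Has k y V m → m ≤ cnt (λ u → lt (z u) k) V

Has-cong : ∀ {k y z V m} → (∀ u → y u ≡ z u) → Has k y V m → Has k z V m
Has-cong e (m , l , F) = m , l , Fam-cong (λ u _ → e u) F

≼-cong : ∀ {x y z} → (∀ u → y u ≡ z u) → x ≼ y → x ≼ z
≼-cong e p .≼-Has k s V m h = Has-cong (λ u → e (s + u)) (p .≼-Has k s V m h)

congS : ∀ {cx cy cx′ cy′ I} → (∀ u → cx u ≡ cx′ u) → (∀ u → cy u ≡ cy′ u) → State cx cy I → State cx′ cy′ I
congS {cx} {cy} {cx′} {cy′} {I} ex ey S = record
  { conf = record
    { R = R ; C = C ; ê = ê ; ê-x = λ u → trans (sym (ex (ê u))) (trans (ê-x u) (ex u)) ; ê-y = λ u → trans (sym (ey (ê u))) (trans (ê-y u) (ey u))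
    ; ê-cx = λ {u} {v} q → ê-cx (trans (ex u) (trans q (sym (ex v)))) ; ê-cy = λ {u} {v} q → ê-cy (trans (ey u) (trans q (sym (ey v))))
    ; tailR = λ {u} np → trans (tailR np) (ex u) ; tailC = λ {u} np → trans (tailC np) (ey u)
    ; R≤ = λ u → ≤-trans (R≤ u) (≤-reflexive (ex u)) ; C≤ = λ u → ≤-trans (C≤ u) (≤-reflexive (ey u))
    ; notI = notI ; notH = notH
    ; fill = λ { (u , p , q) → fill (u , ≤-trans p (≤-reflexive (sym (ex u))) , ≤-trans q (≤-reflexive (sym (ey u)))) }
    ; ord = ord ; diag = λ u _ → trans (proj₁ (diag u (λ ()))) (ex u) , trans (proj₂ (diag u (λ ()))) (ey u)
    ; I-down = I-down ; I-diag = λ u i → I-diag u (subst₂ I (sym (ex u)) (sym (ey u)) i) }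
  ; R≼ = ≼-cong ex R≼ ; C≼ = ≼-cong ey C≼ }
  where open State S

module _ {ν cx cy} (St : Stair ν cx cy) where
  open Stair St
  open Per P

  some-final : State cx cy ∅₂
  some-final = proj₁ (completes (stairD St) ν (λ u → ≤-reflexive (sum u)) ν (λ x l → m≤n⇒m∸n≡0 l) sub
                 (start (stairD St) (Under (ν ∸_)) (λ l p q → <-≤-trans (≤-<-trans q l) (∸-monoʳ-≤ ν p)) (λ u l → <⇒≢ l (cy≡ u)) cover))
    where
    sub : ∀ {a b} → Under (ν ∸_) a b → Dom cx cy a b
    sub {a} {b} l = w a , ≤-reflexive (sym aw) , ≤-trans (<⇒≤ l) (≤-reflexive (sym (trans (cy≡ (w a)) (cong (ν ∸_) aw))))
      where
      aw : cx (w a) ≡ a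
      aw = ρw (<⇒≤ (m∸n≢0⇒n<m {ν} {a} λ q → n≮0 (<-≤-trans l (≤-reflexive q))))
    cover : ∀ {a b} → Dom cx cy a b → ¬ Under (ν ∸_) a b → ∃ λ u → cx u ≡ a × cy u ≡ b
    cover {a} {b} (u , p , q) nl = u , cxa , ≤-antisym (≤-trans (≤-reflexive (trans (cy≡ u) (cong (ν ∸_) cxa))) le) q
      where
      le = ≮⇒≥ nl
      cxa : cx u ≡ a
      cxa = ≤-antisym (+-cancelʳ-≤ (cy u) _ _ (≤-trans (≤-reflexive (sum u)) (≤-trans (m≤n+m∸n ν a) (+-monoʳ-≤ a (≤-trans le q))))) p

  maximal : (S : State cx cy ∅₂) → Pushes 0 cx (State.R S) → Maximal cx (State.R S)
  maximal S p {k} {V} {m} h = lattice-max (lattice St S) (p k V m h)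

shifted-back : ∀ {ν cx cy} (St : Stair ν cx cy) t → (∀ u → shift (t * suc ν) cx u ≡ cx u) × (∀ u → shift (t * suc ν) cy u ≡ cy u)
shifted-back {ν} {cx} {cy} St t = (λ u → trans (shift≡ (t * suc ν) cx u) (trans (cong cx (+-comm (t * suc ν) u)) (Per.ρ-per* (Stair.P St) u t))) ,
                        λ u → trans (shift≡ (t * suc ν) cy u) (trans (cong cy (+-comm (t * suc ν) u)) (Per.ρ-per* (Stair.P (trStair St)) u t))

-- Beyond `M` nothing has entered and both words are periodic, so `Pushes M` holds trivially. After
-- `M` promotions it has become `Pushes 0`, and as `M` is a multiple of the period, the shifted
-- words are `cx` and `cy` again.
maximal-state : ∀ {ν cx cy} → Stair ν cx cy → ∃ λ (S : State cx cy ∅₂) → Maximal cx (State.R S) × Maximal cy (State.C S)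
-- The only box is the corner and lies on the diagonal, so nothing can be promoted; but all letters
-- are 0.
maximal-state {zero} {cx} {cy} St = S , maximal St S (λ k V m → Has-cong (λ u → z (≤-reflexive (m+n≡0⇒m≡0 (cx u) (Stair.sum St u))) (R≤ u))) ,
                      maximal (trStair St) (trS S) λ k V m → Has-cong (λ u → z (≤-reflexive (m+n≡0⇒n≡0 (cx u) (Stair.sum St u))) (C≤ u))
  where
  S = some-final St
  open State S
  z : ∀ {x y} → x ≤ 0 → y ≤ x → x ≡ y
  z p q = trans (n≤0⇒n≡0 p) (sym (n≤0⇒n≡0 (≤-trans q p)))
maximal-state {suc ν} {cx} {cy} St = S″ , (λ h → maximal St′ S′ pR (Has-cong (λ u → sym (ex u)) h)) , λ h → maximal (trStair St′) (trS S′) pC (Has-cong (λ u → sym (ey u)) h)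
  where
  S = some-final St
  open State S
  open Stair St
  open Per P
  -- The number of periods that `e<2νn` shows to exceed every diagonal entry.
  t = suc (suc ν + suc ν)
  M = t * n
  absent : ∀ x → ¬ Pres (M + x)
  absent x p = <⇒≱ (≤-trans (StairCount.e<2νn St S (ρ≤ (M + x))) (m≤m+n M x)) (≤-trans p (≤-reflexive (StairCount.ê≡e St S (M + x))))
  pr = promotes M St (s≤s z≤n) S (λ k V m → Has-cong λ u → sym (tailR (absent u))) (λ k V m → Has-cong λ u → sym (tailC (absent u)))
  S′ = proj₁ pr
  pR = proj₁ (proj₂ pr)
  pC = proj₂ (proj₂ pr)
  St′ = shiftStair M St
  ex = proj₁ (shifted-back St t)
  ey = proj₂ (shifted-back St t)
  S″ = congS ex ey S′

abstract
  reference : ∀ {ν cx cy} → Stair ν cx cy → ∃ λ (S : State cx cy ∅₂) → Maximal cx (State.R S) × Maximal cy (State.C S)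
  reference = maximal-state

-- Uniqueness of the completed tableau

cnt-last : ∀ p q u → cnt p (suc u) ≤ cnt q (suc u) → (∀ x → x < u → q x ≡ true → p x ≡ true) → p u ≡ true → q u ≡ true
cnt-last p q u le h pu with q u in eq
... | true = refl
... | false rewrite pu = ⊥-elim (<⇒≱ le (cnt-mono-p u h))

module Unique {ν cx cy cy°} (St : Stair ν cx cy°) (U : State cx cy° ∅₂) (Rmax : Maximal cx (State.R U)) (Cmax : Maximal cy° (State.C U))
              (D : Diag ν cx cy) (T : State cx cy ∅₂) where
  open Stair St
  open Per P
  open Diag D
  private
    module U = State U
    module T = State T
    module RU = Rank (ν , stairD St) U
    module RT = Rank (ν , D) T

    -- The `ν ∸ cx u` rows further down all end strictly earlier, each earlier than the one above
    -- it.
    cy≥ : ∀ u → ν ∸ cx u ≤ cy u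
    cy≥ u = go (ν ∸ cx u) u (m+[n∸m]≡n (ρ≤ u))
      where
      go : ∀ d u → cx u + d ≡ ν → d ≤ cy u
      go zero u eq = z≤n
      go (suc d) u eq = ≤-trans (s≤s (go d v (trans (cong (_+ d) cv) eq′))) (xy {u} {v} (≤-reflexive (sym cv)))
        where
        eq′ : suc (cx u) + d ≡ ν
        eq′ = trans (sym (+-suc (cx u) d)) eq
        v = w (suc (cx u))
        cv : cx v ≡ suc (cx u)
        cv = ρw (≤-trans (m≤m+n (suc (cx u)) d) (≤-reflexive eq′))

    -- Both words put the classes in the order opposite to `cx`, and chains depend only on the order
    -- of the letters.
    C-fam : ∀ {k V m} → Has k cy V m → Has k cy° V m
    C-fam (m , l , F) = m , l , Fam-map (λ u v _ _ le → ≮⇒≥ λ l → <⇒≱ (xy {u} {v} (Diag.yx (stairD St) {v} {u} l)) le) (λ _ _ _ _ → z≤n) F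

    module Step (u : ℕ) (IH : ∀ {x} → x < u → T.R x ≡ U.R x) where

      -- The first `k` rows of `T` are `k` chains of its word, so by `Rmax` the first `k` rows of
      -- `U` contain at least as many entries up to `u`. The earlier entries are distributed alike,
      -- hence `u` itself is in one of these rows of `U`.
      U≤T : U.R u ≤ T.R u
      U≤T = s≤s⁻¹ (lt-T (cnt-last (λ x → lt (T.R x) k) (λ x → lt (U.R x) k) u
              (Rmax (≼-Has T.R≼ k 0 (suc u) _ (rows-Fam k T.R (suc u)))) (λ x l q → trans (cong (λ z → lt z k) (IH l)) q) (lt-t {T.R u} ≤-refl)))
        where k = suc (T.R u)

      same-row : ∀ {a x} → x ≤ u → cnt (λ y → is (T.R y) a) x ≡ cnt (λ y → is (U.R y) a) x
      same-row {a} {x} le = cnt-cong x λ y l → cong (λ z → is z a) (IH (<-≤-trans l le))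

      module _ (U<T : U.R u < T.R u) where
        i = T.R u
        c = cnt (λ x → is (T.R x) i) u

        i≤ : i ≤ cx u
        i≤ = T.R≤ u

        U-pres : U.Pres u
        U-pres with u ≤? U.ê u
        ... | yes p = p
        ... | no np = ⊥-elim (<⇒≱ U<T (≤-trans i≤ (≤-reflexive (sym (U.tailR np)))))

        -- With more than `ν ∸ i` earlier entries in row `i`, the tableau `U` has filled the
        -- diagonal box of this row before `u`. But the box of `u` in `U` is weakly northwest of it.
        far : ν < i + c → ⊥
        far l = <⇒≱ e<u (U.ord U-pres (U.ê-pres z) (≤-trans (<⇒≤ U<T) (≤-reflexive (sym rz)))
                  (≤-trans (U.C≤ u) (≤-trans (≤-reflexive (cy≡ u)) (≤-trans (∸-monoʳ-≤ ν i≤) (≤-reflexive (sym cz))))))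
          where
          z = w i
          iν = ≤-trans i≤ (ρ≤ u)
          rz : U.R (U.ê z) ≡ i
          rz = trans (proj₁ (RU.diag! z)) (ρw iν)
          cz : U.C (U.ê z) ≡ ν ∸ i
          cz = trans (proj₂ (RU.diag! z)) (trans (cy≡ z) (cong (ν ∸_) (ρw iν)))
          e<u : U.ê z < u
          e<u = ≰⇒> λ le → <⇒≱ l (≤-trans (+-monoʳ-≤ i (begin
            c ≡⟨ same-row ≤-refl ⟩
            cnt (λ x → is (U.R x) i) u ≤⟨ cnt-mono-V _ le ⟩
            cnt (λ x → is (U.R x) i) (U.ê z) ≡⟨ cong (λ t → cnt (λ x → is (U.R x) t) (U.ê z)) (sym rz) ⟩
            cnt (λ x → is (U.R x) (U.R (U.ê z))) (U.ê z) ≡⟨ RU.rank (U.ê-pres z) ⟩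
            U.C (U.ê z) ≡⟨ cz ⟩
            ν ∸ i ∎)) (≤-reflexive (m+[n∸m]≡n iν)))
            where open ≤-Reasoning

        -- Here `u` has column `c` in `T` but a larger one in `U`. Up to `u`, the columns through
        -- `c` would then hold fewer entries in `U` than in `T`, against `Cmax`.
        near : i + c ≤ ν → ⊥
        near l = <⇒≱ C> (s≤s⁻¹ (lt-T (cnt-last (λ x → lt (T.C x) (suc c)) (λ x → lt (U.C x) (suc c)) u
                   (Cmax (C-fam (≼-Has T.C≼ (suc c) 0 (suc u) _ (rows-Fam (suc c) T.C (suc u)))))
                   (λ x x<u q → lt-t (s≤s (≮⇒≥ (below x x<u (s≤s⁻¹ (lt-T q)))))) (lt-t (s≤s (≤-reflexive Cu))))))
          where
          c≤ : c ≤ ν ∸ i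
          c≤ = m+n≤o⇒m≤o∸n c (≤-trans (≤-reflexive (+-comm c i)) l)
          T-pres : T.Pres u
          T-pres with u ≤? T.ê u
          ... | yes p = p
          ... | no np = ⊥-elim (<⇒≱ (RT.rank-tail np) (≤-trans (≤-reflexive (cong (λ z → cnt (λ x → is (T.R x) z) u) (sym (T.tailR np)))) (≤-trans c≤ (≤-trans (≤-reflexive (cong (ν ∸_) (T.tailR np))) (cy≥ u)))))
          Cu : T.C u ≡ c
          Cu = sym (RT.rank T-pres)
          C> : c < U.C u
          C> = ≤-trans (RT.rank-≥ {U.R u} {u} (suc c) box) (≤-trans (≤-reflexive (same-row ≤-refl)) (RU.rank-≤ U-pres))
            where
            box : ∀ b → b < suc c → ∃ λ x → x < u × T.Pres x × T.R x ≡ U.R u × T.C x ≡ b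
            box b lb with RT.at {U.R u} {b} (u , ≤-trans (<⇒≤ U<T) i≤ , ≤-trans (s≤s⁻¹ lb) (≤-trans (≤-reflexive (sym Cu)) (T.C≤ u)))
            ... | x , px , rx , cx₁ = x , ≤∧≢⇒< (T.ord px T-pres (≤-trans (≤-reflexive rx) (<⇒≤ U<T)) (≤-trans (≤-reflexive cx₁) (≤-trans (s≤s⁻¹ lb) (≤-reflexive (sym Cu))))) (λ q → <⇒≢ U<T (trans (sym rx) (cong T.R q))) , px , rx , cx₁
          deep : ∀ x → ¬ U.Pres x → U.C x ≤ c → i ≤ cx x
          deep x np le = ≮⇒≥ λ l′ → <⇒≱ (∸-monoʳ-< l′ (≤-trans i≤ (ρ≤ u))) (≤-trans (≤-reflexive (sym (trans (U.tailC np) (cy≡ x)))) (≤-trans le c≤))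
          -- Ranks settle the cases in which `x` has entered `U`. Otherwise its class is at least
          -- `i`, and in `T` either `x` or the last entered entry of its class lies weakly southeast
          -- of `u`, although it is smaller than `u`.
          below : ∀ x → x < u → U.C x ≤ c → ¬ c < T.C x
          below x x<u le gt with x ≤? T.ê x | x ≤? U.ê x
          ... | yes tp | yes up = <⇒≱ gt (≤-trans (≤-reflexive (trans (sym (RT.rank tp)) (trans (same-row (<⇒≤ x<u)) (trans (cong (λ z → cnt (λ y → is (U.R y) z) x) (IH x<u)) (RU.rank up))))) le)
          ... | yes tp | no un = <⇒≱ x<u (T.ord T-pres tp (≤-trans (deep x un le) (≤-reflexive (sym (trans (IH x<u) (U.tailR un))))) (≤-trans (≤-reflexive Cu) (<⇒≤ gt)))
          ... | no tn | yes up = <⇒≱ (<-≤-trans gt (≤-reflexive (T.tailC tn))) (≤-trans (<⇒≤ (RT.rank-tail tn)) (≤-trans (≤-reflexive (trans (same-row (<⇒≤ x<u)) (trans (cong (λ z → cnt (λ y → is (U.R y) z) x) (trans (sym (T.tailR tn)) (IH x<u))) (RU.rank up)))) le))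
          ... | no tn | no un = <-asym x<u (≤-<-trans (T.ord T-pres (T.ê-pres x) (≤-trans (deep x un le) (≤-reflexive (sym (proj₁ (RT.diag! x))))) (≤-trans (≤-reflexive Cu) (≤-trans (<⇒≤ gt) (≤-reflexive (trans (T.tailC tn) (sym (proj₂ (RT.diag! x)))))))) (≰⇒> tn))

      agrees : T.R u ≡ U.R u
      agrees with m≤n⇒m<n∨m≡n U≤T
      ... | inj₂ e = sym e
      ... | inj₁ l with ν <? T.R u + cnt (λ x → is (T.R x) (T.R u)) u
      ... | yes f = ⊥-elim (far l f)
      ... | no g = ⊥-elim (near l (≮⇒≥ g))

  agree : ∀ u → T.R u ≡ U.R u
  agree = <-rec (λ u → T.R u ≡ U.R u) λ u IH → Step.agrees u IH

  column : ∀ {u} → T.Pres u → T.C u ≡ cnt (λ x → is (U.R x) (U.R u)) u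
  column {u} p = trans (sym (RT.rank p)) (trans (cnt-cong u λ x _ → cong (λ z → is z (T.R u)) (agree x)) (cong (λ z → cnt (λ x → is (U.R x) z) u) (agree u)))

-- The infinite tableau of a periodic word

module Tableau {ν ρ} (P : Per ν ρ) where
  open Per P

  stair : Stair ν ρ (λ u → ν ∸ ρ u)
  stair = record { P = P ; sum = λ u → m+[n∸m]≡n (ρ≤ u) }

  private
    module S = StairCount stair (proj₁ (reference stair))
    module S₀ = RowCount P (stairD stair) (proj₁ (reference stair))
    module U = State (proj₁ (reference stair))

  -- In a completed tableau this rank is the column, by `Unique.column`, but it makes sense for all
  -- entries at once; this is the tableau of which all others are restrictions.
  row col : ℕ → ℕ
  row = U.R
  col u = cnt (λ x → is (row x) (row u)) u

  q : ℕ → ℕ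
  q = S.q

  q-formula : ∀ {i} → i ≤ ν → q i + asc i ≡ i + asc (ν ∸ i)
  q-formula = S.q-formula

  pos-ord : ∀ {u v} → row u ≤ row v → col u ≤ col v → u ≤ v
  pos-ord {u} {v} r c = ≮⇒≥ λ l → <⇒≱ (lattice-inc (lattice stair (proj₁ (reference stair))) l r) c

  pos-inj : ∀ {u v} → row u ≡ row v → col u ≡ col v → u ≡ v
  pos-inj r c = ≤-antisym (pos-ord (≤-reflexive r) (≤-reflexive c)) (pos-ord (≤-reflexive (sym r)) (≤-reflexive (sym c)))

  -- From the diagonal entry of the staircase on, row `a` receives exactly the entries of class `a`,
  -- one in each period.
  deep : ∀ {a t} → a ≤ ν → q a ≤ t → row (val a t) ≡ a × col (val a t) + q a ≡ t + (ν ∸ a)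
  deep {a} {t} l qt = rw , trans (cong (λ z → cnt (λ x → is (row x) z) (val a t) + q a) rw)
      (trans (S₀.row-count l (≤-trans (≤-reflexive (S₀.e≡ l)) (+-monoʳ-≤ (w a) (*-monoˡ-≤ n qt)))) (cong₂ _+_ (S₀.cnt-val t l) (cong (ν ∸_) (ρw l))))
    where
    rw : row (val a t) ≡ a
    rw with m≤n⇒m<n∨m≡n qt
    ... | inj₂ refl = trans (cong row (sym (S₀.e≡ l))) (trans (proj₁ (U.diag (w a) (λ ()))) (ρw l))
    ... | inj₁ l′ = trans (U.tailR λ p → <⇒≱ (≤-<-trans (≤-reflexive (S₀.e≡ l)) (+-monoʳ-< (w a) (*-monoˡ-< n l′)))
                            (≤-trans p (≤-reflexive (U.ê-cx (trans (ρ-val t l) (sym (ρw l))))))) (ρ-val t l)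

  -- `Y a` is the position of the diagonal in row `a`. Its strict decrease forces `ν ∸ a ≤ Y a` and
  -- `Y a + a < m`, the limits of the band in which diagonals can lie.
  module Region (m : ℕ) (Y : ℕ → ℕ) (Y-dec : ∀ {i} → suc i ≤ ν → Y (suc i) < Y i) (Y<m : Y 0 < m) where

    cy : ℕ → ℕ
    cy u = Y (ρ u)

    private
      go : ∀ d i → d + i ≤ ν → Y (d + i) + d ≤ Y i
      go zero i l = ≤-reflexive (+-identityʳ (Y i))
      go (suc d) i l = ≤-trans (≤-reflexive (+-suc _ d)) (≤-trans (+-monoˡ-≤ d (Y-dec l)) (go d i (<⇒≤ l)))

    Y-drop : ∀ {i j} → i ≤ j → j ≤ ν → Y j + (j ∸ i) ≤ Y i
    Y-drop {i} {j} l l′ = subst (λ z → Y z + (j ∸ i) ≤ Y i) (m∸n+n≡m l) (go (j ∸ i) i (≤-trans (≤-reflexive (m∸n+n≡m l)) l′))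

    Y-anti : ∀ {i j} → i ≤ j → j ≤ ν → Y j ≤ Y i
    Y-anti l l′ = ≤-trans (m≤m+n _ _) (Y-drop l l′)

    Y-lo : ∀ {i} → i ≤ ν → ν ∸ i ≤ Y i
    Y-lo l = ≤-trans (m≤n+m _ _) (Y-drop l ≤-refl)

    Y-hi : ∀ {i} → i ≤ ν → Y i + i < m
    Y-hi l = ≤-<-trans (Y-drop z≤n l) Y<m

    D : Diag ν ρ cy
    D = diagP P (λ {u} {v} l → <-≤-trans (m<m+n (Y (ρ v)) (m<n⇒0<n∸m l)) (Y-drop (<⇒≤ l) (ρ≤ v))) (cong Y)

    Dom⇒ : ∀ {a b} → Dom ρ cy a b → a ≤ ν × b ≤ Y a
    Dom⇒ (u , p , q) = ≤-trans p (ρ≤ u) , ≤-trans q (Y-anti p (ρ≤ u))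

    ⇒Dom : ∀ {a b} → a ≤ ν → b ≤ Y a → Dom ρ cy a b
    ⇒Dom {a} l p = w a , ≤-reflexive (sym (ρw l)) , ≤-trans p (≤-reflexive (cong Y (sym (ρw l))))

    inner : ℕ → ℕ
    inner a = if lt ν a then 0 else Y a

    inner-≤ : ∀ {a} → a ≤ ν → inner a ≡ Y a
    inner-≤ l rewrite lt-f l = refl

    inner⇒ : ∀ {a b} → b < inner a → a ≤ ν × b < Y a
    inner⇒ {a} l with a ≤? ν
    ... | yes p = p , <-≤-trans l (≤-reflexive (inner-≤ p))
    ... | no np = ⊥-elim (n≮0 (<-≤-trans l (≤-reflexive (cong (λ z → if z then 0 else Y a) (lt-t (≰⇒> np))))))

    inner-Dom : ∀ {a b} → Under inner a b → Dom ρ cy a b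
    inner-Dom l = let (p , q) = inner⇒ l in ⇒Dom p (<⇒≤ q)

    begin-state : State ρ cy (Under inner)
    begin-state = start D (Under inner)
      (λ {a} {b} {a′} {b′} l p q → let (s , t) = inner⇒ {a} l in <-≤-trans (≤-<-trans q t) (≤-trans (Y-anti p s) (≤-reflexive (sym (inner-≤ (≤-trans p s))))))
      (λ u l → <-irrefl refl (proj₂ (inner⇒ {ρ u} l)))
      λ {a} d nl → let (s , t) = Dom⇒ d in w a , ρw s , ≤-antisym (≤-trans (≤-reflexive (cong Y (ρw s))) (≤-trans (≤-reflexive (sym (inner-≤ s))) (≮⇒≥ nl))) (≤-trans t (≤-reflexive (cong Y (sym (ρw s)))))

    coords≤ : ∀ u → ρ u + cy u ≤ ν + m
    coords≤ u = +-mono-≤ (ρ≤ u) (≤-trans (Y-anti z≤n (ρ≤ u)) (<⇒≤ Y<m))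

    module Final (T : State ρ cy ∅₂) where
      private
        module T = State T
        module K = Unique stair (proj₁ (reference stair)) (proj₁ (proj₂ (reference stair))) (proj₂ (proj₂ (reference stair))) D T
        module Q = RowCount P D T
      open Q using (e) renaming (q to qT)

      row≡ : ∀ u → T.R u ≡ row u
      row≡ = K.agree

      col≡ : ∀ {u} → T.Pres u → T.C u ≡ col u
      col≡ = K.column

      -- The row words of `T` and of the reference tableau agree, so `row-count` can be applied to
      -- both in one window; they differ only in the length of the row before the diagonal, `Y a`
      -- against `ν ∸ a`.
      top : ∀ {a} → a ≤ ν → ∃ λ t → (∀ {u} → ρ u ≡ a → T.ê u ≡ val a t) × t + (ν ∸ a) ≡ q a + Y a
      top {a} l = qT a , (λ {u} r → trans (Q.ê≡e u) (trans (cong e r) (Q.e≡ l))) , +-cancelˡ-≡ (cnt (λ u → is (T.R u) a) V) _ _ (begin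
          X + (qT a + (ν ∸ a)) ≡⟨ sym (+-assoc X _ _) ⟩
          X + qT a + (ν ∸ a) ≡⟨ cong (_+ (ν ∸ a)) (Q.row-count l (m≤m+n _ _)) ⟩
          Z + Y (ρ (w a)) + (ν ∸ a) ≡⟨ solve 3 (λ x y z → x :+ y :+ z := x :+ z :+ y) refl Z (Y (ρ (w a))) (ν ∸ a) ⟩
          Z + (ν ∸ a) + Y (ρ (w a)) ≡⟨ cong₂ (λ x y → Z + (ν ∸ x) + Y y) (sym (ρw l)) (ρw l) ⟩
          Z + (ν ∸ ρ (w a)) + Y a ≡⟨ cong (_+ Y a) (sym (S₀.row-count l (m≤n+m (S₀.e a) (e a)))) ⟩
          cnt (λ u → is (row u) a) V + q a + Y a ≡⟨ cong (λ z → z + q a + Y a) (cnt-cong V λ u _ → cong (λ z → is z a) (sym (row≡ u))) ⟩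
          X + q a + Y a ≡⟨ +-assoc X _ _ ⟩
          X + (q a + Y a) ∎)
        where
        open ≡-Reasoning
        open +-*-Solver
        V = e a + S₀.e a
        X = cnt (λ u → is (T.R u) a) V
        Z = cnt (λ u → is (ρ u) a) V

      top< : ∀ {a t} → a ≤ ν → t + (ν ∸ a) ≡ q a + Y a → t < m
      top< {a} {t} l eq = +-cancelʳ-< (asc a + (ν ∸ a)) t m (begin-strict
          t + (asc a + (ν ∸ a)) ≡⟨ solve 3 (λ x y z → x :+ (y :+ z) := (x :+ z) :+ y) refl t (asc a) (ν ∸ a) ⟩
          t + (ν ∸ a) + asc a ≡⟨ cong (_+ asc a) eq ⟩
          q a + Y a + asc a ≡⟨ solve 3 (λ x y z → x :+ y :+ z := x :+ z :+ y) refl (q a) (Y a) (asc a) ⟩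
          q a + asc a + Y a ≡⟨ cong (_+ Y a) (q-formula l) ⟩
          a + asc (ν ∸ a) + Y a ≡⟨ solve 3 (λ x y z → x :+ y :+ z := z :+ x :+ y) refl a (asc (ν ∸ a)) (Y a) ⟩
          Y a + a + asc (ν ∸ a) <⟨ +-mono-<-≤ (Y-hi l) asc-flip ⟩
          m + (asc a + (ν ∸ a)) ∎)
        where
        open ≤-Reasoning
        open +-*-Solver
        asc-flip : asc (ν ∸ a) ≤ asc a + (ν ∸ a)
        asc-flip with ≤-total a (ν ∸ a)
        ... | inj₁ l′ = ≤-trans (asc-≤′ l′) (≤-trans (+-monoˡ-≤ (asc a) (m∸n≤m (ν ∸ a) a)) (≤-reflexive (+-comm (ν ∸ a) (asc a))))
        ... | inj₂ l′ = ≤-trans (asc-mono′ l′) (m≤m+n _ _)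

      ê<mn : ∀ u → T.ê u < m * n
      ê<mn u = let (t , h , eq) = top (ρ≤ u) in ≤-<-trans (≤-reflexive (h refl)) (val<N*n (ρ≤ u) (top< (ρ≤ u) eq))

    abstract
      bounded : ∀ {f} → (∀ {a b} → Under f a b → Dom ρ cy a b) → (S : State ρ cy (Under f)) → ∀ u → State.ê S u < m * n
      bounded {f} sub S u = let (T , le) = completes D (ν + m) coords≤ n z sub S in ≤-<-trans (le u) (Final.ê<mn T u)
        where
        z : ∀ x → n ≤ x → f x ≡ 0
        z x l with f x in eq
        ... | zero = refl
        ... | suc k = ⊥-elim (<⇒≱ l (proj₁ (Dom⇒ (sub {x} {0} (subst (0 <_) (sym eq) (s≤s z≤n))))))

-- Slides of fillings

upd-at : ∀ {r c} (T : Filling r c) x v → upd T x v x ≡ v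
upd-at T x v with x ≟B x
... | yes _ = refl
... | no ne = ⊥-elim (ne refl)

upd-off : ∀ {r c} (T : Filling r c) {x v y} → y ≢ x → upd T x v y ≡ T y
upd-off T {x} {v} {y} ne with y ≟B x
... | yes e = ⊥-elim (ne e)
... | no _ = refl

-- The common shape of the two constructions: F is the direction in which the
-- empty box travels, px and py are coordinates that increase along F, and enc
-- turns the internal value u into the entry of the filling.
record Game (r c ν m : ℕ) : Set₁ where
  field
    {ρ} : ℕ → ℕ
    P : Per ν ρ
    Y : ℕ → ℕ
    Y-dec : ∀ {i} → suc i ≤ ν → Y (suc i) < Y i
    Y<m : Y 0 < m
    px py : Box r c → ℕ
    px≤ : ∀ x → px x ≤ ν
    p-inj : ∀ {x y} → px x ≡ px y → py x ≡ py y → x ≡ y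
    box : ∀ {a j} → a ≤ ν → j < m → ∃ λ x → px x ≡ a × py x ≡ j
    F : Box r c → Box r c → Set
    F⇒ : ∀ {x y} → F x y → (px y ≡ suc (px x) × py y ≡ py x) ⊎ (px y ≡ px x × py y ≡ suc (py x))
    ⇒F : ∀ {x y} → (px y ≡ suc (px x) × py y ≡ py x) ⊎ (px y ≡ px x × py y ≡ suc (py x)) → F x y
    _⊴_ : ℕ → ℕ → Set
    enc bump : ℕ → ℕ
    -- For reverse slides `enc` is truncated subtraction from `m * suc ν`, which is faithful only
    -- below that bound; hence the hypotheses here and the need for `bounded`.
    enc-≤ : ∀ {u v} → u < m * suc ν → v < m * suc ν → u ≤ v → enc u ⊴ enc v
    ≤-enc : ∀ {u v} → u < m * suc ν → v < m * suc ν → enc u ⊴ enc v → u ≤ v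
    enc-bump : ∀ u → enc (u + suc ν) ≡ bump (enc u)
    In : Box r c → Set
    In⇒ : ∀ {x} → In x → py x ≤ Y (px x)
    ⇒In : ∀ {x} → py x ≤ Y (px x) → In x
    dbox : Fin (suc ν) → Box r c
    b-Y : ∀ k → py (dbox k) ≡ Y (px (dbox k))
    b-at : ∀ {a} → a ≤ ν → ∃ λ k → px (dbox k) ≡ a
    init : Fin (suc ν) → ℕ
    init≡ : ∀ k → init k ≡ enc (Per.w P (px (dbox k)))

  data GSlide : Filling r c → Box r c → Filling r c → Box r c → Set where
    stop : ∀ {T x} → (∀ y → F x y → ¬ Filled T y) → GSlide T x T x
    step : ∀ {T x T′ f} y v → F x y → T y ≡ just v → (∀ z u → F x z → T z ≡ just u → v ⊴ u) →
           GSlide (upd (upd T x (just v)) y nothing) y T′ f → GSlide T x T′ f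

  -- The empty boxes of `In` other than `x` form an order ideal for `px` and `py`. For reverse
  -- slides these coordinates are rotated, and the complement of the ideal gives the Young diagram
  -- after adding `x`.
  GCor : Filling r c → Box r c → Set
  GCor T x = In x × T x ≡ nothing ×
    (∀ y z → px z ≤ px y → py z ≤ py y → In y → T y ≡ nothing → y ≢ x → T z ≡ nothing × z ≢ x)

  data GStep (T : Filling r c) : Filling r c → Set where
    diag  : ∀ x k T′ → GCor T x → GSlide T x T′ (dbox k) → GStep T (upd T′ (dbox k) (Maybe.map bump (T (dbox k))))
    other : ∀ x f T′ → GCor T x → GSlide T x T′ f → (∀ k → dbox k ≢ f) → GStep T T′

  data GRun : Filling r c → Filling r c → Set where
    done : ∀ {T} → FilledExactly T In → GRun T T
    more : ∀ {T T′ T″} → ¬ FilledExactly T In → GStep T T′ → GRun T′ T″ → GRun T T″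

  GOutput : Filling r c → Set
  GOutput T = ∃ λ T₀ → Init dbox init T₀ × GRun T₀ T

module Play {r c ν m} (G : Game r c ν m) where
  open Game G
  open Per P hiding (val)
  open Tableau.Region P m Y Y-dec Y<m public

  record Rep (T : Filling r c) (R C ê : ℕ → ℕ) : Set where
    field
      to   : ∀ {y v} → T y ≡ just v → ∃ λ u → u ≤ ê u × v ≡ enc u × R u ≡ px y × C u ≡ py y
      from : ∀ {u} → u ≤ ê u → ∃ λ y → T y ≡ just (enc u) × px y ≡ R u × py y ≡ C u
  open Rep

  RepH : ∀ {I} → Filling r c → HConf ρ cy I → Set
  RepH T c = Rep T (HConf.R c) (HConf.C c) (HConf.ê c)

  RepS : ∀ {I} → Filling r c → State ρ cy I → Set
  RepS T S = Rep T (State.R S) (State.C S) (State.ê S)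

  not-just : ∀ {T : Filling r c} {y v} → T y ≡ nothing → T y ≡ just v → ⊥
  not-just p q = case trans (sym p) q of λ ()

  rep-move : ∀ {T R C ê R′ C′ x y u} → Rep T R C ê → u ≤ ê u → R u ≡ px y → C u ≡ py y →
             (∀ {u′} → u′ ≤ ê u′ → ¬ At (px x) (py x) (R u′) (C u′)) →
             (∀ {u′} → u′ ≤ ê u′ → R u′ ≡ R u → C u′ ≡ C u → u′ ≡ u) →
             (∀ {u′} → u′ ≢ u → R′ u′ ≡ R u′) → (∀ {u′} → u′ ≢ u → C′ u′ ≡ C u′) → R′ u ≡ px x → C′ u ≡ py x →
             Rep (upd (upd T x (just (enc u))) y nothing) R′ C′ ê
  rep-move {T} {R} {C} {ê} {R′} {C′} {x} {y} {u} rep pu ru cu hole sm oR oC nR nC = record { to = to′ ; from = from′ }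
    where
    T₁ = upd T x (just (enc u))
    x≢y : x ≢ y
    x≢y refl = hole pu (ru , cu)
    to′ : ∀ {z v} → upd T₁ y nothing z ≡ just v → ∃ λ u′ → u′ ≤ ê u′ × v ≡ enc u′ × R′ u′ ≡ px z × C′ u′ ≡ py z
    to′ {z} {v} h with z ≟B y | z ≟B x
    ... | no _ | yes refl = u , pu , sym (just-injective h) , nR , nC
    ... | no ny | no _ = let (u′ , pu′ , e , r , s) = to rep h
                             ne : u′ ≢ u
                             ne = λ q → ny (p-inj (trans (sym r) (trans (cong R q) ru)) (trans (sym s) (trans (cong C q) cu)))
                         in u′ , pu′ , e , trans (oR ne) r , trans (oC ne) s
    from′ : ∀ {u′} → u′ ≤ ê u′ → ∃ λ z → upd T₁ y nothing z ≡ just (enc u′) × px z ≡ R′ u′ × py z ≡ C′ u′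
    from′ {u′} pu′ with u′ ≟ u
    ... | yes refl = x , trans (upd-off T₁ x≢y) (upd-at T x _) , sym nR , sym nC
    ... | no ne = let (z , tz , r , s) = from rep pu′
                      zy : z ≢ y
                      zy = λ q → ne (sm pu′ (trans (sym r) (trans (cong px q) (sym ru))) (trans (sym s) (trans (cong py q) (sym cu))))
                      zx : z ≢ x
                      zx = λ q → hole pu′ (trans (sym r) (cong px q) , trans (sym s) (cong py q))
                  in z , trans (upd-off T₁ zy) (trans (upd-off T zx) tz) , trans r (sym (oR ne)) , trans s (sym (oC ne))

  module _ {I} {T : Filling r c} {x} (h : HConf ρ cy I) (rep : RepH T h) (hx : HConf.ha h ≡ px x) (hy : HConf.hb h ≡ py x) where
    open HConf h

    private
      hole : ∀ {u} → Pres u → ¬ At (px x) (py x) (R u) (C u)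
      hole pu (p , q) = notH pu (trans p (sym hx) , trans q (sym hy))

    rep-down : ∀ {y u} (pu : Pres u) (ru : R u ≡ suc ha) (cu : C u ≡ hb) mn → R u ≡ px y → C u ≡ py y →
               RepH (upd (upd T x (just (enc u))) y nothing) (Down.moved D h u pu ru cu mn)
    rep-down {y} {u} pu ru cu mn ry cy′ = rep-move rep pu ry cy′ hole (λ pu′ r s → same pu′ pu r s)
      (⟨⟩-≢ R u ha) (λ _ → refl) (trans (⟨⟩-≡ R u ha) hx) (trans cu hy)

    rep-right : ∀ {y u} (pu : Pres u) (cu : C u ≡ suc hb) (ru : R u ≡ ha) mn → R u ≡ px y → C u ≡ py y →
                RepH (upd (upd T x (just (enc u))) y nothing) (trH (Down.moved (trD D) (trH h) u pu cu ru mn))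
    rep-right {y} {u} pu cu ru mn ry cy′ = rep-move rep pu ry cy′ hole (λ pu′ r s → same pu′ pu r s)
      (λ _ → refl) (⟨⟩-≢ C u hb) (trans ru hx) (trans (⟨⟩-≡ C u hb) hy)

  rep-refill : ∀ {I T g} (h : HConf ρ cy I) z az bz → RepH T h → HConf.ha h ≡ px g → HConf.hb h ≡ py g →
               Rep (upd T g (just (enc (Refill.nu D h z az bz)))) (HConf.R h) (HConf.C h) (Refill.ê′ D h z az bz)
  rep-refill {T = T} {g} h z az bz rep hg hg′ = record { to = to′ ; from = from′ }
    where
    open HConf h
    open Refill D h z az bz
    T₂ = upd T g (just (enc nu))
    to′ : ∀ {y v} → T₂ y ≡ just v → ∃ λ u → u ≤ ê′ u × v ≡ enc u × R u ≡ px y × C u ≡ py y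
    to′ {y} {v} e with y ≟B g
    ... | yes refl = nu , ≤-reflexive (sym (trans (ê′-t cxnu) (cong (_+ suc ν) ênu))) , sym (just-injective e) , trans Rnu (trans (sym az) hg) , trans Cnu (trans (sym bz) hg′)
    ... | no ne = let (u , pu , rest) = to rep e in u , ≤-trans pu (ê≤ê′ u) , rest
    from′ : ∀ {u} → u ≤ ê′ u → ∃ λ y → T₂ y ≡ just (enc u) × px y ≡ R u × py y ≡ C u
    from′ {u} p with old? p
    ... | inj₂ refl = g , upd-at T g _ , sym (trans Rnu (trans (sym az) hg)) , sym (trans Cnu (trans (sym bz) hg′))
    ... | inj₁ pu = let (y , ty , r , s) = from rep pu
                        ne : y ≢ g
                        ne = λ q → notH pu (trans (sym r) (trans (cong px q) (sym hg)) , trans (sym s) (trans (cong py q) (sym hg′)))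
                    in y , trans (upd-off T ne) ty , r , s

  slide→ : ∀ {I T x T′ g} (h : HConf ρ cy I) → (∀ u → HConf.ê h u < m * n) → RepH T h → HConf.ha h ≡ px x → HConf.hb h ≡ py x →
           GSlide T x T′ g → ∃ λ h′ → Moves D h h′ × RepH T′ h′ × AtDiag D h′ × HConf.ha h′ ≡ px g × HConf.hb h′ ≡ py g
  slide→ {T = T} {x} h bd rep hx hy (stop none) = h , here , rep , exits D h dd dr , hx , hy
    where
    open HConf h
    dd : ¬ Dom ρ cy (suc ha) hb
    dd d = let (u , pu , ru , cu) = fill d (λ i → hI (I-down i (n≤1+n ha) ≤-refl)) (λ (p , _) → 1+n≢n p)
               (y , ty , p , q) = from rep pu
           in none y (⇒F (inj₁ (trans p (trans ru (cong suc hx)) , trans q (trans cu hy)))) (_ , ty)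
    dr : ¬ Dom ρ cy ha (suc hb)
    dr d = let (u , pu , ru , cu) = fill d (λ i → hI (I-down i ≤-refl (n≤1+n hb))) (λ (_ , p) → 1+n≢n p)
               (y , ty , p , q) = from rep pu
           in none y (⇒F (inj₂ (trans p (trans ru hx) , trans q (trans cu (cong suc hy))))) (_ , ty)
  slide→ {T = T} {x} h bd rep hx hy (step y v fxy ty mn sl) with to rep ty
  ... | u , pu , refl , ru , cu with F⇒ fxy
  ... | inj₁ (p , q) =
    let (h′ , mv , rep′ , rest) = slide→ (Down.moved D h u pu rv cv mn′) bd (rep-down h rep hx hy pu rv cv mn′ ru cu) (trans (cong suc hx) (sym p)) (trans hy (sym q)) sl
    in h′ , down u pu rv cv mn′ mv , rep′ , rest
    where
    open HConf h
    rv = trans ru (trans p (cong suc (sym hx)))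
    cv = trans cu (trans q (sym hy))
    mn′ : ∀ u′ → Pres u′ → R u′ ≡ ha → C u′ ≡ suc hb → u ≤ u′
    mn′ u′ pu′ ru′ cu′ = let (z , tz , pz , qz) = from rep pu′
                         in ≤-enc (≤-<-trans pu (bd u)) (≤-<-trans pu′ (bd u′)) (mn z (enc u′) (⇒F (inj₂ (trans pz (trans ru′ hx) , trans qz (trans cu′ (cong suc hy))))) tz)
  ... | inj₂ (p , q) =
    let (h′ , mv , rep′ , rest) = slide→ (trH (Down.moved (trD D) (trH h) u pu cv rv mn′)) bd (rep-right h rep hx hy pu cv rv mn′ ru cu) (trans hx (sym p)) (trans (cong suc hy) (sym q)) sl
    in h′ , right u pu cv rv mn′ mv , rep′ , rest
    where
    open HConf h
    rv = trans ru (trans p (sym hx))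
    cv = trans cu (trans q (cong suc (sym hy)))
    mn′ : ∀ u′ → Pres u′ → C u′ ≡ hb → R u′ ≡ suc ha → u ≤ u′
    mn′ u′ pu′ cu′ ru′ = let (z , tz , pz , qz) = from rep pu′
                         in ≤-enc (≤-<-trans pu (bd u)) (≤-<-trans pu′ (bd u′)) (mn z (enc u′) (⇒F (inj₁ (trans pz (trans ru′ (cong suc hx)) , trans qz (trans cu′ hy)))) tz)

  -- Slides are relations, so the existence of an output needs this direction: the moves of the
  -- configuration prescribe a path in the filling.
  slide← : ∀ {I T x} {h h′ : HConf ρ cy I} → (∀ u → HConf.ê h u < m * n) → RepH T h → HConf.ha h ≡ px x → HConf.hb h ≡ py x →
           Moves D h h′ → AtDiag D h′ → ∃ λ T′ → ∃ λ g → GSlide T x T′ g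
  slide← {T = T} {x} {h} bd rep hx hy here (z , az , bz) = T , x , stop blocked
    where
    open HConf h
    open Diag D
    blocked : ∀ y → F x y → ¬ Filled T y
    blocked y fxy (v , ty) with to rep ty | F⇒ fxy
    ... | u , pu , _ , ru , cu | inj₁ (p , q) = <⇒≱ (xy {z} {u} (<-≤-trans (≤-reflexive (trans (cong suc (trans (sym az) hx)) (sym (trans ru p)))) (R≤ u)))
            (≤-trans (≤-reflexive (trans (sym bz) (trans hy (sym (trans cu q))))) (C≤ u))
    ... | u , pu , _ , ru , cu | inj₂ (p , q) = <⇒≱ (yx {z} {u} (<-≤-trans (≤-reflexive (trans (cong suc (trans (sym bz) hy)) (sym (trans cu q)))) (C≤ u)))
            (≤-trans (≤-reflexive (trans (sym az) (trans hx (sym (trans ru p))))) (R≤ u))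
  slide← {T = T} {x} {h} bd rep hx hy (down u pu rv cv mn mv) dg =
    let (T′ , g , sl) = slide← bd (rep-down h rep hx hy pu rv cv mn (sym py′) (sym qy)) (trans (sym rv) (sym py′)) (trans (sym cv) (sym qy)) mv dg
    in T′ , g , step y (enc u) (⇒F (inj₁ (trans py′ (trans rv (cong suc hx)) , trans qy (trans cv hy)))) ty mn′ sl
    where
    open HConf h
    fr = from rep pu
    y = proj₁ fr
    ty = proj₁ (proj₂ fr)
    py′ = proj₁ (proj₂ (proj₂ fr))
    qy = proj₂ (proj₂ (proj₂ fr))
    mn′ : ∀ z v → F x z → T z ≡ just v → enc u ⊴ v
    mn′ z v fxz tz with to rep tz
    ... | u′ , pu′ , refl , ru′ , cu′ = enc-≤ (≤-<-trans pu (bd u)) (≤-<-trans pu′ (bd u′)) (case F⇒ fxz of λ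
      { (inj₁ (p , q)) → ≤-reflexive (same pu pu′ (trans rv (trans (cong suc hx) (sym (trans ru′ p)))) (trans cv (trans hy (sym (trans cu′ q)))))
      ; (inj₂ (p , q)) → mn u′ pu′ (trans ru′ (trans p (sym hx))) (trans cu′ (trans q (cong suc (sym hy)))) })
  slide← {T = T} {x} {h} bd rep hx hy (right u pu cv rv mn mv) dg =
    let (T′ , g , sl) = slide← bd (rep-right h rep hx hy pu cv rv mn (sym py′) (sym qy)) (trans (sym rv) (sym py′)) (trans (sym cv) (sym qy)) mv dg
    in T′ , g , step y (enc u) (⇒F (inj₂ (trans py′ (trans rv hx) , trans qy (trans cv (cong suc hy))))) ty mn′ sl
    where
    open HConf h
    fr = from rep pu
    y = proj₁ fr
    ty = proj₁ (proj₂ fr)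
    py′ = proj₁ (proj₂ (proj₂ fr))
    qy = proj₂ (proj₂ (proj₂ fr))
    mn′ : ∀ z v → F x z → T z ≡ just v → enc u ⊴ v
    mn′ z v fxz tz with to rep tz
    ... | u′ , pu′ , refl , ru′ , cu′ = enc-≤ (≤-<-trans pu (bd u)) (≤-<-trans pu′ (bd u′)) (case F⇒ fxz of λ
      { (inj₂ (p , q)) → ≤-reflexive (same pu pu′ (trans rv (trans hx (sym (trans ru′ p)))) (trans cv (trans (cong suc hy) (sym (trans cu′ q)))))
      ; (inj₁ (p , q)) → mn u′ pu′ (trans cu′ (trans q (sym hy))) (trans ru′ (trans p (cong suc (sym hx)))) })

  Y<m′ : ∀ {a} → a ≤ ν → Y a < m
  Y<m′ l = ≤-<-trans (Y-anti z≤n l) Y<m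

  Dom-box : ∀ {a j} → Dom ρ cy a j → ∃ λ x → px x ≡ a × py x ≡ j × In x
  Dom-box d = let (l , p) = Dom⇒ d ; (x , ex , ey) = box l (≤-<-trans p (Y<m′ l)) in x , ex , ey , ⇒In (≤-trans (≤-reflexive ey) (≤-trans p (≤-reflexive (cong Y (sym ex)))))

  In-Dom : ∀ {x} → In x → Dom ρ cy (px x) (py x)
  In-Dom {x} i = ⇒Dom (px≤ x) (In⇒ i)

  at-diag : ∀ {g z} → ρ z ≡ px g → cy z ≡ py g → ∃ λ k → dbox k ≡ g
  at-diag {g} {z} p q = let (k , e) = b-at (px≤ g) in k , p-inj e (trans (b-Y k) (trans (cong Y (trans e (sym p))) q))

  record Stage (T : Filling r c) (f : ℕ → ℕ) : Set where
    field
      S   : State ρ cy (Under f)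
      sub : ∀ {a j} → Under f a j → Dom ρ cy a j
      rep : RepS T S

  module _ {T f} (st : Stage T f) where
    open Stage st
    open State S

    empty⇒ : ∀ {y} → In y → T y ≡ nothing → Under f (px y) (py y)
    empty⇒ {y} i e = ≰⇒> λ le → let (u , pu , ru , cu) = fill (In-Dom i) (≤⇒≯ le) (λ ()) ; (y′ , ty , p , q) = from rep pu
                                in not-just {T} e (subst (λ z → T z ≡ just (enc u)) (p-inj (trans p ru) (trans q cu)) ty)

    ⇒empty : ∀ {y} → Under f (px y) (py y) → T y ≡ nothing
    ⇒empty {y} l with T y in eq
    ... | nothing = refl
    ... | just v = let (u , pu , _ , ru , cu) = to rep eq in ⊥-elim (notI pu (subst₂ (Under f) (sym ru) (sym cu) l))

    corner : ∀ {x} → GCor T x → Corner f (px x) (py x)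
    corner {x} (i , e , young) = ≤-antisym (≮⇒≥ λ l → bad l (λ q → 1+n≢n (proj₂ q)) ≤-refl (n≤1+n _)) (empty⇒ i e) ,
                                 ≮⇒≥ λ l → bad l (λ q → 1+n≢n (proj₁ q)) (n≤1+n _) ≤-refl
      where
      bad : ∀ {a j} → Under f a j → ¬ (a ≡ px x × j ≡ py x) → px x ≤ a → py x ≤ j → ⊥
      bad l ne p q = let (y , ya , yj , iy) = Dom-box (sub l)
                     in proj₂ (young y x (≤-trans p (≤-reflexive (sym ya))) (≤-trans q (≤-reflexive (sym yj))) iy (⇒empty (subst₂ (Under f) (sym ya) (sym yj) l))
                          λ { refl → ne (sym ya , sym yj) }) refl

    module _ {x} (co : GCor T x) where
      open Advance D S (corner co) (In-Dom (proj₁ co))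

      sub′ : ∀ {a j} → Under f′ a j → Dom ρ cy a j
      sub′ {a} l = sub (<-≤-trans l (f′≤f a))

      slide-exists : ∃ λ T′ → ∃ λ g → GSlide T x T′ g
      slide-exists = let (h , mv , dg) = slides D (ν + m) coords≤ (ν + m) opened (m≤m+n _ _)
                     in slide← (bounded sub S) rep refl refl mv dg

      refill : ∀ {T′ g} h′ (mv : Moves D opened h′) → RepH T′ h′ → (dg : AtDiag D h′) → HConf.ha h′ ≡ px g → HConf.hb h′ ≡ py g →
               (∃ λ k → dbox k ≡ g) × Stage (upd T′ g (Maybe.map bump (T g))) (f ⟨ px x ≔ py x ⟩)
      refill {T′} {g} h′ mv rep′ dg@(z , az , bz) hg hg′ = at-diag {g} {z} (trans (sym az) hg) (trans (sym bz) hg′) ,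
          record { S = after mv dg ; sub = sub′ ; rep = subst (λ v → Rep (upd T′ g v) Rₕ Cₕ ê′) (sym new) (rep-refill h′ z az bz rep′ hg hg′) }
        where
        open HConf h′ using () renaming (R to Rₕ; C to Cₕ)
        open Refill D h′ z az bz using (ê′; nu)
        -- The construction changes the entry that the box held before the slide, hence the state
        -- before the slide is consulted.
        old : T g ≡ just (enc (ê z))
        old = let (y , ty , p , q) = from rep (ê-pres z) ; dz = State.diag S z (λ ())
              in subst (λ t → T t ≡ just (enc (ê z))) (p-inj (trans p (trans (proj₁ dz) (trans (sym az) hg))) (trans q (trans (proj₂ dz) (trans (sym bz) hg′)))) ty
        unchanged : HConf.ê h′ z ≡ ê z
        unchanged = proj₂ (proj₂ (Moves-≼ D mv)) z
        new : Maybe.map bump (T g) ≡ just (enc nu)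
        new = trans (cong (Maybe.map bump) old) (cong just (trans (sym (enc-bump (ê z))) (cong (λ t → enc (t + suc ν)) (sym unchanged))))

      advance : ∀ {T′ g} → GSlide T x T′ g → (∃ λ k → dbox k ≡ g) × Stage (upd T′ g (Maybe.map bump (T g))) (f ⟨ px x ≔ py x ⟩)
      advance sl = let (h′ , mv , rep′ , dg , hg , hg′) = slide→ opened (bounded sub S) rep refl refl sl in refill h′ mv rep′ dg hg hg′

  run→ : ∀ {T f T″} → Stage T f → GRun T T″ → ∃ λ (S : State ρ cy ∅₂) → RepS T″ S
  run→ {T} {f} st (done ex) = mapI (λ l → void l) (λ ()) S , record { to = to rep ; from = from rep }
    where
    open Stage st
    void : ∀ {a j} → Under f a j → ⊥
    void l = let (y , ya , yj , iy) = Dom-box (sub l) in not-just {T} (⇒empty st (subst₂ (Under f) (sym ya) (sym yj) l)) (proj₂ (proj₂ (ex y) iy))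
  run→ st (more _ (diag x k T′ co sl) run) = run→ (proj₂ (advance st co sl)) run
  -- Every path ends on the diagonal, so this kind of step cannot occur.
  run→ st (more _ (other x g T′ co sl ne) run) = let ((k , e) , _) = advance st co sl in ⊥-elim (ne k e)

  initial : ∀ {T} → Init dbox init T → Stage T inner
  initial {T} (yes! , no!) = record { S = begin-state ; sub = λ {a} → inner-Dom {a} ; rep = record { to = to′ ; from = from′ } }
    where
    Tb : ∀ k → T (dbox k) ≡ just (enc (w (px (dbox k))))
    Tb k = trans (yes! k) (cong just (init≡ k))
    to′ : ∀ {y v} → T y ≡ just v → ∃ λ u → u ≤ u % n × v ≡ enc u × ρ u ≡ px y × cy u ≡ py y
    to′ {y} {v} ty with py y ≟ Y (px y)
    ... | no ne = ⊥-elim (not-just {T} (no! y λ { k refl → ne (b-Y k) }) ty)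
    ... | yes e with b-at (px≤ y)
    ... | k , ek with p-inj {dbox k} {y} ek (trans (b-Y k) (trans (cong Y ek) (sym e)))
    ... | refl = w (px y) , ≤-reflexive (sym (m<n⇒m%n≡m (w< (px≤ y)))) , just-injective (trans (sym ty) (Tb k)) , ρw (px≤ y) , trans (cong Y (ρw (px≤ y))) (sym e)
    from′ : ∀ {u} → u ≤ u % n → ∃ λ y → T y ≡ just (enc u) × px y ≡ ρ u × py y ≡ cy u
    from′ {u} p = let (k , ek) = b-at (ρ≤ u)
                  in dbox k , trans (Tb k) (cong (just ∘ enc) (trans (cong w ek) (trans (sym (%≡w u)) (≤-antisym (m%n≤m u n) p)))) , ek , trans (b-Y k) (cong Y ek)

  final : ∀ {T} → GOutput T → ∃ λ (S : State ρ cy ∅₂) → RepS T S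
  final (T₀ , i , run) = run→ (initial i) run

  T₀ : Filling r c
  T₀ y = if is (py y) (Y (px y)) then just (enc (w (px y))) else nothing

  T₀-init : Init dbox init T₀
  T₀-init = (λ k → trans (cong (λ z → if z then just (enc (w (px (dbox k)))) else nothing) (is-t (b-Y k))) (cong just (sym (init≡ k)))) ,
            λ x h → cong (λ z → if z then just (enc (w (px x))) else nothing) (is-f λ e → let (k , ek) = b-at (px≤ x) in h k (p-inj ek (trans (b-Y k) (trans (cong Y ek) (sym e)))))

  diag-step : ∀ {T x T′ g} → GCor T x → GSlide T x T′ g → (∃ λ k → dbox k ≡ g) → GStep T (upd T′ g (Maybe.map bump (T g)))
  diag-step co sl (k , refl) = diag _ k _ co sl

  output-exists : ∃ GOutput
  output-exists = let (f , z , T , st , k) = peel Q next (suc ν) inner (λ x l → cong (λ t → if t then 0 else Y x) (lt-t l)) (T₀ , initial T₀-init , id)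
                  in T , T₀ , T₀-init , k (done λ y → filled-In st , λ i → In-filled z st i)
    where
    Q : (ℕ → ℕ) → Set
    -- Boxes are filled at the end of the run, while `GRun` is composed from its front; the
    -- continuation mediates.
    Q f = ∃ λ T → Stage T f × (∀ {T″} → GRun T T″ → GRun T₀ T″)
    filled-In : ∀ {T f y} → Stage T f → Filled T y → In y
    filled-In st (v , ty) = let (u , pu , _ , ru , cu) = to (Stage.rep st) ty
                            in ⇒In (proj₂ (Dom⇒ (subst₂ (Dom ρ cy) ru cu (u , State.R≤ (Stage.S st) u , State.C≤ (Stage.S st) u))))
    In-filled : ∀ {T f y} → (∀ x → f x ≡ 0) → Stage T f → In y → Filled T y
    In-filled {T} {f} {y} z st i with T y in eq
    ... | just v = v , refl
    ... | nothing = ⊥-elim (n≮0 (<-≤-trans (empty⇒ st i eq) (≤-reflexive (z (px y)))))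
    next′ : ∀ {f T x} → In x → Stage T f → (∀ {T″} → GRun T T″ → GRun T₀ T″) → Corner f (px x) (py x) → Q (f ⟨ px x ≔ py x ⟩)
    next′ {f} {T} {x} ix st k (fa , fs) = _ , proj₂ adv , λ run → k (more (λ ex → not-just {T} ex₀ (proj₂ (proj₂ (ex x) ix))) (diag-step co sl (proj₁ adv)) run)
      where
      open Stage st
      ex₀ : T x ≡ nothing
      ex₀ = ⇒empty st (≤-reflexive (sym fa))
      eq : ∀ y → Under f (px y) (py y) → px x ≤ px y → py x ≤ py y → y ≡ x
      eq y uy p q = p-inj ey₁ (≤-antisym (s≤s⁻¹ (≤-trans uy (≤-reflexive (trans (cong f ey₁) fa)))) q)
        where
        ey₁ : px y ≡ px x
        ey₁ = ≤-antisym (≮⇒≥ λ l → <⇒≱ (State.I-down S uy l q) fs) p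
      co : GCor T x
      co = ix , ex₀ , λ y z p q iy ey ne → let uy = empty⇒ st iy ey in ⇒empty st (State.I-down S uy p q) , λ { refl → ne (eq y uy p q) }
      sl = proj₂ (proj₂ (slide-exists st co))
      adv = advance st co sl
    next : ∀ f a j → Corner f a j → Q f → Q (f ⟨ a ≔ j ⟩)
    next f a j co (T , st , k) = let (x , ex , ey , ix) = Dom-box (Stage.sub st {a} {j} (≤-reflexive (sym (proj₁ co))))
                                 in subst₂ (λ a j → Corner f a j → Q (f ⟨ a ≔ j ⟩)) ex ey (next′ ix st k) co

-- Coordinates of the rectangle and the two games on it

mkPer : ∀ {ν} (ω inv : ℕ → ℕ) → (∀ i → ω i ≤ ν) → (∀ x → inv x ≤ ν) → (∀ {i} → i ≤ ν → inv (ω i) ≡ i) →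
        (∀ {x} → x ≤ ν → ω (inv x) ≡ x) → Per ν (λ u → inv (u % suc ν))
mkPer {ν} ω inv ω≤ inv≤ inv-ω ω-inv = record
  { ρ≤ = λ u → inv≤ (u % n) ; ρ-per = λ u → cong inv ([m+n]%n≡m%n u n)
  ; ρ-inj = λ {u} {v} l l′ q → distinct l l′ (trans (sym (ω-inv (%≤ u))) (trans (cong ω q) (ω-inv (%≤ v))))
  ; w = ω ; w< = λ {i} _ → s≤s (ω≤ i) ; ρw = λ {i} l → trans (cong inv (m<n⇒m%n≡m (s≤s (ω≤ i)))) (inv-ω l) }
  where
  n = suc ν
  %≤ : ∀ u → u % n ≤ ν
  %≤ u = s≤s⁻¹ (m%n<n u n)
  distinct : ∀ {u v} → u < v → v < u + n → u % n ≢ v % n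
  distinct {u} {v} l l′ q = <⇒≱ l′ (begin
    u + n ≡⟨ cong (_+ n) (m≡m%n+[m/n]*n u n) ⟩
    u % n + u / n * n + n ≡⟨ trans (+-assoc (u % n) _ n) (cong₂ _+_ q (+-comm (u / n * n) n)) ⟩
    v % n + suc (u / n) * n ≤⟨ +-monoʳ-≤ (v % n) (*-monoˡ-≤ n u/<v/) ⟩
    v % n + v / n * n ≡⟨ sym (m≡m%n+[m/n]*n v n) ⟩
    v ∎)
    where
    open ≤-Reasoning
    u/<v/ : u / n < v / n
    u/<v/ = ≰⇒> λ le → <⇒≱ l (subst₂ _≤_ (sym (m≡m%n+[m/n]*n v n)) (sym (m≡m%n+[m/n]*n u n)) (+-mono-≤ (≤-reflexive (sym q)) (*-monoˡ-≤ n le)))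

fin : ∀ {ν} → ℕ → Fin (suc ν)
fin {ν} i = fromℕ< (m%n<n i (suc ν))

toℕ-fin : ∀ {ν i} → i ≤ ν → toℕ (fin {ν} i) ≡ i
toℕ-fin l = trans (Fin.toℕ-fromℕ< _) (m<n⇒m%n≡m (s≤s l))

fin-toℕ : ∀ {ν} (k : Fin (suc ν)) → fin (toℕ k) ≡ k
fin-toℕ k = Fin.toℕ-injective (toℕ-fin (Fin.toℕ≤pred[n] k))

-- `ν + 1` strictly decreasing numbers from 0 to `ν` leave no choice. This fixes the coordinate `A`
-- of the boxes of any diagonal.
decreasing : ∀ {ν} (g : ℕ → ℕ) → (∀ {i} → suc i ≤ ν → g (suc i) < g i) → g 0 ≤ ν → ∀ {i} → i ≤ ν → g i ≡ ν ∸ i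
decreasing {ν} g dec g0 {i} l = ≤-antisym (m+n≤o⇒m≤o∸n (g i) (≤-trans (from-start i l) g0)) (from-end (ν ∸ i) i (m+[n∸m]≡n l))
  where
  from-start : ∀ i → i ≤ ν → g i + i ≤ g 0
  from-start zero l = ≤-reflexive (+-identityʳ (g 0))
  from-start (suc i) l = ≤-trans (≤-reflexive (+-suc (g (suc i)) i)) (≤-trans (+-monoˡ-≤ i (dec l)) (from-start i (<⇒≤ l)))
  from-end : ∀ d i → i + d ≡ ν → d ≤ g i
  from-end zero i e = z≤n
  from-end (suc d) i e = ≤-trans (s≤s (from-end d (suc i) e′)) (dec (≤-trans (m≤m+n (suc i) d) (≤-reflexive e′)))
    where e′ = trans (sym (+-suc i d)) e

-- The coordinate A takes every value exactly once on a diagonal; it is the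
-- row if R has n rows and the column if R has n columns.
record Axes (r c ν μ : ℕ) : Set where
  field
    A B : Box r c → ℕ
    A≤ : ∀ x → A x ≤ ν
    B≤ : ∀ x → B x ≤ μ
    ax-inj : ∀ {x y} → A x ≡ A y → B x ≡ B y → x ≡ y
    ax-box : ∀ {a j} → a ≤ ν → j ≤ μ → ∃ λ x → A x ≡ a × B x ≡ j
    fwd⇒ : ∀ {x y} → Fwd x y → (A y ≡ suc (A x) × B y ≡ B x) ⊎ (A y ≡ A x × B y ≡ suc (B x))
    ⇒fwd : ∀ {x y} → (A y ≡ suc (A x) × B y ≡ B x) ⊎ (A y ≡ A x × B y ≡ suc (B x)) → Fwd x y
    le⇒ : ∀ {x y : Box r c} → toℕ (Defs.row x) ≤ toℕ (Defs.row y) → toℕ (Defs.col x) ≤ toℕ (Defs.col y) → A x ≤ A y × B x ≤ B y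
    ⇒le : ∀ {x y : Box r c} → A x ≤ A y → B x ≤ B y → toℕ (Defs.row x) ≤ toℕ (Defs.row y) × toℕ (Defs.col x) ≤ toℕ (Defs.col y)
    σ : Fin (suc ν) → ℕ
    τ : ℕ → Fin (suc ν)
    σ≤ : ∀ k → σ k ≤ ν
    σ-τ : ∀ {a} → a ≤ ν → σ (τ a) ≡ a
    τ-σ : ∀ k → τ (σ k) ≡ k
    diag-A : ∀ (d : Diagonal r c (suc ν)) k → A (b d k) ≡ σ k
    diag-B : ∀ (d : Diagonal r c (suc ν)) {i} → suc i ≤ ν → B (b d (τ (suc i))) < B (b d (τ i))
    size : r * c ≡ suc μ * suc ν

rowAxes : ∀ ν μ → Axes (suc ν) (suc μ) ν μ
rowAxes ν μ = record
  { A = toℕ ∘ proj₁ ; B = toℕ ∘ proj₂ ; A≤ = λ x → Fin.toℕ≤pred[n] (proj₁ x) ; B≤ = λ x → Fin.toℕ≤pred[n] (proj₂ x)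
  ; ax-inj = λ p q → cong₂ _,_ (Fin.toℕ-injective p) (Fin.toℕ-injective q)
  ; ax-box = λ l l′ → (fromℕ< (s≤s l) , fromℕ< (s≤s l′)) , Fin.toℕ-fromℕ< (s≤s l) , Fin.toℕ-fromℕ< (s≤s l′)
  ; fwd⇒ = λ { (inj₁ (p , q)) → inj₂ (cong toℕ p , q) ; (inj₂ (p , q)) → inj₁ (p , cong toℕ q) }
  ; ⇒fwd = λ { (inj₁ (p , q)) → inj₂ (p , Fin.toℕ-injective q) ; (inj₂ (p , q)) → inj₁ (Fin.toℕ-injective p , q) }
  ; le⇒ = _,_ ; ⇒le = _,_
  ; σ = λ k → ν ∸ toℕ k ; τ = λ a → fin (ν ∸ a) ; σ≤ = λ k → m∸n≤m ν (toℕ k)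
  ; σ-τ = λ {a} l → trans (cong (ν ∸_) (toℕ-fin (m∸n≤m ν a))) (m∸[m∸n]≡n l)
  ; τ-σ = λ k → trans (cong fin (m∸[m∸n]≡n (Fin.toℕ≤pred[n] k))) (fin-toℕ k)
  ; diag-A = λ d k → trans (cong (λ k → toℕ (proj₁ (b d k))) (sym (fin-toℕ k)))
      (decreasing (λ i → toℕ (proj₁ (b d (fin i)))) (λ l → proj₁ (staircase d _ _ (next l))) (Fin.toℕ≤pred[n] (proj₁ (b d (fin 0)))) (Fin.toℕ≤pred[n] k))
  ; diag-B = λ d {i} l → proj₂ (staircase d (fin (ν ∸ suc i)) (fin (ν ∸ i)) (trans (toℕ-fin (m∸n≤m ν i)) (trans (∸-suc′ l) (cong suc (sym (toℕ-fin (m∸n≤m ν (suc i))))))))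
  ; size = *-comm (suc ν) (suc μ) }
  where
  next : ∀ {i} → suc i ≤ ν → toℕ (fin {ν} (suc i)) ≡ suc (toℕ (fin {ν} i))
  next l = trans (toℕ-fin l) (cong suc (sym (toℕ-fin (<⇒≤ l))))

colAxes : ∀ ν μ → Axes (suc μ) (suc ν) ν μ
colAxes ν μ = record
  { A = toℕ ∘ proj₂ ; B = toℕ ∘ proj₁ ; A≤ = λ x → Fin.toℕ≤pred[n] (proj₂ x) ; B≤ = λ x → Fin.toℕ≤pred[n] (proj₁ x)
  ; ax-inj = λ p q → cong₂ _,_ (Fin.toℕ-injective q) (Fin.toℕ-injective p)
  ; ax-box = λ l l′ → (fromℕ< (s≤s l′) , fromℕ< (s≤s l)) , Fin.toℕ-fromℕ< (s≤s l) , Fin.toℕ-fromℕ< (s≤s l′)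
  ; fwd⇒ = λ { (inj₁ (p , q)) → inj₁ (q , cong toℕ p) ; (inj₂ (p , q)) → inj₂ (cong toℕ q , p) }
  ; ⇒fwd = λ { (inj₁ (p , q)) → inj₁ (Fin.toℕ-injective q , p) ; (inj₂ (p , q)) → inj₂ (q , Fin.toℕ-injective p) }
  ; le⇒ = λ p q → q , p ; ⇒le = λ p q → q , p
  ; σ = toℕ ; τ = fin ; σ≤ = Fin.toℕ≤pred[n]
  ; σ-τ = toℕ-fin ; τ-σ = fin-toℕ
  ; diag-A = λ d k → trans (cong (λ k → toℕ (proj₂ (b d k))) (sym (trans (cong fin (m∸[m∸n]≡n (Fin.toℕ≤pred[n] k))) (fin-toℕ k))))
      (trans (decreasing (λ i → toℕ (proj₂ (b d (fin (ν ∸ i))))) (λ {i} l → proj₂ (staircase d _ _ (trans (toℕ-fin (m∸n≤m ν i)) (trans (∸-suc′ l) (cong suc (sym (toℕ-fin (m∸n≤m ν (suc i)))))))))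
         (Fin.toℕ≤pred[n] (proj₂ (b d (fin ν)))) (m∸n≤m ν (toℕ k))) (m∸[m∸n]≡n (Fin.toℕ≤pred[n] k)))
  ; diag-B = λ d {i} l → proj₁ (staircase d (fin i) (fin (suc i)) (trans (toℕ-fin l) (cong suc (sym (toℕ-fin (<⇒≤ l))))))
  ; size = refl }

module _ {r c : ℕ} where

  ∈ₛ-young : ∀ (s : Shape r c) {x y : Box r c} → toℕ (Defs.row y) ≤ toℕ (Defs.row x) → toℕ (Defs.col y) ≤ toℕ (Defs.col x) → x ∈ₛ s → y ∈ₛ s
  ∈ₛ-young s {x} {y} p q l = ≤-<-trans q (<-≤-trans l (antitone s (Defs.row y) (Defs.row x) p))

module Words {r c ν μ} (ax : Axes r c ν μ) (π : Permutation (suc ν) (suc ν)) where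
  open Axes ax

  ω inv : ℕ → ℕ
  ω a = toℕ (π ⟨$⟩ʳ τ a)
  inv x = σ (π ⟨$⟩ˡ fin x)

  ω≤ : ∀ a → ω a ≤ ν
  ω≤ a = Fin.toℕ≤pred[n] (π ⟨$⟩ʳ τ a)

  inv≤ : ∀ x → inv x ≤ ν
  inv≤ x = σ≤ (π ⟨$⟩ˡ fin x)

  inv-ω : ∀ {i} → i ≤ ν → inv (ω i) ≡ i
  inv-ω {i} l = trans (cong (λ z → σ (π ⟨$⟩ˡ z)) (fin-toℕ (π ⟨$⟩ʳ τ i))) (trans (cong σ (inverseˡ π)) (σ-τ l))

  ω-inv : ∀ {x} → x ≤ ν → ω (inv x) ≡ x
  ω-inv {x} l = trans (cong (λ z → toℕ (π ⟨$⟩ʳ z)) (τ-σ (π ⟨$⟩ˡ fin x))) (trans (cong toℕ (inverseʳ π)) (toℕ-fin l))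

  P⁺ : Per ν (λ u → inv (u % suc ν))
  P⁺ = mkPer ω inv ω≤ inv≤ inv-ω ω-inv

  -- The rotation reverses the order of the classes and counts entries from the largest downwards,
  -- so the permutation becomes its reverse complement.
  P⁻ : Per ν (λ u → ν ∸ inv (ν ∸ u % suc ν))
  P⁻ = mkPer (λ i → ν ∸ ω (ν ∸ i)) (λ x → ν ∸ inv (ν ∸ x)) (λ i → m∸n≤m ν (ω (ν ∸ i))) (λ x → m∸n≤m ν (inv (ν ∸ x)))
    (λ {i} l → trans (cong (λ z → ν ∸ inv z) (m∸[m∸n]≡n (ω≤ (ν ∸ i)))) (trans (cong (ν ∸_) (inv-ω (m∸n≤m ν i))) (m∸[m∸n]≡n l)))
    (λ {x} l → trans (cong (λ z → ν ∸ ω z) (m∸[m∸n]≡n (inv≤ (ν ∸ x)))) (trans (cong (ν ∸_) (ω-inv (m∸n≤m ν x))) (m∸[m∸n]≡n l)))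

  module OnDiagonal (d : Diagonal r c (suc ν)) where

    Y : ℕ → ℕ
    Y a = B (b d (τ a))

    young : ∀ (s : Shape r c) {x y} → A y ≤ A x → B y ≤ B x → x ∈ₛ s → y ∈ₛ s
    young s p q = let (p′ , q′) = ⇒le p q in ∈ₛ-young s p′ q′

    A-b : ∀ {a} → a ≤ ν → A (b d (τ a)) ≡ a
    A-b {a} l = trans (diag-A d (τ a)) (σ-τ l)

    B-b : ∀ k → B (b d k) ≡ Y (A (b d k))
    B-b k = cong (λ z → B (b d z)) (sym (trans (cong τ (diag-A d k)) (τ-σ k)))

    skew-Y : ∀ {x} → x ∈ₛ upper d → ¬ (x ∈ₛ lower d) → B x ≡ Y (A x)
    skew-Y {x} i ni = let (k , e) = skew-in-b d x i ni in subst (λ z → B z ≡ Y (A z)) e (B-b k)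

    upper⇐ : ∀ {x} → B x ≤ Y (A x) → x ∈ₛ upper d
    upper⇐ {x} l = young (upper d) (≤-reflexive (sym (A-b (A≤ x)))) l (proj₁ (b-in-skew d (τ (A x))))

    lower⇒ : ∀ {x} → x ∈ₛ lower d → B x < Y (A x)
    lower⇒ {x} i = ≰⇒> λ l → proj₂ (b-in-skew d (τ (A x))) (young (lower d) (≤-reflexive (A-b (A≤ x))) l i)

    upper⇒ : ∀ {x} → x ∈ₛ upper d → B x ≤ Y (A x)
    upper⇒ {x} i with toℕ (Defs.col x) <? len (lower d) (Defs.row x)
    ... | yes p = <⇒≤ (lower⇒ {x} p)
    ... | no np = ≤-reflexive (skew-Y i np)

    lower⇐ : ∀ {x} → B x < Y (A x) → x ∈ₛ lower d
    lower⇐ {x} l with toℕ (Defs.col x) <? len (lower d) (Defs.row x)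
    ... | yes p = p
    ... | no np = ⊥-elim (<⇒≢ l (skew-Y (upper⇐ (<⇒≤ l)) np))

    plusGame : Game r c ν (suc μ)
    plusGame = record
      { P = P⁺ ; Y = Y ; Y-dec = diag-B d ; Y<m = s≤s (B≤ _)
      ; px = A ; py = B ; px≤ = A≤ ; p-inj = ax-inj ; box = λ l l′ → ax-box l (s≤s⁻¹ l′)
      ; F = Fwd ; F⇒ = fwd⇒ ; ⇒F = ⇒fwd
      ; _⊴_ = _≤_ ; enc = suc ; bump = _+ suc ν ; enc-≤ = λ _ _ → s≤s ; ≤-enc = λ _ _ → s≤s⁻¹ ; enc-bump = λ _ → refl
      ; In = _∈ₛ upper d ; In⇒ = upper⇒ ; ⇒In = upper⇐
      ; dbox = b d ; b-Y = B-b ; b-at = λ {a} l → τ a , A-b l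
      ; init = λ k → suc (toℕ (π ⟨$⟩ʳ k))
      ; init≡ = λ k → cong (λ z → suc (toℕ (π ⟨$⟩ʳ z))) (sym (trans (cong τ (diag-A d k)) (τ-σ k))) }

    Y⁻ : ℕ → ℕ
    Y⁻ i = μ ∸ Y (ν ∸ i)

    minusGame : Game r c ν (suc μ)
    minusGame = record
      { P = P⁻ ; Y = Y⁻
      ; Y-dec = λ {i} l → ∸-monoʳ-< (subst (λ z → Y z < Y (ν ∸ suc i)) (trans (sym (+-∸-assoc 1 l)) refl) (diag-B d {ν ∸ suc i} (≤-trans (≤-reflexive (trans (sym (+-∸-assoc 1 l)) refl)) (m∸n≤m ν i)))) (B≤ _)
      ; Y<m = s≤s (m∸n≤m μ (Y (ν ∸ 0)))
      ; px = λ x → ν ∸ A x ; py = λ x → μ ∸ B x ; px≤ = λ x → m∸n≤m ν (A x)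
      ; p-inj = λ {x} {y} p q → ax-inj (∸-cancelˡ-≡ (A≤ x) (A≤ y) p) (∸-cancelˡ-≡ (B≤ x) (B≤ y) q)
      ; box = λ {a} {j} l l′ → let (x , p , q) = ax-box (m∸n≤m ν a) (m∸n≤m μ j) in x , trans (cong (ν ∸_) p) (m∸[m∸n]≡n l) , trans (cong (μ ∸_) q) (m∸[m∸n]≡n (s≤s⁻¹ l′))
      ; F = λ x y → Fwd y x
      ; F⇒ = λ {x} {y} f → case fwd⇒ f of λ
          { (inj₁ (p , q)) → inj₁ (back (A≤ x) p , cong (μ ∸_) (sym q)) ; (inj₂ (p , q)) → inj₂ (cong (ν ∸_) (sym p) , back (B≤ x) q) }
      ; ⇒F = λ {x} {y} → λ
          { (inj₁ (p , q)) → ⇒fwd (inj₁ (forth (A≤ x) (A≤ y) p , ∸-cancelˡ-≡ (B≤ x) (B≤ y) (sym q)))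
          ; (inj₂ (p , q)) → ⇒fwd (inj₂ (∸-cancelˡ-≡ (A≤ x) (A≤ y) (sym p) , forth (B≤ x) (B≤ y) q)) }
      ; _⊴_ = λ v u → u ≤ v ; enc = suc μ * suc ν ∸_ ; bump = _∸ suc ν
      ; enc-≤ = λ _ _ → ∸-monoʳ-≤ (suc μ * suc ν) ; ≤-enc = λ lu _ l → ≮⇒≥ λ l′ → <⇒≱ (∸-monoʳ-< l′ (<⇒≤ lu)) l
      ; enc-bump = λ u → sym (∸-+-assoc (suc μ * suc ν) u (suc ν))
      ; In = λ y → ¬ (y ∈ₛ lower d)
      ; In⇒ = λ {x} ni → ∸-monoʳ-≤ μ (≤-trans (≤-reflexive (cong Y (m∸[m∸n]≡n (A≤ x)))) (≮⇒≥ (ni ∘ lower⇐)))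
      ; ⇒In = λ {x} l i → <⇒≱ (∸-monoʳ-< (<-≤-trans (lower⇒ {x} i) (≤-reflexive (cong Y (sym (m∸[m∸n]≡n (A≤ x)))))) (B≤ _)) l
      ; dbox = b d ; b-Y = λ k → cong (μ ∸_) (trans (B-b k) (cong Y (sym (m∸[m∸n]≡n (A≤ (b d k))))))
      ; b-at = λ {a} l → τ (ν ∸ a) , trans (cong (ν ∸_) (A-b (m∸n≤m ν a))) (m∸[m∸n]≡n l)
      ; init = λ k → suc (toℕ (π ⟨$⟩ʳ k)) + μ * suc ν
      ; init≡ = λ k → start≡ k }
      where
      back : ∀ {N x y} → x ≤ N → x ≡ suc y → N ∸ y ≡ suc (N ∸ x)
      back l refl = trans (sym refl) (sym (trans (sym (+-∸-assoc 1 l)) refl))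
      forth : ∀ {N x y} → x ≤ N → y ≤ N → N ∸ y ≡ suc (N ∸ x) → x ≡ suc y
      forth {N} {x} {y} l l′ e = +-cancelˡ-≡ (N ∸ x) x (suc y) (trans (m∸n+n≡m l) (trans (sym (m∸n+n≡m l′)) (trans (cong (_+ y) e) (sym (+-suc (N ∸ x) y)))))
      start≡ : ∀ k → suc (toℕ (π ⟨$⟩ʳ k)) + μ * suc ν ≡ suc μ * suc ν ∸ (ν ∸ ω (ν ∸ (ν ∸ A (b d k))))
      start≡ k = sym (begin
        suc ν + μ * suc ν ∸ (ν ∸ ω (ν ∸ (ν ∸ A (b d k)))) ≡⟨ cong (λ z → suc ν + μ * suc ν ∸ (ν ∸ z)) ωk ⟩
        suc ν + μ * suc ν ∸ (ν ∸ x) ≡⟨ cong (_∸ (ν ∸ x)) (+-comm (suc ν) (μ * suc ν)) ⟩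
        μ * suc ν + suc ν ∸ (ν ∸ x) ≡⟨ +-∸-assoc (μ * suc ν) (≤-trans (m∸n≤m ν x) (n≤1+n ν)) ⟩
        μ * suc ν + (suc ν ∸ (ν ∸ x)) ≡⟨ cong (μ * suc ν +_) (trans (+-∸-assoc 1 (m∸n≤m ν x)) (cong suc (m∸[m∸n]≡n (Fin.toℕ≤pred[n] (π ⟨$⟩ʳ k))))) ⟩
        μ * suc ν + suc x ≡⟨ +-comm (μ * suc ν) (suc x) ⟩
        suc x + μ * suc ν ∎)
        where
        open ≡-Reasoning
        x = toℕ (π ⟨$⟩ʳ k)
        ωk : ω (ν ∸ (ν ∸ A (b d k))) ≡ x
        ωk = trans (cong ω (m∸[m∸n]≡n (A≤ (b d k)))) (cong (λ z → toℕ (π ⟨$⟩ʳ z)) (trans (cong τ (diag-A d k)) (τ-σ k)))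

    module PG = Game plusGame
    module MG = Game minusGame

    slide⇒ : ∀ {T x T′ g} → Slide T x T′ g → PG.GSlide T x T′ g
    slide⇒ (stop h) = PG.stop h
    slide⇒ (step y v f e h s) = PG.step y v f e h (slide⇒ s)

    slide⇐ : ∀ {T x T′ g} → PG.GSlide T x T′ g → Slide T x T′ g
    slide⇐ (PG.stop h) = stop h
    slide⇐ (PG.step y v f e h s) = step y v f e h (slide⇐ s)

    rslide⇒ : ∀ {T x T′ g} → RSlide T x T′ g → MG.GSlide T x T′ g
    rslide⇒ (stop h) = MG.stop h
    rslide⇒ (step y v f e h s) = MG.step y v f e h (rslide⇒ s)

    rslide⇐ : ∀ {T x T′ g} → MG.GSlide T x T′ g → RSlide T x T′ g
    rslide⇐ (MG.stop h) = stop h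
    rslide⇐ (MG.step y v f e h s) = step y v f e h (rslide⇐ s)

    corner⇒ : ∀ {T x} → Plus.Corner d T x → PG.GCor T x
    corner⇒ ((i , e) , yg) = i , e , λ y z p q iy ey ne → let (p′ , q′) = ⇒le p q ; ((_ , t) , ne′) = yg _ _ _ _ p′ q′ ((iy , ey) , ne) in t , ne′

    corner⇐ : ∀ {T x} → PG.GCor T x → Plus.Corner d T x
    corner⇐ (i , e , h) = (i , e) , λ y₁ z₁ y₂ z₂ p q ((iy , ey) , ne) → let (p′ , q′) = le⇒ p q ; (t , ne′) = h (y₁ , y₂) (z₁ , z₂) p′ q′ iy ey ne in (∈ₛ-young (upper d) p q iy , t) , ne′

    addable⇒ : ∀ {T x} → Minus.Addable (suc μ) d T x → MG.GCor T x
    addable⇒ {T} {x} (nx , yg) = nx ∘ inj₁ , empty x (nx ∘ inj₂) , λ y z p q iy ey ne →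
        let (p′ , q′) = ⇒le {y} {z} (∸-cancelˡ-≤′ (A≤ y) p) (∸-cancelˡ-≤′ (B≤ y) q)
        in empty z (λ f → outside iy ey ne (yg _ _ _ _ p′ q′ (inj₁ (inj₂ f)))) , λ e → outside iy ey ne (yg _ _ _ _ p′ q′ (inj₂ e))
      where
      outside : ∀ {y} → ¬ (y ∈ₛ lower d) → T y ≡ nothing → y ≢ x → ¬ (Minus.ν (suc μ) d T y ⊎ y ≡ x)
      outside iy ey ne (inj₁ (inj₁ l)) = iy l
      outside iy ey ne (inj₁ (inj₂ (v , t))) = case trans (sym ey) t of λ ()
      outside iy ey ne (inj₂ e) = ne e
      empty : ∀ y → ¬ Filled T y → T y ≡ nothing
      empty y nf with T y
      ... | nothing = refl
      ... | just v = ⊥-elim (nf (v , refl))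
      ∸-cancelˡ-≤′ : ∀ {N x y} → x ≤ N → N ∸ y ≤ N ∸ x → x ≤ y
      ∸-cancelˡ-≤′ l p = ≮⇒≥ λ l′ → <⇒≱ (∸-monoʳ-< l′ l) p

    addable⇐ : ∀ {T x} → MG.GCor T x → Minus.Addable (suc μ) d T x
    addable⇐ {T} {x} (nl , e , h) = (λ { (inj₁ l) → nl l ; (inj₂ (v , t)) → case trans (sym e) t of λ () }) ,
        λ i i′ j j′ p q → close (i , j) (i′ , j′) p q
      where
      close : ∀ y z → toℕ (Defs.row z) ≤ toℕ (Defs.row y) → toℕ (Defs.col z) ≤ toℕ (Defs.col y) →
              Minus.ν (suc μ) d T y ⊎ y ≡ x → Minus.ν (suc μ) d T z ⊎ z ≡ x
      close y z p q py with toℕ (Defs.col z) <? len (lower d) (Defs.row z) | T z in eq | z ≟B x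
      ... | yes l | _ | _ = inj₁ (inj₁ l)
      ... | no _ | just v | _ = inj₁ (inj₂ (v , refl))
      ... | no _ | nothing | yes e = inj₂ e
      ... | no nz | nothing | no ne = ⊥-elim (case py of λ
              { (inj₁ (inj₁ l)) → nz (∈ₛ-young (lower d) p q l)
              ; (inj₁ (inj₂ (v , t))) → case trans (sym (proj₁ hy)) t of λ ()
              ; (inj₂ e) → proj₂ hy e })
        where
        pq = le⇒ {z} {y} p q
        hy = h z y (∸-monoʳ-≤ ν (proj₁ pq)) (∸-monoʳ-≤ μ (proj₂ pq)) nz eq ne

    run⇒ : ∀ {T T′} → Plus.Run d T T′ → PG.GRun T T′
    run⇒ (Plus.done h) = PG.done h
    run⇒ (Plus.more n (Plus.diag x k T′ co sl) run) = PG.more n (PG.diag x k T′ (corner⇒ co) (slide⇒ sl)) (run⇒ run)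
    run⇒ (Plus.more n (Plus.other x f T′ co sl ne) run) = PG.more n (PG.other x f T′ (corner⇒ co) (slide⇒ sl) ne) (run⇒ run)

    run⇐ : ∀ {T T′} → PG.GRun T T′ → Plus.Run d T T′
    run⇐ (PG.done h) = Plus.done h
    run⇐ (PG.more n (PG.diag x k T′ co sl) run) = Plus.more n (Plus.diag x k T′ (corner⇐ co) (slide⇐ sl)) (run⇐ run)
    run⇐ (PG.more n (PG.other x f T′ co sl ne) run) = Plus.more n (Plus.other x f T′ (corner⇐ co) (slide⇐ sl) ne) (run⇐ run)

    rrun⇒ : ∀ {T T′} → Minus.Run (suc μ) d T T′ → MG.GRun T T′
    rrun⇒ (Minus.done h) = MG.done h
    rrun⇒ (Minus.more n (Minus.diag x k T′ co sl) run) = MG.more n (MG.diag x k T′ (addable⇒ co) (rslide⇒ sl)) (rrun⇒ run)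
    rrun⇒ (Minus.more n (Minus.other x f T′ co sl ne) run) = MG.more n (MG.other x f T′ (addable⇒ co) (rslide⇒ sl) ne) (rrun⇒ run)

    rrun⇐ : ∀ {T T′} → MG.GRun T T′ → Minus.Run (suc μ) d T T′
    rrun⇐ (MG.done h) = Minus.done h
    rrun⇐ (MG.more n (MG.diag x k T′ co sl) run) = Minus.more n (Minus.diag x k T′ (addable⇐ co) (rslide⇐ sl)) (rrun⇐ run)
    rrun⇐ (MG.more n (MG.other x f T′ co sl ne) run) = Minus.more n (Minus.other x f T′ (addable⇐ co) (rslide⇐ sl) ne) (rrun⇐ run)

-- Gluing the two halves

module Final {r c ν m} (G : Game r c ν m) where
  open Game G
  open Play G
  open Per P hiding (val)
  module Tab = Tableau P

  module _ {T} (S : State ρ cy ∅₂) (rep : RepS T S) where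
    open State S
    module Fin′ = Tableau.Region.Final P m Y Y-dec Y<m S

    entry : ∀ {x} → In x → ∃ λ u → Pres u × T x ≡ just (enc u) × R u ≡ px x × C u ≡ py x
    entry {x} i = let (u , pu , ru , cu) = fill (In-Dom i) (λ ()) (λ ()) ; (y , ty , p , q) = Rep.from rep pu
                  in u , pu , subst (λ z → T z ≡ just (enc u)) (p-inj (trans p ru) (trans q cu)) ty , ru , cu

    box-of : ∀ {u} → Pres u → ∃ λ x → T x ≡ just (enc u) × px x ≡ R u × py x ≡ C u × py x ≤ Y (px x)
    box-of {u} pu = let (y , ty , p , q) = Rep.from rep pu
                    in y , ty , p , q , subst₂ (λ a j → j ≤ Y a) (sym p) (sym q) (proj₂ (Dom⇒ (u , R≤ u , C≤ u)))

    row-R : ∀ u → Tab.row u ≡ R u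
    row-R u = sym (Fin′.row≡ u)

    col-C : ∀ {u} → Pres u → Tab.col u ≡ C u
    col-C p = sym (Fin′.col≡ p)

    last : ℕ → ℕ
    last a = ê (w a)

    ê-last : ∀ u → ê u ≡ last (ρ u)
    ê-last u = ê-cx (sym (ρw (ρ≤ u)))

    last-R : ∀ {a} → a ≤ ν → R (last a) ≡ a
    last-R {a} l = trans (proj₁ (State.diag S (w a) (λ ()))) (ρw l)

    last-C : ∀ {a} → a ≤ ν → C (last a) ≡ Y a
    last-C {a} l = trans (proj₂ (State.diag S (w a) (λ ()))) (cong Y (ρw l))

    at-last : ∀ {u a} → a ≤ ν → Pres u → R u ≡ a → C u ≡ Y a → u ≡ last (ρ u)
    at-last {u} {a} l pu ru cu = trans u≡ (cong last (sym (trans (cong ρ u≡) (trans (ê-x (w a)) (ρw l)))))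
      where
      u≡ : u ≡ last a
      u≡ = same pu (ê-pres (w a)) (trans ru (sym (last-R l))) (trans cu (sym (last-C l)))

module Glue {r c ν μ} (ax : Axes r c ν μ) (π : Permutation (suc ν) (suc ν)) where
  open Axes ax
  open Words ax π
  module U = Tableau P⁺
  module V = Tableau P⁻
  open Per P⁺ using () renaming (asc to asc⁺; val to val⁺)
  open Per P⁻ using () renaming (asc to asc⁻; val to val⁻)

  ρ⁺ ρ⁻ : ℕ → ℕ
  ρ⁺ u = inv (u % suc ν)
  ρ⁻ u = ν ∸ inv (ν ∸ u % suc ν)

  ρ⁺≤ : ∀ u → ρ⁺ u ≤ ν
  ρ⁺≤ u = inv≤ (u % suc ν)

  ρ⁻≤ : ∀ u → ρ⁻ u ≤ ν
  ρ⁻≤ u = m∸n≤m ν (inv (ν ∸ u % suc ν))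

  -- The largest entry counted from 0. The forward number `u` and the backward number `u′` denote
  -- the same entry when they add up to `tot`.
  tot : ℕ
  tot = ν + μ * suc ν

  -- Reverse complementation keeps ascents and reverses their places, so those of the rotated
  -- permutation before `i` are those of the original from `ν ∸ i` on.
  asc-dual : ∀ i → i ≤ ν → asc⁻ i + asc⁺ (ν ∸ i) ≡ asc⁺ ν
  asc-dual zero l = refl
  asc-dual (suc i) l = begin
    b2n (lt (ν ∸ ω (ν ∸ i)) (ν ∸ ω (ν ∸ suc i))) + asc⁻ i + asc⁺ (ν ∸ suc i) ≡⟨ cong (λ z → b2n z + asc⁻ i + asc⁺ (ν ∸ suc i)) flip-lt ⟩
    b2n (lt (ω (ν ∸ suc i)) (ω (ν ∸ i))) + asc⁻ i + asc⁺ (ν ∸ suc i) ≡⟨ solve 3 (λ x y z → x :+ y :+ z := y :+ (x :+ z)) refl _ (asc⁻ i) (asc⁺ (ν ∸ suc i)) ⟩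
    asc⁻ i + (b2n (lt (ω (ν ∸ suc i)) (ω (ν ∸ i))) + asc⁺ (ν ∸ suc i)) ≡⟨ cong (λ z → asc⁻ i + (b2n (lt (ω (ν ∸ suc i)) (ω z)) + asc⁺ (ν ∸ suc i))) (∸-suc′ l) ⟩
    asc⁻ i + asc⁺ (suc (ν ∸ suc i)) ≡⟨ cong (λ z → asc⁻ i + asc⁺ z) (sym (∸-suc′ l)) ⟩
    asc⁻ i + asc⁺ (ν ∸ i) ≡⟨ asc-dual i (<⇒≤ l) ⟩
    asc⁺ ν ∎
    where
    open ≡-Reasoning
    open +-*-Solver
    flip-lt : lt (ν ∸ ω (ν ∸ i)) (ν ∸ ω (ν ∸ suc i)) ≡ lt (ω (ν ∸ suc i)) (ω (ν ∸ i))
    flip-lt with ω (ν ∸ suc i) <? ω (ν ∸ i)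
    ... | yes p = trans (lt-t (∸-monoʳ-< p (ω≤ (ν ∸ i)))) (sym (lt-t p))
    ... | no np = trans (lt-f (∸-monoʳ-≤ ν (≮⇒≥ np))) (sym (lt-f (≮⇒≥ np)))

  -- In the sum of the two instances of `q-formula` all ascent numbers cancel by two uses of
  -- `asc-dual`. This is the relation that makes the two infinite tableaux fit.
  q-dual : ∀ {a} → a ≤ ν → U.q a + V.q (ν ∸ a) ≡ ν
  q-dual {a} l = +-cancelʳ-≡ (asc⁺ a + asc⁻ (ν ∸ a)) _ _ (begin
    U.q a + V.q (ν ∸ a) + (asc⁺ a + asc⁻ (ν ∸ a)) ≡⟨ solve 4 (λ x y z t → x :+ y :+ (z :+ t) := (x :+ z) :+ (y :+ t)) refl (U.q a) (V.q (ν ∸ a)) (asc⁺ a) (asc⁻ (ν ∸ a)) ⟩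
    (U.q a + asc⁺ a) + (V.q (ν ∸ a) + asc⁻ (ν ∸ a)) ≡⟨ cong₂ _+_ (U.q-formula l) (trans (V.q-formula (m∸n≤m ν a)) (cong (λ z → ν ∸ a + asc⁻ z) νν)) ⟩
    (a + asc⁺ (ν ∸ a)) + (ν ∸ a + asc⁻ a) ≡⟨ solve 4 (λ x y z t → (x :+ y) :+ (z :+ t) := (x :+ z) :+ (t :+ y)) refl a (asc⁺ (ν ∸ a)) (ν ∸ a) (asc⁻ a) ⟩
    (a + (ν ∸ a)) + (asc⁻ a + asc⁺ (ν ∸ a)) ≡⟨ cong₂ _+_ (m+[n∸m]≡n l) (asc-dual a l) ⟩
    ν + asc⁺ ν ≡⟨ cong (ν +_) (sym (trans (cong (λ z → asc⁺ z + asc⁻ (ν ∸ a)) (sym νν)) (trans (+-comm (asc⁺ (ν ∸ (ν ∸ a))) _) (asc-dual (ν ∸ a) (m∸n≤m ν a))))) ⟩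
    ν + (asc⁺ a + asc⁻ (ν ∸ a)) ∎)
    where
    open ≡-Reasoning
    open +-*-Solver
    νν : ν ∸ (ν ∸ a) ≡ a
    νν = m∸[m∸n]≡n l

  private
    val-dual : ∀ {a t t′} → a ≤ ν → t + t′ ≡ μ → val⁺ a t + val⁻ (ν ∸ a) t′ ≡ tot
    val-dual {a} {t} {t′} l e = begin
      ω a + t * suc ν + (ν ∸ ω (ν ∸ (ν ∸ a)) + t′ * suc ν) ≡⟨ cong (λ z → ω a + t * suc ν + (ν ∸ ω z + t′ * suc ν)) (m∸[m∸n]≡n l) ⟩
      ω a + t * suc ν + (ν ∸ ω a + t′ * suc ν) ≡⟨ solve 5 (λ x t y t′ n → x :+ t :* n :+ (y :+ t′ :* n) := (x :+ y) :+ (t :+ t′) :* n) refl (ω a) t (ν ∸ ω a) t′ (suc ν) ⟩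
      (ω a + (ν ∸ ω a)) + (t + t′) * suc ν ≡⟨ cong₂ (λ x y → x + y * suc ν) (m+[n∸m]≡n (ω≤ a)) e ⟩
      tot ∎
      where
      open ≡-Reasoning
      open +-*-Solver

  -- On the band of the boxes that lie on some diagonal the two infinite tableaux agree.
  meet : ∀ {a j} → a ≤ ν → ν ∸ a ≤ j → j + a ≤ μ →
         ∃ λ u → ∃ λ u′ → u + u′ ≡ tot × U.row u ≡ a × U.col u ≡ j × V.row u′ ≡ ν ∸ a × V.col u′ ≡ μ ∸ j
  meet {a} {j} l lo hi = val⁺ a t , val⁻ (ν ∸ a) t′ , val-dual {a} {t} {t′} l tt , proj₁ dU , cU , proj₁ dV , cV
    where
    open +-*-Solver
    -- `deep` solved for the period in which class `a` reaches column `j`; `t′` is the same for the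
    -- rotated tableau.
    t = U.q a + (j ∸ (ν ∸ a))
    t′ = V.q (ν ∸ a) + (μ ∸ j ∸ a)
    a≤ : a ≤ μ ∸ j
    a≤ = m+n≤o⇒m≤o∸n a (≤-trans (≤-reflexive (+-comm a j)) hi)
    dU = U.deep {a} {t} l (m≤m+n _ _)
    dV = V.deep {ν ∸ a} {t′} (m∸n≤m ν a) (m≤m+n _ _)
    cU : U.col (val⁺ a t) ≡ j
    cU = +-cancelʳ-≡ (U.q a) _ _ (trans (proj₂ dU) (trans (+-assoc (U.q a) _ _) (trans (cong (U.q a +_) (m∸n+n≡m lo)) (+-comm (U.q a) j))))
    cV : V.col (val⁻ (ν ∸ a) t′) ≡ μ ∸ j
    cV = +-cancelʳ-≡ (V.q (ν ∸ a)) _ _ (trans (proj₂ dV) (trans (cong (t′ +_) (m∸[m∸n]≡n l)) (trans (+-assoc (V.q (ν ∸ a)) _ _) (trans (cong (V.q (ν ∸ a) +_) (m∸n+n≡m a≤)) (+-comm (V.q (ν ∸ a)) (μ ∸ j))))))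
    tt : t + t′ ≡ μ
    tt = +-cancelʳ-≡ ν _ _ (begin
      t + t′ + ν ≡⟨ cong (t + t′ +_) (sym (m∸n+n≡m l)) ⟩
      t + t′ + (ν ∸ a + a) ≡⟨ solve 6 (λ x y z s p q → (x :+ y) :+ (z :+ s) :+ (p :+ q) := (x :+ z) :+ ((y :+ p) :+ (s :+ q))) refl (U.q a) (j ∸ (ν ∸ a)) (V.q (ν ∸ a)) (μ ∸ j ∸ a) (ν ∸ a) a ⟩
      (U.q a + V.q (ν ∸ a)) + ((j ∸ (ν ∸ a) + (ν ∸ a)) + (μ ∸ j ∸ a + a)) ≡⟨ cong₂ _+_ (q-dual l) (cong₂ _+_ (m∸n+n≡m lo) (m∸n+n≡m a≤)) ⟩
      ν + (j + (μ ∸ j)) ≡⟨ cong (ν +_) (m+[n∸m]≡n (≤-trans (m≤m+n j a) hi)) ⟩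
      ν + μ ≡⟨ +-comm ν μ ⟩
      μ + ν ∎)
      where open ≡-Reasoning

  class-dual : ∀ {u u′} → u + u′ ≡ tot → ρ⁻ u′ ≡ ν ∸ ρ⁺ u
  class-dual {u} {u′} e = trans (cong ρ⁻ u′≡) (Per.ρ-val P⁻ (μ ∸ t) (m∸n≤m ν a))
    where
    a = ρ⁺ u
    t = u / suc ν
    t≤ : t ≤ μ
    t≤ = s≤s⁻¹ (Per.u<N*n⇒ P⁺ {u} {suc μ} (s≤s (≤-trans (m≤m+n u u′) (≤-reflexive e))))
    u′≡ : u′ ≡ val⁻ (ν ∸ a) (μ ∸ t)
    u′≡ = +-cancelˡ-≡ u _ _ (trans e (sym (trans (cong (_+ val⁻ (ν ∸ a) (μ ∸ t)) (Per.val-u P⁺ u)) (val-dual {a} {t} {μ ∸ t} (ρ⁺≤ u) (m+[n∸m]≡n t≤)))))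

  -- `e⁺` and `e⁻` are the diagonal entries of the two outputs. The inequality in `minus` is strict
  -- because the diagonal boxes take their entries from the first output; with `tops` the two ranges
  -- of each class then meet without gap or overlap.
  record Halves (T : Filling r c) : Set where
    field
      Y e⁺ e⁻ : ℕ → ℕ
      Y-lo : ∀ {i} → i ≤ ν → ν ∸ i ≤ Y i
      Y-hi : ∀ {i} → i ≤ ν → Y i + i ≤ μ
      Y-anti : ∀ {i j} → i ≤ j → j ≤ ν → Y j ≤ Y i
      tops : ∀ {a} → a ≤ ν → e⁺ a + e⁻ (ν ∸ a) ≡ tot
      plus : ∀ {x} → B x ≤ Y (A x) → ∃ λ u → u ≤ e⁺ (ρ⁺ u) × T x ≡ just (suc u) × U.row u ≡ A x × U.col u ≡ B x
      minus : ∀ {x} → Y (A x) < B x → ∃ λ u → u < e⁻ (ρ⁻ u) × T x ≡ just (suc tot ∸ u) × V.row u ≡ ν ∸ A x × V.col u ≡ μ ∸ B x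
      plus⁻¹ : ∀ {u} → u ≤ e⁺ (ρ⁺ u) → ∃ λ x → T x ≡ just (suc u)
      minus⁻¹ : ∀ {u} → u < e⁻ (ρ⁻ u) → ∃ λ x → T x ≡ just (suc tot ∸ u)

  private
    comp : ∀ {u u′} → u + u′ ≡ tot → suc tot ∸ u′ ≡ suc u
    comp {u} {u′} e = trans (cong (λ z → suc z ∸ u′) (sym e)) (m+n∸n≡m (suc u) u′)

    rot-inj : ∀ {x y} → ν ∸ A x ≡ ν ∸ A y → μ ∸ B x ≡ μ ∸ B y → x ≡ y
    rot-inj {x} {y} p q = ax-inj (∸-cancelˡ-≡ (A≤ x) (A≤ y) p) (∸-cancelˡ-≡ (B≤ x) (B≤ y) q)

  module _ {T} (H : Halves T) where
    open Halves H

    e⁺≤ : ∀ u → e⁺ (ρ⁺ u) ≤ tot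
    e⁺≤ u = ≤-trans (m≤m+n _ _) (≤-reflexive (tops (ρ⁺≤ u)))

    e⁻≤ : ∀ u → e⁻ (ρ⁻ u) ≤ tot
    e⁻≤ u = ≤-trans (m≤n+m _ _) (≤-reflexive (trans (cong (λ z → e⁺ (ν ∸ ρ⁻ u) + e⁻ z) (sym (m∸[m∸n]≡n (ρ⁻≤ u)))) (tops (m∸n≤m ν (ρ⁻ u)))))

    ranged : ∀ x → ∃ λ v → T x ≡ just v × 1 ≤ v × v ≤ suc tot
    ranged x with B x ≤? Y (A x)
    ... | yes i = let (u , lu , t , _) = plus i in suc u , t , s≤s z≤n , s≤s (≤-trans lu (e⁺≤ u))
    ... | no ni = let (u , lu , t , _) = minus (≰⇒> ni) in suc tot ∸ u , t , m<n⇒0<n∸m (s≤s (≤-trans (<⇒≤ lu) (e⁻≤ u))) , m∸n≤m (suc tot) u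

    exclusive : ∀ {u u′} → u ≤ e⁺ (ρ⁺ u) → u′ < e⁻ (ρ⁻ u′) → suc u ≢ suc tot ∸ u′
    exclusive {u} {u′} lu lu′ q = <⇒≢ (+-mono-≤-< lu (<-≤-trans lu′ (≤-reflexive (cong e⁻ (class-dual {u} {u′} e))))) (trans e (sym (tops (ρ⁺≤ u))))
      where
      e : u + u′ ≡ tot
      e = suc-injective (trans (cong (_+ u′) q) (m∸n+n≡m (≤-trans (<⇒≤ lu′) (≤-trans (e⁻≤ u′) (n≤1+n tot)))))

    injective : ∀ {x y v} → T x ≡ just v → T y ≡ just v → x ≡ y
    injective {x} {y} p q with B x ≤? Y (A x) | B y ≤? Y (A y)
    ... | yes i | yes i′ = let (u , lu , t , a , j) = plus i ; (u′ , lu′ , t′ , a′ , j′) = plus i′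
                               e = suc-injective (just-injective (trans (sym t) (trans p (trans (sym q) t′))))
                           in ax-inj (trans (sym a) (trans (cong U.row e) a′)) (trans (sym j) (trans (cong U.col e) j′))
    ... | no i | no i′ = let (u , lu , t , a , j) = minus (≰⇒> i) ; (u′ , lu′ , t′ , a′ , j′) = minus (≰⇒> i′)
                             e = ∸-cancelˡ-≡ (≤-trans (<⇒≤ lu) (≤-trans (e⁻≤ u) (n≤1+n tot))) (≤-trans (<⇒≤ lu′) (≤-trans (e⁻≤ u′) (n≤1+n tot))) (just-injective (trans (sym t) (trans p (trans (sym q) t′))))
                         in rot-inj (trans (sym a) (trans (cong V.row e) a′)) (trans (sym j) (trans (cong V.col e) j′))
    ... | yes i | no i′ = let (u , lu , t , _) = plus i ; (u′ , lu′ , t′ , _) = minus (≰⇒> i′)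
                          in ⊥-elim (exclusive lu lu′ (just-injective (trans (sym t) (trans p (trans (sym q) t′)))))
    ... | no i | yes i′ = let (u , lu , t , _) = minus (≰⇒> i) ; (u′ , lu′ , t′ , _) = plus i′
                          in ⊥-elim (exclusive lu′ lu (just-injective (trans (sym t′) (trans q (trans (sym p) t)))))

    surjective : ∀ u → u ≤ tot → ∃ λ x → T x ≡ just (suc u)
    surjective u l with u ≤? e⁺ (ρ⁺ u)
    ... | yes p = plus⁻¹ p
    ... | no np = let (x , t) = minus⁻¹ {tot ∸ u} small in x , trans t (cong just (comp e))
      where
      e : u + (tot ∸ u) ≡ tot
      e = m+[n∸m]≡n l
      small : tot ∸ u < e⁻ (ρ⁻ (tot ∸ u))
      small = +-cancelˡ-< (e⁺ (ρ⁺ u)) _ _ (<-≤-trans (+-monoˡ-< (tot ∸ u) (≰⇒> np)) (≤-reflexive (trans e (sym (trans (cong (λ z → e⁺ (ρ⁺ u) + e⁻ z) (class-dual {u} e)) (tops (ρ⁺≤ u)))))))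

    -- The diagonal separates the two boxes. Follow it down until it passes column `j′`: there its
    -- own box or the box of the row in column `j′` lies in the band, and between the two given
    -- boxes.
    between : ∀ d {a j j′} → d + a ≤ ν → j ≤ j′ → j ≤ Y a → Y (d + a) < j′ →
              ∃ λ i → ∃ λ k → a ≤ i × i ≤ d + a × j ≤ k × k ≤ j′ × ν ∸ i ≤ k × k + i ≤ μ
    between d {a} {j} {j′} l jj jY Y< with Y a <? j′
    ... | yes p = a , Y a , ≤-refl , m≤n+m a d , jY , <⇒≤ p , Y-lo (≤-trans (m≤n+m a d) l) , Y-hi (≤-trans (m≤n+m a d) l)
    between zero l jj jY Y< | no np = ⊥-elim (np Y<)
    between (suc d) {a} {j} {j′} l jj jY Y< | no np with Y (suc a) <? j′
    ... | yes p = a , j′ , ≤-refl , m≤n+m a (suc d) , jj , ≤-refl , ≤-trans (≤-reflexive (∸-suc′ sa)) (≤-trans (s≤s (Y-lo sa)) p) ,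
                  ≤-trans (+-monoˡ-≤ a (≮⇒≥ np)) (Y-hi (≤-trans (n≤1+n a) sa))
      where
      sa : suc a ≤ ν
      sa = ≤-trans (s≤s (m≤n+m a d)) l
    ... | no np′ = let (i , k , p₁ , p₂ , rest) = between d {suc a} (≤-trans (≤-reflexive (+-suc d a)) l) jj (≤-trans jj (≮⇒≥ np′)) (subst (λ z → Y z < j′) (sym (+-suc d a)) Y<)
                   in i , k , ≤-trans (n≤1+n a) p₁ , ≤-trans p₂ (≤-reflexive (+-suc d a)) , rest

    -- Across the diagonal neither infinite tableau contains both entries in question, so they are
    -- compared through a box of the band, where the two tableaux show the same entry.
    weakly : ∀ {x y v v′} → A x ≤ A y → B x ≤ B y → T x ≡ just v → T y ≡ just v′ → v ≤ v′
    weakly {x} {y} {v} {v′} la lb tx ty with B x ≤? Y (A x) | B y ≤? Y (A y)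
    ... | yes i | yes i′ = let (u , lu , t , a , j) = plus i ; (u′ , lu′ , t′ , a′ , j′) = plus i′
                           in subst₂ _≤_ (just-injective (trans (sym t) tx)) (just-injective (trans (sym t′) ty))
                                (s≤s (U.pos-ord (subst₂ _≤_ (sym a) (sym a′) la) (subst₂ _≤_ (sym j) (sym j′) lb)))
    ... | no i | no i′ = let (u , lu , t , a , j) = minus (≰⇒> i) ; (u′ , lu′ , t′ , a′ , j′) = minus (≰⇒> i′)
                         in subst₂ _≤_ (just-injective (trans (sym t) tx)) (just-injective (trans (sym t′) ty))
                              (∸-monoʳ-≤ (suc tot) (V.pos-ord (subst₂ _≤_ (sym a′) (sym a) (∸-monoʳ-≤ ν la)) (subst₂ _≤_ (sym j′) (sym j) (∸-monoʳ-≤ μ lb))))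
    ... | no i | yes i′ = ⊥-elim (<⇒≱ (≰⇒> i) (≤-trans lb (≤-trans i′ (Y-anti la (A≤ y)))))
    ... | yes i | no i′ =
      let (p , k , p≥ , p≤ , k≥ , k≤ , lo , hi) = between (A y ∸ A x) {A x} (≤-trans (≤-reflexive (m∸n+n≡m la)) (A≤ y)) lb i (subst (λ z → Y z < B y) (sym (m∸n+n≡m la)) (≰⇒> i′))
          p≤′ = ≤-trans p≤ (≤-reflexive (m∸n+n≡m la))
          (ū , ū′ , e , a , j , a′ , j′) = meet (≤-trans p≤′ (A≤ y)) lo hi
          (u , _ , t , au , ju) = plus i
          (u′ , _ , t′ , au′ , ju′) = minus (≰⇒> i′)
      in subst₂ _≤_ (just-injective (trans (sym t) tx)) (just-injective (trans (sym t′) ty))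
           (≤-trans (s≤s (U.pos-ord (subst₂ _≤_ (sym au) (sym a) p≥) (subst₂ _≤_ (sym ju) (sym j) k≥)))
             (≤-trans (≤-reflexive (sym (comp e))) (∸-monoʳ-≤ (suc tot) (V.pos-ord (subst₂ _≤_ (sym au′) (sym a′) (∸-monoʳ-≤ ν p≤′)) (subst₂ _≤_ (sym ju′) (sym j′) (∸-monoʳ-≤ μ k≤))))))

    increasing : ∀ {x y v v′} → A x ≤ A y → B x ≤ B y → x ≢ y → T x ≡ just v → T y ≡ just v′ → v < v′
    increasing la lb ne tx ty = ≤∧≢⇒< (weakly la lb tx ty) λ { refl → ne (injective tx ty) }

    standard : SYT T
    standard = (λ x → subst (λ z → ∃ λ v → T x ≡ just v × 1 ≤ v × v ≤ z) (sym size) (ranged x)) ,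
      (λ { (suc u) _ l → let (x , t) = surjective u (s≤s⁻¹ (≤-trans l (≤-reflexive size))) in x , t , λ y t′ → injective t′ t }) ,
      (λ i j j′ v v′ l t t′ → let (p , q) = le⇒ {i , j} {i , j′} ≤-refl (<⇒≤ l) in increasing p q (λ e → <⇒≢ l (cong (toℕ ∘ proj₂) e)) t t′) ,
      λ i i′ j v v′ l t t′ → let (p , q) = le⇒ {i , j} {i′ , j} (<⇒≤ l) ≤-refl in increasing p q (λ e → <⇒≢ l (cong (toℕ ∘ proj₁) e)) t t′

  -- A box beyond one diagonal but not beyond the other satisfies both limits of the band, so `meet`
  -- applies to it.
  mixed : ∀ {T T′ x} (H : Halves T) (H′ : Halves T′) → B x ≤ Halves.Y H (A x) → Halves.Y H′ (A x) < B x → T x ≡ T′ x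
  mixed {x = x} H H′ i i′ =
    let (u , _ , t , au , ju) = Halves.plus H i ; (u′ , _ , t′ , au′ , ju′) = Halves.minus H′ i′
        (ū , ū′ , e , a , j , a′ , j′) = meet (A≤ x) (≤-trans (Halves.Y-lo H′ (A≤ x)) (<⇒≤ i′)) (≤-trans (+-monoˡ-≤ (A x) i) (Halves.Y-hi H (A≤ x)))
    in trans t (trans (cong just (trans (cong suc (U.pos-inj (trans au (sym a)) (trans ju (sym j)))) (trans (sym (comp e)) (cong (suc tot ∸_) (V.pos-inj (trans a′ (sym au′)) (trans j′ (sym ju′))))))) (sym t′))

  independent : ∀ {T T′} → Halves T → Halves T′ → ∀ x → T x ≡ T′ x
  independent {T} {T′} H H′ x with B x ≤? Halves.Y H (A x) | B x ≤? Halves.Y H′ (A x)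
  ... | yes i | yes i′ = let (u , lu , t , a , j) = Halves.plus H i ; (u′ , lu′ , t′ , a′ , j′) = Halves.plus H′ i′
                         in trans t (trans (cong (just ∘ suc) (U.pos-inj (trans a (sym a′)) (trans j (sym j′)))) (sym t′))
  ... | no i | no i′ = let (u , lu , t , a , j) = Halves.minus H (≰⇒> i) ; (u′ , lu′ , t′ , a′ , j′) = Halves.minus H′ (≰⇒> i′)
                       in trans t (trans (cong (λ z → just (suc tot ∸ z)) (V.pos-inj (trans a (sym a′)) (trans j (sym j′)))) (sym t′))
  ... | yes i | no i′ = mixed H H′ i (≰⇒> i′)
  ... | no i | yes i′ = sym (mixed H′ H i′ (≰⇒> i))

  module _ (d : Diagonal r c (suc ν)) where
    open OnDiagonal d
    private
      module PP = Play plusGame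
      module PM = Play minusGame
      module FP = Final plusGame
      module FM = Final minusGame

    module _ {T T⁺ T⁻ : Filling r c} (S⁺ : State ρ⁺ PP.cy ∅₂) (r⁺ : PP.RepS T⁺ S⁺) (S⁻ : State ρ⁻ PM.cy ∅₂) (r⁻ : PM.RepS T⁻ S⁻)
             (glue : ∀ x → (x ∈ₛ upper d → T x ≡ T⁺ x) × (¬ (x ∈ₛ upper d) → T x ≡ T⁻ x)) where
      private
        e⁺ = FP.last S⁺ r⁺
        e⁻ = FM.last S⁻ r⁻

        νν : ∀ {a} → a ≤ ν → ν ∸ (ν ∸ a) ≡ a
        νν = m∸[m∸n]≡n

        diag⁻ : ∀ {u x} → State.Pres S⁻ u → State.R S⁻ u ≡ ν ∸ A x → State.C S⁻ u ≡ μ ∸ B x → B x ≡ Y (A x) → u ≡ e⁻ (ρ⁻ u)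
        diag⁻ {u} {x} pu ru cu e = FM.at-last S⁻ r⁻ (m∸n≤m ν (A x)) pu ru (trans cu (cong (μ ∸_) (trans e (cong Y (sym (νν (A≤ x)))))))

        diag⁻′ : ∀ {u x} → u ≡ e⁻ (ρ⁻ u) → State.R S⁻ u ≡ ν ∸ A x → State.C S⁻ u ≡ μ ∸ B x → B x ≡ Y (A x)
        diag⁻′ {u} {x} e ru cu = ∸-cancelˡ-≡ (B≤ x) (B≤ _) (trans (sym cu) (trans (cong (State.C S⁻) e)
            (trans (FM.last-C S⁻ r⁻ (ρ⁻≤ u)) (cong (λ z → μ ∸ Y z) (trans (cong (ν ∸_) ρu) (νν (A≤ x)))))))
          where
          ρu : ρ⁻ u ≡ ν ∸ A x
          ρu = trans (sym (FM.last-R S⁻ r⁻ (ρ⁻≤ u))) (trans (cong (State.R S⁻) (sym e)) ru)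

        -- Both outputs contain the diagonal boxes, and these lie in the band, where `meet`
        -- determines the two entries.
        tops : ∀ {a} → a ≤ ν → e⁺ a + e⁻ (ν ∸ a) ≡ tot
        tops {a} l = let (u , u′ , e , ru , cu , rv , cv) = meet l (PP.Y-lo l) (s≤s⁻¹ (PP.Y-hi l))
                         p⁺ = State.ê-pres S⁺ (ω a)
                         p⁻ = State.ê-pres S⁻ (ν ∸ ω (ν ∸ (ν ∸ a)))
                     in trans (cong₂ _+_
                          (U.pos-inj (trans (FP.row-R S⁺ r⁺ (e⁺ a)) (trans (FP.last-R S⁺ r⁺ l) (sym ru))) (trans (FP.col-C S⁺ r⁺ p⁺) (trans (FP.last-C S⁺ r⁺ l) (sym cu))))
                          (V.pos-inj (trans (FM.row-R S⁻ r⁻ (e⁻ (ν ∸ a))) (trans (FM.last-R S⁻ r⁻ (m∸n≤m ν a)) (sym rv)))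
                            (trans (FM.col-C S⁻ r⁻ p⁻) (trans (FM.last-C S⁻ r⁻ (m∸n≤m ν a)) (trans (cong (λ z → μ ∸ Y z) (νν l)) (sym cv)))))) e

      halves : Halves T
      halves = record
        { Y = Y ; e⁺ = e⁺ ; e⁻ = e⁻ ; Y-lo = PP.Y-lo ; Y-hi = λ l → s≤s⁻¹ (PP.Y-hi l) ; Y-anti = PP.Y-anti ; tops = tops
        ; plus = λ {x} l → let i = upper⇐ l ; (u , pu , t , ru , cu) = FP.entry S⁺ r⁺ i
                           in u , ≤-trans pu (≤-reflexive (FP.ê-last S⁺ r⁺ u)) , trans (proj₁ (glue x) i) t , trans (FP.row-R S⁺ r⁺ u) ru , trans (FP.col-C S⁺ r⁺ pu) cu
        ; minus = λ {x} l → let ni = λ i → <⇒≱ l (upper⇒ i) ; (u , pu , t , ru , cu) = FM.entry S⁻ r⁻ {x} (λ i → <-asym l (lower⇒ i))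
                            in u , ≤∧≢⇒< (≤-trans pu (≤-reflexive (FM.ê-last S⁻ r⁻ u))) (λ e → <⇒≢ l (sym (diag⁻′ {u} {x} e ru cu))) ,
                               trans (proj₂ (glue x) ni) t , trans (FM.row-R S⁻ r⁻ u) ru , trans (FM.col-C S⁻ r⁻ pu) cu
        ; plus⁻¹ = λ {u} l → let (x , t , p , q , i) = FP.box-of S⁺ r⁺ (≤-trans l (≤-reflexive (sym (FP.ê-last S⁺ r⁺ u)))) in x , trans (proj₁ (glue x) (upper⇐ i)) t
        ; minus⁻¹ = λ {u} l → let pu = ≤-trans (<⇒≤ l) (≤-reflexive (sym (FM.ê-last S⁻ r⁻ u)))
                                  (x , t , p , q , i) = FM.box-of S⁻ r⁻ pu
                                  le : Y (A x) ≤ B x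
                                  le = subst (λ z → Y z ≤ B x) (νν (A≤ x)) (unrotate (B≤ _) i)
                              in x , trans (proj₂ (glue x) λ iu → <⇒≢ l (diag⁻ {u} {x} pu (sym p) (sym q) (≤-antisym (upper⇒ iu) le))) t }
        where
        unrotate : ∀ {N x y} → y ≤ N → N ∸ x ≤ N ∸ y → y ≤ x
        unrotate l p = ≮⇒≥ λ l′ → <⇒≱ (∸-monoʳ-< l′ l) p

    TW-halves : ∀ {T} → TW (suc μ) d π T → Halves T
    TW-halves (T⁺ , T⁻ , (T₀ , i , run) , (T₀′ , i′ , run′) , glue) =
      let (S⁺ , r⁺) = PP.final (T₀ , i , run⇒ run) ; (S⁻ , r⁻) = PM.final (T₀′ , i′ , rrun⇒ run′) in halves S⁺ r⁺ S⁻ r⁻ glue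

    TW-exists : ∃ λ T → TW (suc μ) d π T
    TW-exists = let (T⁺ , T₀ , i , run) = PP.output-exists ; (T⁻ , T₀′ , i′ , run′) = PM.output-exists
                in T T⁺ T⁻ , T⁺ , T⁻ , (T₀ , i , run⇐ run) , (T₀′ , i′ , rrun⇐ run′) , λ x → on T⁺ T⁻ x , off T⁺ T⁻ x
      where
      dec : ∀ (x : Box r c) → Dec (x ∈ₛ upper d)
      dec x = toℕ (proj₂ x) <? len (upper d) (proj₁ x)
      T : Filling r c → Filling r c → Filling r c
      T T⁺ T⁻ x = if does (dec x) then T⁺ x else T⁻ x
      on : ∀ T⁺ T⁻ x → x ∈ₛ upper d → T T⁺ T⁻ x ≡ T⁺ x
      on T⁺ T⁻ x i = cong (λ z → if z then T⁺ x else T⁻ x) (dec-true (dec x) i)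
      off : ∀ T⁺ T⁻ x → ¬ (x ∈ₛ upper d) → T T⁺ T⁻ x ≡ T⁻ x
      off T⁺ T⁻ x n = cong (λ z → if z then T⁺ x else T⁻ x) (dec-false (dec x) n)

  conclude : ((d : Diagonal r c (suc ν)) → ∃ λ T → TW (suc μ) d π T) ×
             ((d : Diagonal r c (suc ν)) → ∀ T → TW (suc μ) d π T → SYT T) ×
             ((d d′ : Diagonal r c (suc ν)) → ∀ T T′ → TW (suc μ) d π T → TW (suc μ) d′ π T′ → ∀ x → T x ≡ T′ x)
  conclude = TW-exists , (λ d T tw → standard (TW-halves d tw)) , λ d d′ T T′ tw tw′ → independent (TW-halves d tw) (TW-halves d′ tw′)

theorem1p2 : ∀ (n m r c : ℕ) → 1 ≤ n → n ≤ m →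
    ((r ≡ n × c ≡ m) ⊎ (r ≡ m × c ≡ n)) →
    (w : Permutation n n) →
    ((d : Diagonal r c n) → ∃[ T ] TW m d w T) ×
    ((d : Diagonal r c n) → ∀ T → TW m d w T → SYT T) ×
    ((d d′ : Diagonal r c n) → ∀ T T′ → TW m d w T → TW m d′ w T′ →
       ∀ x → T x ≡ T′ x)
theorem1p2 (suc ν) (suc μ) r c _ _ (inj₁ (refl , refl)) w = Glue.conclude (rowAxes ν μ) w
theorem1p2 (suc ν) (suc μ) r c _ _ (inj₂ (refl , refl)) w = Glue.conclude (colAxes ν μ) w
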